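{- Let $N_1(n,k)$ be the number of $n$-bit partial Boolean functions that depend on $k$ bits and have exact quantum query complexity $1$ (i.e. are non-constant and can be computed exactly by a quantum 1-query algorithm). If $n\ge3$ and $k\ge2$, then $$N_1(n,k)\le n^2\,2^{2^{n-1}(1+2^{2-k})+2n^2}.$$
   Context: An $n$-bit partial Boolean function is a map $f:D\to\{0,1\}$ with $D\subseteq\{0,1\}^n$ (equivalently a string in $\{0,1,*\}^{2^n}$). $f$ depends on $k$ bits if $k$ is the minimum, over all multilinear polynomials $p$ with $p(x)=f(x)$ for all $x\in D$, of the number of variables occurring in $p$. A quantum 1-query algorithm works in a finite-dimensional Hilbert space with orthonormal basis $\{|i,j'\rangle\}$, $i\in\{0,\dots,n\}$; the oracle is $O_x|i,j'\rangle=(-1)^{x_i}|i,j'\rangle$ for $i\ge1$, $O_x|0,j'\rangle=|0,j'\rangle$; the algorithm applies input-independent unitaries $U_0,O_x,U_1$ to an initial state and performs a projective measurement with outcomes in $\{0,1\}$; it computes $f$ exactly if for every $x\in D$ the outcome is $f(x)$ with probability 1. -}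

module Defs where

open import Algebra.Bundles.Raw using (RawRing)
import Algebra.Definitions.RawMonoid as RawMonoidDefs
open import Data.Bool.Base using (Bool; true; false; if_then_else_)
open import Data.Fin.Base using (Fin; zero; suc)
import Data.Fin.Properties as Fin
open import Data.Fin.Subset using (Subset; inside; outside; _∈_; ∣_∣)
open import Data.Integer.Base as ℤ using (ℤ; +_; -[1+_])
open import Data.Maybe.Base using (Maybe; just; nothing)
open import Data.Nat.Base as ℕ using (ℕ; zero; suc)
import Data.Nat.Properties as ℕ
open import Data.Product.Base using (Σ; ∃; _×_; _,_)
open import Data.Product.Properties using (≡-dec)
open import Data.Rational.Base as ℚ using (ℚ; 0ℚ; 1ℚ; ½)
import Data.Rational.Properties as ℚ
open import Data.Rational.Solver using (module +-*-Solver)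
open import Data.Rational.Unnormalised.Base as ℚᵘ using (ℚᵘ)
open import Data.Vec.Base using (Vec; []; _∷_; lookup)
open import Function.Base using (_∘_)
open import Function.Bundles using (_⇔_)
open import Level using (0ℓ)
open import Relation.Binary.Bundles using (Setoid)
open import Relation.Binary.PropositionalEquality
  using (_≡_; refl; sym; trans; cong; cong₂; subst; _→-setoid_)
open import Relation.Nullary.Decidable.Core using (does)
open import Relation.Nullary.Negation.Core using (¬_)

------------------------------------------------------------------------
-- Real numbers: Cauchy sequences of rationals

IsCauchy : (ℕ → ℚ) → Set
IsCauchy x = ∀ ε → 0ℚ ℚ.< ε →
  ∃ λ N → ∀ m n → N ℕ.≤ m → N ℕ.≤ n → ℚ.∣ x m ℚ.- x n ∣ ℚ.< ε

record ℝ : Set where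
  constructor mkℝ
  field
    seq    : ℕ → ℚ
    cauchy : IsCauchy seq
open ℝ public

infix 4 _≈_

_≈_ : ℝ → ℝ → Set
x ≈ y = ∀ ε → 0ℚ ℚ.< ε →
  ∃ λ N → ∀ n → N ℕ.≤ n → ℚ.∣ seq x n ℚ.- seq y n ∣ ℚ.< ε

private
  open +-*-Solver

  half-pos : ∀ {ε} → 0ℚ ℚ.< ε → 0ℚ ℚ.< ε ℚ.* ½
  half-pos {ε} 0<ε = subst (ℚ._< ε ℚ.* ½) (ℚ.*-zeroˡ ½) (ℚ.*-monoˡ-<-pos ½ 0<ε)

  half+half : ∀ ε → ε ℚ.* ½ ℚ.+ ε ℚ.* ½ ≡ ε
  half+half ε = trans (sym (ℚ.*-distribˡ-+ ε ½ ½)) (ℚ.*-identityʳ ε)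

  cast : ∀ {p q a b} → p ≡ q → a ≡ b → ℚ.∣ p ∣ ℚ.< a → ℚ.∣ q ∣ ℚ.< b
  cast refl refl p<a = p<a

  ∣+∣-bound : ∀ p q {a b} → ℚ.∣ p ∣ ℚ.< a → ℚ.∣ q ∣ ℚ.< b → ℚ.∣ p ℚ.+ q ∣ ℚ.< a ℚ.+ b
  ∣+∣-bound p q p<a q<b = ℚ.≤-<-trans (ℚ.∣p+q∣≤∣p∣+∣q∣ p q) (ℚ.+-mono-< p<a q<b)

  ∣*∣-bound : ∀ p q {a b} → ℚ.∣ p ∣ ℚ.< a → ℚ.∣ q ∣ ℚ.< b → ℚ.∣ p ℚ.* q ∣ ℚ.< a ℚ.* b
  ∣*∣-bound p q {a} {b} p<a q<b = subst (ℚ._< a ℚ.* b) (sym (ℚ.∣p*q∣≡∣p∣*∣q∣ p q))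
    (ℚ.≤-<-trans
      (ℚ.*-monoʳ-≤-nonNeg ℚ.∣ q ∣ {{ℚ.∣-∣-nonNeg q}} (ℚ.<⇒≤ p<a))
      (ℚ.*-monoʳ-<-pos a {{ℚ.positive (ℚ.≤-<-trans (ℚ.0≤∣p∣ p) p<a)}} q<b))

  EventuallyBelow : (ℕ → ℚ) → ℚ → Set
  EventuallyBelow x b = ∃ λ N → ∀ n → N ℕ.≤ n → ℚ.∣ x n ∣ ℚ.< b

  bounded : ∀ x → IsCauchy x → ∃ (EventuallyBelow x)
  bounded x cx with cx 1ℚ (ℚ.positive⁻¹ 1ℚ)
  ... | N , close = 1ℚ ℚ.+ (ℚ.∣ x N ∣ ℚ.+ 1ℚ) , N , λ n N≤n →
    cast (split (x n) (x N)) refl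
      (∣+∣-bound (x n ℚ.- x N) (x N) (close n N N≤n ℕ.≤-refl) (p<p+1 ℚ.∣ x N ∣))
    where
    split : ∀ p q → p ℚ.- q ℚ.+ q ≡ p
    split = solve 2 (λ p q → p :- q :+ q := p) refl
    p<p+1 : ∀ p → p ℚ.< p ℚ.+ 1ℚ
    p<p+1 p = subst (ℚ._< p ℚ.+ 1ℚ) (ℚ.+-identityʳ p)
      (ℚ.+-monoʳ-< p (ℚ.positive⁻¹ 1ℚ))

  const-cauchy : ∀ q → IsCauchy (λ _ → q)
  const-cauchy q ε 0<ε = 0 , λ _ _ _ _ →
    subst (λ t → ℚ.∣ t ∣ ℚ.< ε) (sym (ℚ.+-inverseʳ q)) 0<ε

  neg-cauchy : ∀ x → IsCauchy x → IsCauchy (λ n → ℚ.- x n)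
  neg-cauchy x cx ε 0<ε with cx ε 0<ε
  ... | N , close = N , λ m n N≤m N≤n →
    cast (swap (x m) (x n)) refl (close n m N≤n N≤m)
    where
    swap : ∀ p q → q ℚ.- p ≡ (ℚ.- p) ℚ.- (ℚ.- q)
    swap = solve 2 (λ p q → q :- p := (:- p) :- (:- q)) refl

  +-cauchy : ∀ x y → IsCauchy x → IsCauchy y → IsCauchy (λ n → x n ℚ.+ y n)
  +-cauchy x y cx cy ε 0<ε with cx (ε ℚ.* ½) (half-pos 0<ε) | cy (ε ℚ.* ½) (half-pos 0<ε)
  ... | N , closeˣ | M , closeʸ = N ℕ.⊔ M , λ m n m≥ n≥ →
    cast (regroup (x m) (x n) (y m) (y n)) (half+half ε)
      (∣+∣-bound (x m ℚ.- x n) (y m ℚ.- y n)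
        (closeˣ m n (ℕ.m⊔n≤o⇒m≤o N M m≥) (ℕ.m⊔n≤o⇒m≤o N M n≥))
        (closeʸ m n (ℕ.m⊔n≤o⇒n≤o N M m≥) (ℕ.m⊔n≤o⇒n≤o N M n≥)))
    where
    regroup : ∀ p q r s → (p ℚ.- q) ℚ.+ (r ℚ.- s) ≡ (p ℚ.+ r) ℚ.- (q ℚ.+ s)
    regroup = solve 4 (λ p q r s → (p :- q) :+ (r :- s) := (p :+ r) :- (q :+ s)) refl

  scaled : ∀ x → IsCauchy x → ∀ b → 0ℚ ℚ.< b → ∀ ε → 0ℚ ℚ.< ε →
    ∃ λ δ → b ℚ.* δ ≡ ε ×
      ∃ λ N → ∀ m n → N ℕ.≤ m → N ℕ.≤ n → ℚ.∣ x m ℚ.- x n ∣ ℚ.< δ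
  scaled x cx b 0<b ε 0<ε = δ , b*δ≡ε , cx δ 0<δ
    where
    instance
      b-pos : ℚ.Positive b
      b-pos = ℚ.positive 0<b
      b≢0 : ℚ.NonZero b
      b≢0 = ℚ.pos⇒nonZero b
    δ : ℚ
    δ = ℚ.1/ b ℚ.* ε
    b*δ≡ε : b ℚ.* δ ≡ ε
    b*δ≡ε = trans (sym (ℚ.*-assoc b (ℚ.1/ b) ε))
      (trans (cong (ℚ._* ε) (ℚ.*-inverseʳ b)) (ℚ.*-identityˡ ε))
    0<δ : 0ℚ ℚ.< δ
    0<δ = subst (ℚ._< δ) (ℚ.*-zeroʳ (ℚ.1/ b))
      (ℚ.*-monoʳ-<-pos (ℚ.1/ b) {{ℚ.1/pos⇒pos b}} 0<ε)

  below⇒0< : ∀ x {b} → EventuallyBelow x b → 0ℚ ℚ.< b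
  below⇒0< x (N , below) = ℚ.≤-<-trans (ℚ.0≤∣p∣ (x N)) (below N ℕ.≤-refl)

  *-cauchy : ∀ x y → IsCauchy x → IsCauchy y → IsCauchy (λ n → x n ℚ.* y n)
  *-cauchy x y cx cy ε 0<ε = combine (bounded x cx) (bounded y cy)
    where
    regroup : ∀ p q r s →
      p ℚ.* (r ℚ.- s) ℚ.+ s ℚ.* (p ℚ.- q) ≡ p ℚ.* r ℚ.- q ℚ.* s
    regroup = solve 4 (λ p q r s → p :* (r :- s) :+ s :* (p :- q) := p :* r :- q :* s) refl

    CloseBelow : (ℕ → ℚ) → ℚ → Set
    CloseBelow z b = ∃ λ δ → b ℚ.* δ ≡ ε ℚ.* ½ ×
      ∃ λ N → ∀ m n → N ℕ.≤ m → N ℕ.≤ n → ℚ.∣ z m ℚ.- z n ∣ ℚ.< δ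

    finish : ∀ {a b} → EventuallyBelow x a → EventuallyBelow y b →
      CloseBelow x b → CloseBelow y a →
      ∃ λ N → ∀ m n → N ℕ.≤ m → N ℕ.≤ n → ℚ.∣ x m ℚ.* y m ℚ.- x n ℚ.* y n ∣ ℚ.< ε
    finish (A , belowˣ) (B , belowʸ) (δ , bδ , N , closeˣ) (γ , aγ , M , closeʸ) =
      (A ℕ.⊔ B) ℕ.⊔ (N ℕ.⊔ M) , λ m n m≥ n≥ →
      let A⊔B≤m = ℕ.m⊔n≤o⇒m≤o (A ℕ.⊔ B) (N ℕ.⊔ M) m≥
          N⊔M≤m = ℕ.m⊔n≤o⇒n≤o (A ℕ.⊔ B) (N ℕ.⊔ M) m≥
          A⊔B≤n = ℕ.m⊔n≤o⇒m≤o (A ℕ.⊔ B) (N ℕ.⊔ M) n≥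
          N⊔M≤n = ℕ.m⊔n≤o⇒n≤o (A ℕ.⊔ B) (N ℕ.⊔ M) n≥
      in cast (regroup (x m) (x n) (y m) (y n)) (trans (cong₂ ℚ._+_ aγ bδ) (half+half ε))
        (∣+∣-bound (x m ℚ.* (y m ℚ.- y n)) (y n ℚ.* (x m ℚ.- x n))
          (∣*∣-bound (x m) (y m ℚ.- y n)
            (belowˣ m (ℕ.m⊔n≤o⇒m≤o A B A⊔B≤m))
            (closeʸ m n (ℕ.m⊔n≤o⇒n≤o N M N⊔M≤m) (ℕ.m⊔n≤o⇒n≤o N M N⊔M≤n)))
          (∣*∣-bound (y n) (x m ℚ.- x n)
            (belowʸ n (ℕ.m⊔n≤o⇒n≤o A B A⊔B≤n))
            (closeˣ m n (ℕ.m⊔n≤o⇒m≤o N M N⊔M≤m) (ℕ.m⊔n≤o⇒m≤o N M N⊔M≤n))))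

    combine : ∃ (EventuallyBelow x) → ∃ (EventuallyBelow y) →
      ∃ λ N → ∀ m n → N ℕ.≤ m → N ℕ.≤ n → ℚ.∣ x m ℚ.* y m ℚ.- x n ℚ.* y n ∣ ℚ.< ε
    combine (a , x<a) (b , y<b) = finish x<a y<b
      (scaled x cx b (below⇒0< y y<b) (ε ℚ.* ½) (half-pos 0<ε))
      (scaled y cy a (below⇒0< x x<a) (ε ℚ.* ½) (half-pos 0<ε))

ℝ-rawRing : RawRing 0ℓ 0ℓ
ℝ-rawRing = record
  { Carrier = ℝ
  ; _≈_     = _≈_
  ; _+_     = λ x y → mkℝ (λ n → seq x n ℚ.+ seq y n) (+-cauchy (seq x) (seq y) (cauchy x) (cauchy y))
  ; _*_     = λ x y → mkℝ (λ n → seq x n ℚ.* seq y n) (*-cauchy (seq x) (seq y) (cauchy x) (cauchy y))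
  ; -_      = λ x → mkℝ (λ n → ℚ.- seq x n) (neg-cauchy (seq x) (cauchy x))
  ; 0#      = mkℝ (λ _ → 0ℚ) (const-cauchy 0ℚ)
  ; 1#      = mkℝ (λ _ → 1ℚ) (const-cauchy 1ℚ)
  }

module ℝ-Ring = RawRing ℝ-rawRing
open RawMonoidDefs ℝ-Ring.+-rawMonoid public using () renaming (sum to sumℝ)
open RawMonoidDefs ℝ-Ring.*-rawMonoid public using () renaming (sum to productℝ)

------------------------------------------------------------------------
-- Complex numbers

record ℂ : Set where
  constructor _+i_
  field
    re im : ℝ
open ℂ public

ℂ-rawRing : RawRing 0ℓ 0ℓ
ℂ-rawRing = record
  { Carrier = ℂ
  ; _≈_     = λ z w → re z ≈ re w × im z ≈ im w
  ; _+_     = λ z w → (re z + re w) +i (im z + im w)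
  ; _*_     = λ z w → (re z * re w + - (im z * im w)) +i (re z * im w + im z * re w)
  ; -_      = λ z → (- re z) +i (- im z)
  ; 0#      = 0# +i 0#
  ; 1#      = 1# +i 0#
  }
  where open RawRing ℝ-rawRing hiding (_≈_)

module ℂ-Ring = RawRing ℂ-rawRing
open RawMonoidDefs ℂ-Ring.+-rawMonoid public using () renaming (sum to sumℂ)

conj : ℂ → ℂ
conj z = re z +i (ℝ-Ring.- im z)

∣_∣² : ℂ → ℝ
∣ z ∣² = re z ℝ-Ring.* re z ℝ-Ring.+ im z ℝ-Ring.* im z

------------------------------------------------------------------------
-- Partial Boolean functions

-- The value  nothing  means that the input lies outside the domain D.
PartialFunction : ℕ → Set
PartialFunction n = Vec Bool n → Maybe Bool

-- Equality of partial functions is pointwise.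
PartialFunction-setoid : ℕ → Setoid 0ℓ 0ℓ
PartialFunction-setoid n = Vec Bool n →-setoid Maybe Bool

Constant : ∀ {n} → PartialFunction n → Set
Constant f = ∃ λ b → ∀ x c → f x ≡ just c → c ≡ b

------------------------------------------------------------------------
-- Multilinear polynomials and dependence on k bits

-- The subset S indexes the coefficient of the monomial ∏_{i∈S} xᵢ.
Multilinear : ℕ → Set
Multilinear n = Subset n → ℝ

sumSubsets : ∀ {n} → (Subset n → ℝ) → ℝ
sumSubsets {zero}  g = g []
sumSubsets {suc n} g =
  sumSubsets (g ∘ (outside ∷_)) ℝ-Ring.+ sumSubsets (g ∘ (inside ∷_))

monomial : ∀ {n} → Subset n → (Fin n → ℝ) → ℝ
monomial S x = productℝ λ i → if lookup S i then x i else ℝ-Ring.1#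

eval : ∀ {n} → Multilinear n → (Fin n → ℝ) → ℝ
eval p x = sumSubsets λ S → p S ℝ-Ring.* monomial S x

bit : Bool → ℝ
bit b = if b then ℝ-Ring.1# else ℝ-Ring.0#

Represents : ∀ {n} → Multilinear n → PartialFunction n → Set
Represents p f = ∀ x b → f x ≡ just b → eval p (bit ∘ lookup x) ≈ bit b

Occurs : ∀ {n} → Fin n → Multilinear n → Set
Occurs i p = ∃ λ S → i ∈ S × ¬ (p S ≈ ℝ-Ring.0#)

HasVariableCount : ∀ {n} → Multilinear n → ℕ → Set
HasVariableCount {n} p m =
  Σ (Subset n) λ V → (∀ i → i ∈ V ⇔ Occurs i p) × ∣ V ∣ ≡ m

RepresentedWith : ∀ {n} → PartialFunction n → ℕ → Set
RepresentedWith f m = ∃ λ p → Represents p f × HasVariableCount p m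

DependsOnBits : ∀ {n} → PartialFunction n → ℕ → Set
DependsOnBits f k = RepresentedWith f k × (∀ m → RepresentedWith f m → k ℕ.≤ m)

------------------------------------------------------------------------
-- Quantum 1-query algorithms on n bits with workspace dimension w

module Hilbert (n w : ℕ) where

  open RawRing ℂ-rawRing

  Basis : Set
  Basis = Fin (suc n) × Fin w

  State Operator : Set
  State    = Basis → ℂ
  Operator = Basis → Basis → ℂ

  ∑ : (Basis → ℂ) → ℂ
  ∑ g = sumℂ λ i → sumℂ λ j → g (i , j)

  ‖_‖² : State → ℝ
  ‖ ψ ‖² = sumℝ λ i → sumℝ λ j → ∣ ψ (i , j) ∣²

  identity : Operator
  identity a b = if does (≡-dec Fin._≟_ Fin._≟_ a b) then 1# else 0#

  infixr 7 _·_ _⊚_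
  infixl 6 _⊞_
  infix  4 _≋_

  _·_ : Operator → State → State
  (A · ψ) a = ∑ λ b → A a b * ψ b

  _⊚_ _⊞_ : Operator → Operator → Operator
  (A ⊚ B) a c = ∑ λ b → A a b * B b c
  (A ⊞ B) a b = A a b + B a b

  _† : Operator → Operator
  (A †) a b = conj (A b a)

  _≋_ : Operator → Operator → Set
  A ≋ B = ∀ a b → RawRing._≈_ ℂ-rawRing (A a b) (B a b)

  IsUnitary : Operator → Set
  IsUnitary U = (U † ⊚ U ≋ identity) × (U ⊚ U † ≋ identity)

  IsOrthogonalProjection : Operator → Set
  IsOrthogonalProjection P = (P † ≋ P) × (P ⊚ P ≋ P)

  oracle : Vec Bool n → State → State
  oracle x ψ (zero  , j) = ψ (zero , j)
  oracle x ψ (suc i , j) = if lookup x i then - ψ (suc i , j) else ψ (suc i , j)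

record AlgorithmData (n : ℕ) : Set where
  field
    w : ℕ
  open Hilbert n w public
  field
    initial : State
    U₀ U₁   : Operator
    P       : Bool → Operator

  final : Vec Bool n → State
  final x = U₁ · oracle x (U₀ · initial)

  probability : Vec Bool n → Bool → ℝ
  probability x b = ‖ P b · final x ‖²

-- The axioms are kept out of the record because Agda normalises the types of
-- record fields, which is prohibitively slow for equations between operators.
IsOneQueryAlgorithm : ∀ {n} → AlgorithmData n → Set
IsOneQueryAlgorithm A =
    ‖ initial ‖² ≈ ℝ-Ring.1#
  × IsUnitary U₀
  × IsUnitary U₁
  × (∀ b → IsOrthogonalProjection (P b))
  × (P false ⊞ P true ≋ identity)
  where open AlgorithmData A

ComputesExactly : ∀ {n} → AlgorithmData n → PartialFunction n → Set
ComputesExactly A f = ∀ x b → f x ≡ just b → probability x b ≈ ℝ-Ring.1#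
  where open AlgorithmData A

ExactQuantumQueryComplexityOne : ∀ {n} → PartialFunction n → Set
ExactQuantumQueryComplexityOne {n} f =
  ¬ Constant f ×
  ∃ λ (A : AlgorithmData n) → IsOneQueryAlgorithm A × ComputesExactly A f

------------------------------------------------------------------------
-- Powers of two with integer and rational exponents

2^ℤ_ : ℤ → ℚᵘ
2^ℤ (+ m)      = (+ (2 ℕ.^ m)) ℚᵘ./ 1
2^ℤ (-[1+ m ]) = ((+ 1) ℚᵘ./ (2 ℕ.^ suc m)) {{ℕ.m^n≢0 2 (suc m)}}

-- m ≲ c ·2^ e  is the inequality  m ≤ c · 2^e  in ℝ.  For e = p / q with
-- q ≥ 1 both sides are nonnegative, so it is stated after taking q-th powers.
infix 4 _≲_·2^_

_≲_·2^_ : ℕ → ℕ → ℚᵘ → Set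
m ≲ c ·2^ e = compare (ℚᵘ.↥ e) (ℚᵘ.↧ₙ e)
  where
  compare : ℤ → ℕ → Set
  compare (+ p)      q = m ℕ.^ q ℕ.≤ c ℕ.^ q ℕ.* 2 ℕ.^ p
  compare (-[1+ p ]) q = m ℕ.^ q ℕ.* 2 ℕ.^ suc p ℕ.≤ c ℕ.^ q

{-# OPTIONS --safe #-}
-- If a one-query algorithm computes f exactly, the final states of a 0-input x
-- and a 1-input y are orthogonal.  With pᵢ the weight on |i,·⟩ before the query
-- this reads  Σ_{i=0}^n pᵢ sᵢ(x) sᵢ(y) = 0,  where sᵢ(x) = (-1)^{xᵢ} and s₀ = 1.
-- A total extension of f depends only on the xᵢ with pᵢ ≠ 0, so at least k of
-- p₁, …, pₙ are nonzero and the number z of zero weights is at most n + 1 - k.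
--
-- If P, Q ⊆ {±1}^{n+1} are orthogonal with respect to p, then
-- ∣P∣ ∣Q∣ ≤ 2^{n+1+z}, by induction on the dimension.  Taking P and Q as large as
-- possible makes them closed under negation and under flips of the coordinates
-- of weight zero, so that both have at least 2^{z+1} elements and
-- ∣P∣ + ∣Q∣ ≤ 2^n + 2^{z+1}.  The points x with s(x) ∈ P ∪ Q are half as many.
--
-- The 0-inputs lie in a hyperplane of ℝ^{n+1}, so n of them span them all, and
-- so do n of the 1-inputs; both spans stay orthogonal.  Hence f is determined by
-- 2n points (2n² bits) and one bit for each of the at most 2^{n-1} + 2^{n+1-k}
-- points in the two spans, telling whether f is defined there.
--
-- The real numbers are constructive, but the final inequality between natural
-- numbers is decidable, so it is enough to argue under double negation.
module Submission where

open import Algebra.Bundles using (CommutativeRing)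
open import Algebra.Morphism.Structures using (IsRingHomomorphism)
import Algebra.Properties.CommutativeSemigroup as CommutativeSemigroupProperties
import Algebra.Properties.Ring as RingProperties
import Algebra.Properties.Semiring.Sum as SemiringSum
open import Algebra.Structures
  using (IsCommutativeRing; IsMagma; IsSemigroup; IsMonoid; IsGroup; IsAbelianGroup; IsRing)
open import Data.Bool.Base using (Bool; true; false; not; _∧_; _∨_; if_then_else_)
import Data.Bool.Properties as Bool
open import Data.Fin.Base
  using (Fin; zero; suc; _↑ˡ_; _↑ʳ_; splitAt; toℕ; fromℕ<; inject≤; combine; funToFin;
    finToFun)
import Data.Fin.Properties as Fin
open import Data.Fin.Subset using (Subset; ∣_∣; inside; outside; _∈_; ∁)
open import Data.Fin.Subset.Properties using (x∉p⇒x∈∁p; p⊆q⇒∣p∣≤∣q∣; ∣∁p∣≡n∸∣p∣; ∣p∣≤n)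
open import Data.Integer.Base as ℤ using (ℤ; +_; -[1+_])
import Data.Integer.Properties as ℤ
open import Data.List.Base as List using (List; []; _∷_; length)
open import Data.List.Membership.Propositional.Properties using (∈-lookup)
open import Data.List.Relation.Unary.All as All using (All; []; _∷_)
open import Data.List.Relation.Unary.AllPairs using ([]; _∷_)
open import Data.List.Relation.Unary.Unique.Setoid using (Unique)
open import Data.Maybe.Base using (Maybe; just; nothing; is-just)
open import Data.Nat.Base as ℕ using (ℕ; zero; suc)
import Data.Nat.Properties as ℕ
open import Data.Nat.Tactic.RingSolver using () renaming (solve-∀ to ℕ-ring)
open import Data.Product.Base using (Σ; ∃; _×_; _,_; proj₁; proj₂)
open import Data.Product.Properties using (≡-dec)
open import Data.Rational.Base as ℚ using (ℚ; 0ℚ; 1ℚ; ½)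
import Data.Rational.Properties as ℚ
open import Data.Rational.Solver using (module +-*-Solver)
open import Data.Rational.Unnormalised.Base as ℚᵘ using (ℚᵘ; mkℚᵘ; 1ℚᵘ)
import Data.Rational.Unnormalised.Properties as ℚᵘ
open import Data.Sum.Base using (_⊎_; inj₁; inj₂; [_,_])
open import Data.Vec.Base
  using (Vec; []; _∷_; lookup; map; updateAt; tabulate; here; there)
open import Data.Vec.Functional using (tail) renaming (_∷_ to _◂_)
open import Data.Vec.Properties
  using (lookup⇒[]=; []=⇒lookup; lookup∘tabulate; lookup∘updateAt′; tabulate∘lookup;
    tabulate-cong)
open import Defs
open import Function.Base using (_∘_)
open import Function.Bundles using (mk⇔)
open import Level using (0ℓ)
open import Relation.Binary.PropositionalEquality as ≡ using (_≡_; refl; cong; cong₂; subst)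
import Relation.Binary.Reasoning.Setoid as SetoidReasoning
open import Relation.Nullary.Decidable
  using (Dec; yes; no; does; dec-true; decidable-stable; ¬¬-excluded-middle; dec-false)
open import Relation.Nullary.Negation using (¬_; contradiction; ¬¬-map)

-- The induction on the dimension cannot keep orthogonality as its hypothesis: fixing the head of a
-- vector shifts inner products by a constant. Differences of vectors do not see this shift, which
-- is why the hypothesis is `Crossed`. Equality of reals is undecidable and a nonzero real has no
-- ready inverse, while elimination has to divide by pivots. Sign vectors have rational entries, so
-- elimination runs over ℚ, and real numbers enter only in the vectors that are tested for
-- orthogonality. A span is accordingly given through its annihilator. The weights p cannot be part
-- of a code, since they range over a continuum. They are used up in showing that the two spans are
-- disjoint and small. Both are properties of the generating points alone, so functions with the
-- same points share them, whatever their weights. The sets that are actually counted, `Perp p B`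
-- and its orthogonal, do depend on p; they contain the spans and serve only to bound their size.

private
  module QS = +-*-Solver
open QS using (_:=_; _:+_; _:*_; _:-_; :-_)

-- Real numbers

Null : (ℕ → ℚ) → Set
Null z = ∀ ε → 0ℚ ℚ.< ε → ∃ λ N → ∀ n → N ℕ.≤ n → ℚ.∣ z n ∣ ℚ.< ε

Bounded : (ℕ → ℚ) → Set
Bounded y = ∃ λ b → ℚ.Positive b × ∃ λ N → ∀ n → N ℕ.≤ n → ℚ.∣ y n ∣ ℚ.≤ b

null-resp : ∀ {z w} → (∀ n → z n ≡ w n) → Null z → Null w
null-resp z≡w nz ε 0<ε with nz ε 0<ε
... | N , small = N , λ n N≤n → subst (λ t → ℚ.∣ t ∣ ℚ.< ε) (z≡w n) (small n N≤n)

null-0 : Null (λ _ → 0ℚ)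
null-0 ε 0<ε = 0 , λ _ _ → 0<ε

null-neg : ∀ {z} → Null z → Null (λ n → ℚ.- z n)
null-neg {z} nz ε 0<ε with nz ε 0<ε
... | N , small = N , λ n N≤n →
  subst (ℚ._< ε) (≡.sym (ℚ.∣-p∣≡∣p∣ (z n))) (small n N≤n)

null-+ : ∀ {z w} → Null z → Null w → Null (λ n → z n ℚ.+ w n)
null-+ {z} {w} nz nw ε 0<ε with nz (ε ℚ.* ½) half-pos | nw (ε ℚ.* ½) half-pos
  where
  half-pos : 0ℚ ℚ.< ε ℚ.* ½
  half-pos = subst (ℚ._< ε ℚ.* ½) (ℚ.*-zeroˡ ½) (ℚ.*-monoˡ-<-pos ½ 0<ε)
... | N , small | M , small′ = N ℕ.⊔ M , λ n n≥ →
  subst (ℚ.∣ z n ℚ.+ w n ∣ ℚ.<_)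
    (≡.trans (≡.sym (ℚ.*-distribˡ-+ ε ½ ½)) (ℚ.*-identityʳ ε))
    (ℚ.≤-<-trans (ℚ.∣p+q∣≤∣p∣+∣q∣ (z n) (w n))
      (ℚ.+-mono-< (small n (ℕ.m⊔n≤o⇒m≤o N M n≥)) (small′ n (ℕ.m⊔n≤o⇒n≤o N M n≥))))

null-* : ∀ {y z} → Bounded y → Null z → Null (λ n → y n ℚ.* z n)
null-* {y} {z} (b , b>0 , N , y≤b) nz ε 0<ε with nz δ 0<δ
  where
  instance
    b-pos : ℚ.Positive b
    b-pos = b>0
    b≢0 : ℚ.NonZero b
    b≢0 = ℚ.pos⇒nonZero b
  δ : ℚ
  δ = ℚ.1/ b ℚ.* ε
  0<δ : 0ℚ ℚ.< δ
  0<δ = subst (ℚ._< δ) (ℚ.*-zeroʳ (ℚ.1/ b))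
    (ℚ.*-monoʳ-<-pos (ℚ.1/ b) {{ℚ.1/pos⇒pos b}} 0<ε)
... | M , small = N ℕ.⊔ M , λ n n≥ →
  subst (ℚ._< ε) (≡.sym (ℚ.∣p*q∣≡∣p∣*∣q∣ (y n) (z n)))
    (ℚ.≤-<-trans
      (ℚ.*-monoʳ-≤-nonNeg ℚ.∣ z n ∣ {{ℚ.∣-∣-nonNeg (z n)}}
        (y≤b n (ℕ.m⊔n≤o⇒m≤o N M n≥)))
      (subst (b ℚ.* ℚ.∣ z n ∣ ℚ.<_) bδ≡ε
        (ℚ.*-monoʳ-<-pos b {{b>0}} (small n (ℕ.m⊔n≤o⇒n≤o N M n≥)))))
  where
  instance
    b≢0 : ℚ.NonZero b
    b≢0 = ℚ.pos⇒nonZero b {{b>0}}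
  bδ≡ε : b ℚ.* (ℚ.1/ b ℚ.* ε) ≡ ε
  bδ≡ε = ≡.trans (≡.sym (ℚ.*-assoc b (ℚ.1/ b) ε))
    (≡.trans (cong (ℚ._* ε) (ℚ.*-inverseʳ b)) (ℚ.*-identityˡ ε))

cauchy⇒bounded : ∀ {y} → IsCauchy y → Bounded y
cauchy⇒bounded {y} cy with cy 1ℚ (ℚ.positive⁻¹ 1ℚ)
... | N , close =
  1ℚ ℚ.+ ℚ.∣ y N ∣
  , ℚ.pos+nonNeg⇒pos 1ℚ ℚ.∣ y N ∣ {{ℚ.∣-∣-nonNeg (y N)}}
  , N , λ n N≤n → subst (λ t → ℚ.∣ t ∣ ℚ.≤ 1ℚ ℚ.+ ℚ.∣ y N ∣) (split (y n) (y N))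
      (ℚ.≤-trans (ℚ.∣p+q∣≤∣p∣+∣q∣ (y n ℚ.- y N) (y N))
        (ℚ.+-monoˡ-≤ ℚ.∣ y N ∣ (ℚ.<⇒≤ (close n N N≤n ℕ.≤-refl))))
  where
  split : ∀ p q → p ℚ.- q ℚ.+ q ≡ p
  split = QS.solve 2 (λ p q → p :- q :+ q := p) refl

-- As a record, unlike the function _≈_, this determines its arguments in unification.
infix 4 _≃ℝ_
record _≃ℝ_ (x y : ℝ) : Set where
  constructor mk≃
  field ≃⇒≈ : x ≈ y
open _≃ℝ_ public

≗⇒≃ : ∀ {x y} → (∀ n → seq x n ≡ seq y n) → x ≃ℝ y
≗⇒≃ {x} {y} x≗y = mk≃ (null-resp (λ n → ≡.sym
  (≡.trans (cong (ℚ._- seq y n) (x≗y n)) (ℚ.+-inverseʳ (seq y n)))) null-0)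

abstract
  ℝ-sym : ∀ {x y} → x ≃ℝ y → y ≃ℝ x
  ℝ-sym {x} {y} (mk≃ x≃y) = mk≃ (null-resp (λ n → swap (seq x n) (seq y n)) (null-neg x≃y))
    where
    swap : ∀ p q → ℚ.- (p ℚ.- q) ≡ q ℚ.- p
    swap = QS.solve 2 (λ p q → :- (p :- q) := q :- p) refl

  ℝ-trans : ∀ {x y z} → x ≃ℝ y → y ≃ℝ z → x ≃ℝ z
  ℝ-trans {x} {y} {z} (mk≃ x≃y) (mk≃ y≃z) = mk≃
    (null-resp (λ n → chain (seq x n) (seq y n) (seq z n)) (null-+ x≃y y≃z))
    where
    chain : ∀ p q r → (p ℚ.- q) ℚ.+ (q ℚ.- r) ≡ p ℚ.- r
    chain = QS.solve 3 (λ p q r → (p :- q) :+ (q :- r) := p :- r) refl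

-- Opaque copies of the operations, so that Agda never compares Cauchy proofs.
infixl 6 _+ᴿ_
infixl 7 _*ᴿ_
infix  8 -ᴿ_

opaque
  _+ᴿ_ _*ᴿ_ : ℝ → ℝ → ℝ
  _+ᴿ_ = ℝ-Ring._+_
  _*ᴿ_ = ℝ-Ring._*_

  -ᴿ_ : ℝ → ℝ
  -ᴿ_ = ℝ-Ring.-_

  0ᴿ 1ᴿ : ℝ
  0ᴿ = ℝ-Ring.0#
  1ᴿ = ℝ-Ring.1#

opaque
  unfolding _+ᴿ_

  seq-+ : ∀ x y n → seq (x +ᴿ y) n ≡ seq x n ℚ.+ seq y n
  seq-+ x y n = refl

  seq-* : ∀ x y n → seq (x *ᴿ y) n ≡ seq x n ℚ.* seq y n
  seq-* x y n = refl

  seq-0 : ∀ n → seq 0ᴿ n ≡ 0ℚ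
  seq-0 n = refl

  seq-1 : ∀ n → seq 1ᴿ n ≡ 1ℚ
  seq-1 n = refl

  ℝ-+-cong : ∀ {x y u v} → x ≃ℝ y → u ≃ℝ v → x +ᴿ u ≃ℝ y +ᴿ v
  ℝ-+-cong {x} {y} {u} {v} (mk≃ x≃y) (mk≃ u≃v) = mk≃
    (null-resp (λ n → regroup (seq x n) (seq y n) (seq u n) (seq v n)) (null-+ x≃y u≃v))
    where
    regroup : ∀ p q r s → (p ℚ.- q) ℚ.+ (r ℚ.- s) ≡ (p ℚ.+ r) ℚ.- (q ℚ.+ s)
    regroup = QS.solve 4 (λ p q r s → (p :- q) :+ (r :- s) := (p :+ r) :- (q :+ s)) refl

  ℝ-neg-cong : ∀ {x y} → x ≃ℝ y → -ᴿ x ≃ℝ -ᴿ y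
  ℝ-neg-cong {x} {y} (mk≃ x≃y) = mk≃
    (null-resp (λ n → push (seq x n) (seq y n)) (null-neg x≃y))
    where
    push : ∀ p q → ℚ.- (p ℚ.- q) ≡ (ℚ.- p) ℚ.- (ℚ.- q)
    push = QS.solve 2 (λ p q → :- (p :- q) := (:- p) :- (:- q)) refl

  ℝ-*-cong : ∀ {x y u v} → x ≃ℝ y → u ≃ℝ v → x *ᴿ u ≃ℝ y *ᴿ v
  ℝ-*-cong {x} {y} {u} {v} (mk≃ x≃y) (mk≃ u≃v) = mk≃
    (null-resp (λ n → regroup (seq x n) (seq y n) (seq u n) (seq v n))
      (null-+ {λ n → seq x n ℚ.* (seq u n ℚ.- seq v n)} {λ n → seq v n ℚ.* (seq x n ℚ.- seq y n)}
        (null-* {seq x} (cauchy⇒bounded (cauchy x)) u≃v)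
        (null-* {seq v} (cauchy⇒bounded (cauchy v)) x≃y)))
    where
    regroup : ∀ p q r s →
      p ℚ.* (r ℚ.- s) ℚ.+ s ℚ.* (p ℚ.- q) ≡ p ℚ.* r ℚ.- q ℚ.* s
    regroup = QS.solve 4 (λ p q r s → p :* (r :- s) :+ s :* (p :- q) := p :* r :- q :* s) refl

  ℝ-isCommutativeRing : IsCommutativeRing _≃ℝ_ _+ᴿ_ _*ᴿ_ -ᴿ_ 0ᴿ 1ᴿ
  ℝ-isCommutativeRing = record
    { isRing = record
      { +-isAbelianGroup = record
        { isGroup = record
          { isMonoid = record
            { isSemigroup = record
              { isMagma = record
                { isEquivalence = record
                  { refl  = λ {x} → ≗⇒≃ λ _ → refl
                  ; sym   = ℝ-sym
                  ; trans = ℝ-trans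
                  }
                ; ∙-cong = ℝ-+-cong
                }
              ; assoc = λ x y z → ≗⇒≃ λ n → ℚ.+-assoc (seq x n) (seq y n) (seq z n)
              }
            ; identity = (λ x → ≗⇒≃ λ n → ℚ.+-identityˡ (seq x n))
                       , (λ x → ≗⇒≃ λ n → ℚ.+-identityʳ (seq x n))
            }
          ; inverse = (λ x → ≗⇒≃ λ n → ℚ.+-inverseˡ (seq x n))
                    , (λ x → ≗⇒≃ λ n → ℚ.+-inverseʳ (seq x n))
          ; ⁻¹-cong = ℝ-neg-cong
          }
        ; comm = λ x y → ≗⇒≃ λ n → ℚ.+-comm (seq x n) (seq y n)
        }
      ; *-cong = ℝ-*-cong
      ; *-assoc = λ x y z → ≗⇒≃ λ n → ℚ.*-assoc (seq x n) (seq y n) (seq z n)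
      ; *-identity = (λ x → ≗⇒≃ λ n → ℚ.*-identityˡ (seq x n))
                   , (λ x → ≗⇒≃ λ n → ℚ.*-identityʳ (seq x n))
      ; distrib = (λ x y z → ≗⇒≃ λ n → ℚ.*-distribˡ-+ (seq x n) (seq y n) (seq z n))
                , (λ x y z → ≗⇒≃ λ n → ℚ.*-distribʳ-+ (seq x n) (seq y n) (seq z n))
      }
    ; *-comm = λ x y → ≗⇒≃ λ n → ℚ.*-comm (seq x n) (seq y n)
    }

ℝ-commutativeRing : CommutativeRing 0ℓ 0ℓ
ℝ-commutativeRing = record { isCommutativeRing = ℝ-isCommutativeRing }

opaque
  unfolding _+ᴿ_

  1≄0 : ¬ 1ᴿ ≃ℝ 0ᴿ
  1≄0 (mk≃ 1≈0) with 1≈0 1ℚ (ℚ.positive⁻¹ 1ℚ)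
  ... | N , small = ℚ.<-irrefl refl (small N ℕ.≤-refl)

constℝ : ℚ → ℝ
constℝ q = mkℝ (λ _ → q) λ ε 0<ε → 0 , λ _ _ _ _ →
  subst (λ t → ℚ.∣ t ∣ ℚ.< ε) (≡.sym (ℚ.+-inverseʳ q)) 0<ε

opaque
  unfolding _+ᴿ_

  constℝ-homomorphism :
    IsRingHomomorphism ℚ.+-*-rawRing (CommutativeRing.rawRing ℝ-commutativeRing) constℝ
  constℝ-homomorphism = record
    { isSemiringHomomorphism = record
      { isNearSemiringHomomorphism = record
        { +-isMonoidHomomorphism = record
          { isMagmaHomomorphism = record
            { isRelHomomorphism = record { cong = λ x≡y → ≗⇒≃ λ _ → x≡y }
            ; homo = λ x y → ≗⇒≃ λ _ → refl
            }
          ; ε-homo = ≗⇒≃ λ _ → refl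
          }
        ; *-homo = λ x y → ≗⇒≃ λ _ → refl
        }
      ; 1#-homo = ≗⇒≃ λ _ → refl
      }
    ; -‿homo = λ x → ≗⇒≃ λ _ → refl
    }

-- Termwise nonnegativity is stronger than x ≥ 0, but squares have it.
TermwiseNonNeg : ℝ → Set
TermwiseNonNeg x = ∀ n → 0ℚ ℚ.≤ seq x n

square-nonNeg : ∀ x → TermwiseNonNeg (x ℝ-Ring.* x)
square-nonNeg x n with ℚ.≤-total 0ℚ (seq x n)
... | inj₁ 0≤x = ℚ.nonNegative⁻¹ _
  {{ℚ.nonNeg*nonNeg⇒nonNeg (seq x n) {{ℚ.nonNegative 0≤x}} (seq x n) {{ℚ.nonNegative 0≤x}}}}
... | inj₂ x≤0 = ℚ.nonNegative⁻¹ _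
  {{ℚ.nonPos*nonPos⇒nonPos (seq x n) {{ℚ.nonPositive x≤0}} (seq x n) {{ℚ.nonPositive x≤0}}}}

+-nonNeg : ∀ {x y} → TermwiseNonNeg x → TermwiseNonNeg y → TermwiseNonNeg (x ℝ-Ring.+ y)
+-nonNeg 0≤x 0≤y n = ℚ.+-mono-≤ (0≤x n) (0≤y n)

sum-nonNeg : ∀ {m} (t : Fin m → ℝ) → (∀ i → TermwiseNonNeg (t i)) → TermwiseNonNeg (sumℝ t)
sum-nonNeg {zero}  t 0≤t _ = ℚ.≤-refl
sum-nonNeg {suc m} t 0≤t =
  +-nonNeg {t zero} {sumℝ (t ∘ suc)} (0≤t zero) (sum-nonNeg (t ∘ suc) (0≤t ∘ suc))

-- Comparing the representing sequences term by term takes the place of an order on ℝ. This is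
-- enough for norms, which are sums of squares.
squeeze : ∀ {x y} → TermwiseNonNeg x → (∀ n → seq x n ℚ.≤ seq y n) →
  y ≈ ℝ-Ring.0# → x ≈ ℝ-Ring.0#
squeeze {x} {y} 0≤x x≤y y≈0 ε 0<ε with y≈0 ε 0<ε
... | N , small = N , λ n N≤n →
  subst (λ t → ℚ.∣ t ∣ ℚ.< ε) (minus-zero (seq x n))
  (subst (ℚ._< ε) (≡.sym (ℚ.0≤p⇒∣p∣≡p (0≤x n)))
    (ℚ.≤-<-trans (x≤y n)
      (subst (ℚ._< ε) (ℚ.0≤p⇒∣p∣≡p (ℚ.≤-trans (0≤x n) (x≤y n)))
        (subst (λ t → ℚ.∣ t ∣ ℚ.< ε) (≡.sym (minus-zero (seq y n))) (small n N≤n)))))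
  where
  minus-zero : ∀ p → p ≡ p ℚ.- 0ℚ
  minus-zero = QS.solve 1 (λ p → p := p :- QS.con 0ℚ) refl

+≈0⇒ˡ : ∀ {x y} → TermwiseNonNeg x → TermwiseNonNeg y →
  x ℝ-Ring.+ y ≈ ℝ-Ring.0# → x ≈ ℝ-Ring.0#
+≈0⇒ˡ {x} {y} 0≤x 0≤y = squeeze {x} {x ℝ-Ring.+ y} 0≤x λ n →
  subst (ℚ._≤ seq x n ℚ.+ seq y n) (ℚ.+-identityʳ (seq x n)) (ℚ.+-monoʳ-≤ (seq x n) (0≤y n))

+≈0⇒ʳ : ∀ {x y} → TermwiseNonNeg x → TermwiseNonNeg y →
  x ℝ-Ring.+ y ≈ ℝ-Ring.0# → y ≈ ℝ-Ring.0#
+≈0⇒ʳ {x} {y} 0≤x 0≤y = squeeze {y} {x ℝ-Ring.+ y} 0≤y λ n →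
  subst (ℚ._≤ seq x n ℚ.+ seq y n) (ℚ.+-identityˡ (seq y n)) (ℚ.+-monoˡ-≤ (seq y n) (0≤x n))

sum≈0⇒ : ∀ {m} (t : Fin m → ℝ) → (∀ i → TermwiseNonNeg (t i)) →
  sumℝ t ≈ ℝ-Ring.0# → ∀ i → t i ≈ ℝ-Ring.0#
sum≈0⇒ {suc m} t 0≤t s≈0 zero =
  +≈0⇒ˡ {t zero} {sumℝ (t ∘ suc)} (0≤t zero) (sum-nonNeg (t ∘ suc) (0≤t ∘ suc)) s≈0
sum≈0⇒ {suc m} t 0≤t s≈0 (suc i) = sum≈0⇒ (t ∘ suc) (0≤t ∘ suc)
  (+≈0⇒ʳ {t zero} {sumℝ (t ∘ suc)} (0≤t zero) (sum-nonNeg (t ∘ suc) (0≤t ∘ suc)) s≈0) i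

-- The index from which the squares stay below ε² works for x and ε, because a term of absolute
-- value at least ε has a square of at least ε².
square≈0⇒ : ∀ x → x ℝ-Ring.* x ≈ ℝ-Ring.0# → x ≈ ℝ-Ring.0#
square≈0⇒ x x²≈0 ε 0<ε with x²≈0 (ε ℚ.* ε) 0<ε²
  where
  0<ε² : 0ℚ ℚ.< ε ℚ.* ε
  0<ε² = ℚ.positive⁻¹ _ {{ℚ.pos*pos⇒pos ε {{ℚ.positive 0<ε}} ε {{ℚ.positive 0<ε}}}}
... | N , small = N , λ n N≤n → ℚ.≰⇒> λ ε≤∣x∣ →
  ℚ.<-irrefl refl (ℚ.<-≤-trans
    (subst (ℚ._< ε ℚ.* ε) (unsquare (seq x n)) (small n N≤n))
    (ℚ.≤-trans (ℚ.*-monoˡ-≤-nonNeg ε {{ℚ.pos⇒nonNeg ε {{ℚ.positive 0<ε}}}} ε≤∣x∣)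
      (ℚ.*-monoʳ-≤-nonNeg ℚ.∣ seq x n ℚ.- 0ℚ ∣ {{ℚ.∣-∣-nonNeg (seq x n ℚ.- 0ℚ)}} ε≤∣x∣)))
  where
  unsquare : ∀ p → ℚ.∣ p ℚ.* p ℚ.- 0ℚ ∣ ≡ ℚ.∣ p ℚ.- 0ℚ ∣ ℚ.* ℚ.∣ p ℚ.- 0ℚ ∣
  unsquare p = ≡.trans
    (cong ℚ.∣_∣ (QS.solve 1 (λ p →
      p :* p :- QS.con 0ℚ := (p :- QS.con 0ℚ) :* (p :- QS.con 0ℚ)) refl p))
    (ℚ.∣p*q∣≡∣p∣*∣q∣ (p ℚ.- 0ℚ) (p ℚ.- 0ℚ))

-- Counting in the Boolean cube

count : ∀ {N} → (Vec Bool N → Bool) → ℕ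
count {zero}  P = if P [] then 1 else 0
count {suc N} P = count (P ∘ (false ∷_)) ℕ.+ count (P ∘ (true ∷_))

count≡0 : ∀ {N} (P : Vec Bool N → Bool) → (∀ x → P x ≡ false) → count P ≡ 0
count≡0 {zero}  P none rewrite none [] = refl
count≡0 {suc N} P none =
  cong₂ ℕ._+_ (count≡0 _ (none ∘ (false ∷_))) (count≡0 _ (none ∘ (true ∷_)))

count-∘-map-not : ∀ {N} (P : Vec Bool N → Bool) → count (P ∘ map not) ≡ count P
count-∘-map-not {zero}  P = refl
count-∘-map-not {suc N} P = ≡.trans
  (cong₂ ℕ._+_ (count-∘-map-not (P ∘ (true ∷_))) (count-∘-map-not (P ∘ (false ∷_))))
  (ℕ.+-comm (count (P ∘ (true ∷_))) _)

count-cong : ∀ {N} {P Q : Vec Bool N → Bool} → (∀ x → P x ≡ Q x) → count P ≡ count Q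
count-cong {zero}  P≗Q rewrite P≗Q [] = refl
count-cong {suc N} P≗Q =
  cong₂ ℕ._+_ (count-cong (P≗Q ∘ (false ∷_))) (count-cong (P≗Q ∘ (true ∷_)))

count-∨ : ∀ {N} (P Q : Vec Bool N → Bool) → (∀ x → P x ∧ Q x ≡ false) →
  count (λ x → P x ∨ Q x) ≡ count P ℕ.+ count Q
count-∨ {zero} P Q disj with P [] | Q [] | disj []
... | false | _     | _ = refl
... | true  | false | _ = refl
count-∨ {suc N} P Q disj = ≡.trans
  (cong₂ ℕ._+_ (count-∨ (P ∘ (false ∷_)) (Q ∘ (false ∷_)) (disj ∘ (false ∷_)))
               (count-∨ (P ∘ (true ∷_)) (Q ∘ (true ∷_)) (disj ∘ (true ∷_))))
  (interchange (count (P ∘ (false ∷_))) _ _ _)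
  where
  interchange : ∀ a b c d → a ℕ.+ b ℕ.+ (c ℕ.+ d) ≡ a ℕ.+ c ℕ.+ (b ℕ.+ d)
  interchange = ℕ-ring

search : ∀ {N} (P : Vec Bool N → Bool) → (∃ λ x → P x ≡ true) ⊎ (∀ x → P x ≡ false)
search {zero} P with P [] in eq
... | true  = inj₁ ([] , eq)
... | false = inj₂ λ { [] → eq }
search {suc N} P with search (P ∘ (false ∷_)) | search (P ∘ (true ∷_))
... | inj₁ (x , Px) | _             = inj₁ (false ∷ x , Px)
... | inj₂ none     | inj₁ (x , Px) = inj₁ (true ∷ x , Px)
... | inj₂ none     | inj₂ none′    = inj₂ λ { (false ∷ x) → none x ; (true ∷ x) → none′ x }

enumerate : ∀ {N} (P : Vec Bool N → Bool) →
  Σ (Fin (count P) → Vec Bool N) λ e → ∀ x → P x ≡ true → ∃ λ j → e j ≡ x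
enumerate {zero} P with P [] in eq
... | true  = (λ _ → []) , λ { [] _ → zero , refl }
... | false = (λ ()) , λ { [] P[] → contradiction (≡.trans (≡.sym eq) P[]) λ () }
enumerate {suc N} P with enumerate (P ∘ (false ∷_)) | enumerate (P ∘ (true ∷_))
... | e₀ , onto₀ | e₁ , onto₁ = e , onto
  where
  m₀ = count (P ∘ (false ∷_))
  m₁ = count (P ∘ (true ∷_))
  branch : Fin m₀ ⊎ Fin m₁ → Vec Bool (suc N)
  branch = [ (false ∷_) ∘ e₀ , (true ∷_) ∘ e₁ ]
  e : Fin (m₀ ℕ.+ m₁) → Vec Bool (suc N)
  e = branch ∘ splitAt m₀
  onto : ∀ x → P x ≡ true → ∃ λ j → e j ≡ x
  onto (false ∷ x) Px with onto₀ x Px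
  ... | j , eq = j ↑ˡ m₁ , ≡.trans (cong branch (Fin.splitAt-↑ˡ m₀ j m₁)) (cong (false ∷_) eq)
  onto (true ∷ x) Px with onto₁ x Px
  ... | j , eq = m₀ ↑ʳ j , ≡.trans (cong branch (Fin.splitAt-↑ʳ m₀ m₁ j)) (cong (true ∷_) eq)

FlipClosed : ∀ {N} → Subset N → (Vec Bool N → Bool) → Set
FlipClosed Z P = ∀ i x → lookup Z i ≡ true → P x ≡ true → P (updateAt x i not) ≡ true

flipClosed-tail : ∀ {N z Z} {P : Vec Bool (suc N) → Bool} b →
  FlipClosed (z ∷ Z) P → FlipClosed Z (P ∘ (b ∷_))
flipClosed-tail b closed i x = closed (suc i) (b ∷ x)

private
  2*2^ : ∀ {a b} z → 2 ℕ.^ z ℕ.≤ a → 2 ℕ.^ z ℕ.≤ b → 2 ℕ.^ suc z ℕ.≤ a ℕ.+ b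
  2*2^ {a} {b} z ≤a ≤b =
    ℕ.+-mono-≤ ≤a (subst (ℕ._≤ b) (≡.sym (ℕ.+-identityʳ (2 ℕ.^ z))) ≤b)

-- The flips at Z act freely, so the orbit of the single point x already has this many elements.
flipClosed⇒2^≤ : ∀ {N} (Z : Subset N) (P : Vec Bool N → Bool) → FlipClosed Z P →
  ∀ x → P x ≡ true → 2 ℕ.^ ∣ Z ∣ ℕ.≤ count P
flipClosed⇒2^≤ [] P closed [] Px rewrite Px = ℕ.≤-refl
flipClosed⇒2^≤ (true ∷ Z) P closed (b ∷ x) Px = 2*2^ ∣ Z ∣ (half false) (half true)
  where
  flip : ∀ b c → P (b ∷ x) ≡ true → P (c ∷ x) ≡ true
  flip false false Pb = Pb
  flip false true  Pb = closed zero (false ∷ x) refl Pb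
  flip true  false Pb = closed zero (true ∷ x) refl Pb
  flip true  true  Pb = Pb
  half : ∀ c → 2 ℕ.^ ∣ Z ∣ ℕ.≤ count (P ∘ (c ∷_))
  half c = flipClosed⇒2^≤ Z (P ∘ (c ∷_)) (flipClosed-tail c closed) x (flip b c Px)
flipClosed⇒2^≤ (false ∷ Z) P closed (false ∷ x) Px = ℕ.≤-trans
  (flipClosed⇒2^≤ Z (P ∘ (false ∷_)) (flipClosed-tail false closed) x Px) (ℕ.m≤m+n _ _)
flipClosed⇒2^≤ (false ∷ Z) P closed (true ∷ x) Px = ℕ.≤-trans
  (flipClosed⇒2^≤ Z (P ∘ (true ∷_)) (flipClosed-tail true closed) x Px) (ℕ.m≤n+m _ _)

-- Flips at Z never change a coordinate outside Z, where x and its negation differ. Their two orbits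
-- are therefore disjoint, which doubles the previous bound.
antipodal⇒2^≤ : ∀ {N} (Z : Subset N) (P : Vec Bool N → Bool) → FlipClosed Z P →
  ∀ i → lookup Z i ≡ false → ∀ x → P x ≡ true → P (map not x) ≡ true →
  2 ℕ.^ suc ∣ Z ∣ ℕ.≤ count P
antipodal⇒2^≤ (true ∷ Z) P closed (suc i) Zi (b ∷ x) Px P¬x =
  2*2^ (suc ∣ Z ∣) (half false b Px P¬x) (half true b Px P¬x)
  where
  half : ∀ c b → P (b ∷ x) ≡ true → P (not b ∷ map not x) ≡ true →
    2 ℕ.^ suc ∣ Z ∣ ℕ.≤ count (P ∘ (c ∷_))
  half c b Px P¬x = antipodal⇒2^≤ Z (P ∘ (c ∷_)) (flipClosed-tail c closed) i Zi x
    (move c b x Px) (move c (not b) (map not x) P¬x)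
    where
    move : ∀ c b x → P (b ∷ x) ≡ true → P (c ∷ x) ≡ true
    move false false x Pb = Pb
    move true  false x Pb = closed zero (false ∷ x) refl Pb
    move false true  x Pb = closed zero (true ∷ x) refl Pb
    move true  true  x Pb = Pb
-- The leading coordinate outside Z separates x from its negation, whether or not it is i: each half
-- of the cube contains one of them.
antipodal⇒2^≤ (false ∷ Z) P closed i Zi (false ∷ x) Px P¬x = 2*2^ ∣ Z ∣
  (flipClosed⇒2^≤ Z (P ∘ (false ∷_)) (flipClosed-tail false closed) x Px)
  (flipClosed⇒2^≤ Z (P ∘ (true ∷_)) (flipClosed-tail true closed) (map not x) P¬x)
antipodal⇒2^≤ (false ∷ Z) P closed i Zi (true ∷ x) Px P¬x = 2*2^ ∣ Z ∣
  (flipClosed⇒2^≤ Z (P ∘ (false ∷_)) (flipClosed-tail false closed) (map not x) P¬x)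
  (flipClosed⇒2^≤ Z (P ∘ (true ∷_)) (flipClosed-tail true closed) x Px)

-- (a − s)(b − s) ≥ 0, so  s (a + b) ≤ a b + s² ≤ s (t + s).
product⇒sum : ∀ {a b s t} → 0 ℕ.< s → s ℕ.≤ a → s ℕ.≤ b → a ℕ.* b ℕ.≤ s ℕ.* t →
  a ℕ.+ b ℕ.≤ t ℕ.+ s
product⇒sum {s = suc s-1} {t} 0<s s≤a s≤b ab≤st
  with ℕ.m≤n⇒∃[o]m+o≡n s≤a | ℕ.m≤n⇒∃[o]m+o≡n s≤b
... | c , refl | d , refl = ℕ.*-cancelˡ-≤ s (begin
  s ℕ.* (s ℕ.+ c ℕ.+ (s ℕ.+ d))            ≤⟨ ℕ.m≤m+n _ (c ℕ.* d) ⟩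
  s ℕ.* (s ℕ.+ c ℕ.+ (s ℕ.+ d)) ℕ.+ c ℕ.* d ≡⟨ expand s c d ⟩
  (s ℕ.+ c) ℕ.* (s ℕ.+ d) ℕ.+ s ℕ.* s       ≤⟨ ℕ.+-monoˡ-≤ (s ℕ.* s) ab≤st ⟩
  s ℕ.* t ℕ.+ s ℕ.* s                       ≡⟨ ℕ.*-distribˡ-+ s t s ⟨
  s ℕ.* (t ℕ.+ s)                           ∎)
  where
  open ℕ.≤-Reasoning
  s = suc s-1
  expand : ∀ s c d → s ℕ.* (s ℕ.+ c ℕ.+ (s ℕ.+ d)) ℕ.+ c ℕ.* d ≡ (s ℕ.+ c) ℕ.* (s ℕ.+ d) ℕ.+ s ℕ.* s
  expand = ℕ-ring

-- Orthogonality of sign vectors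

TwoTorsionFree : CommutativeRing 0ℓ 0ℓ → Set
TwoTorsionFree R = ∀ x → x + x ≃ 0# → x ≃ 0#
  where open CommutativeRing R using (_+_; 0#) renaming (_≈_ to _≃_)

module SignedSums (R : CommutativeRing 0ℓ 0ℓ) (halve : TwoTorsionFree R) where

  open CommutativeRing R hiding (zero)
    renaming (_≈_ to _≃_; refl to ≃-refl; sym to ≃-sym; trans to ≃-trans)
  open RingProperties ring using (-‿involutive; -‿+-comm; -0#≈0#; +-cancelˡ)
  open CommutativeSemigroupProperties +-commutativeSemigroup using (interchange)
  open SemiringSum semiring using (sum; sum-cong-≋)
  open SetoidReasoning setoid

  signed : Bool → Carrier → Carrier
  signed b r = if b then - r else r

  signed-cong : ∀ b {r s} → r ≃ s → signed b r ≃ signed b s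
  signed-cong false r≃s = r≃s
  signed-cong true  r≃s = -‿cong r≃s

  signed-0 : ∀ b {r} → r ≃ 0# → signed b r ≃ 0#
  signed-0 false r≃0 = r≃0
  signed-0 true  r≃0 = ≃-trans (-‿cong r≃0) -0#≈0#

  signed-not : ∀ b r → signed (not b) r ≃ - signed b r
  signed-not false r = ≃-refl
  signed-not true  r = ≃-sym (-‿involutive r)

  signed-comm : ∀ b c r → signed b (signed c r) ≡ signed c (signed b r)
  signed-comm false c     r = refl
  signed-comm true  false r = refl
  signed-comm true  true  r = refl

  signed-self : ∀ b r → signed b (signed b r) ≃ r
  signed-self false r = ≃-refl
  signed-self true  r = -‿involutive r

  sum-signed : ∀ {N} b (t : Fin N → Carrier) → sum (signed b ∘ t) ≃ signed b (sum t)
  sum-signed false t = ≃-refl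
  sum-signed {zero}  true t = ≃-sym -0#≈0#
  sum-signed {suc N} true t = ≃-trans (+-congˡ (sum-signed true (t ∘ suc))) (-‿+-comm _ _)

  sum-signed² : ∀ {M N} (b c : Fin M → Bool) (t : Fin M → Fin N → Carrier) →
    sum (λ i → sum λ j → signed (b i) (signed (c i) (t i j)))
      ≃ sum λ i → signed (b i) (signed (c i) (sum (t i)))
  sum-signed² b c t = sum-cong-≋ λ i → ≃-trans (sum-signed (b i) (signed (c i) ∘ t i))
    (signed-cong (b i) (sum-signed (c i) (t i)))

  -- The weighted inner product of two sign vectors, where `true` stands for -1.
  pairing : ∀ {N} → (Fin N → Carrier) → Vec Bool N → Vec Bool N → Carrier
  pairing p x y = sum λ i → signed (lookup x i) (signed (lookup y i) (p i))

  pairing-comm : ∀ {N} (p : Fin N → Carrier) x y → pairing p x y ≃ pairing p y x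
  pairing-comm p x y = sum-cong-≋ λ i → reflexive (signed-comm (lookup x i) (lookup y i) (p i))

  pairing-self : ∀ {N} (p : Fin N → Carrier) x → pairing p x x ≃ sum p
  pairing-self p x = sum-cong-≋ λ i → signed-self (lookup x i) (p i)

  -- ⟨x − x′, y − y′⟩ = 0 for all x, x′ ∈ P and y, y′ ∈ Q.  Unlike orthogonality,
  -- this survives fixing or forgetting a coordinate.
  Crossed : ∀ {N} → (Fin N → Carrier) → (P Q : Vec Bool N → Bool) → Set
  Crossed p P Q = ∀ x x′ y y′ → P x ≡ true → P x′ ≡ true → Q y ≡ true → Q y′ ≡ true →
    pairing p x y + pairing p x′ y′ ≃ pairing p x y′ + pairing p x′ y

  -- Both vectors from P have head a, so the head contributes one term for y and one for y′. Each
  -- occurs once on either side and cancels, even if the forgotten heads of y and y′ differ.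
  crossed-tail : ∀ {N} {p : Fin (suc N) → Carrier} {P Q} a (Q′ : Vec Bool N → Bool) →
    (∀ y → Q′ y ≡ true → ∃ λ b → Q (b ∷ y) ≡ true) →
    Crossed p P Q → Crossed (p ∘ suc) (P ∘ (a ∷_)) Q′
  crossed-tail {p = p} a Q′ lift crossed x x′ y y′ Px Px′ Q′y Q′y′
    with lift y Q′y | lift y′ Q′y′
  ... | b , Qy | b′ , Qy′ = +-cancelˡ (u + v) _ _ (begin
    u + v + (⟪ x , y ⟫ + ⟪ x′ , y′ ⟫)     ≈⟨ interchange u v _ _ ⟩
    u + ⟪ x , y ⟫ + (v + ⟪ x′ , y′ ⟫)     ≈⟨ crossed (a ∷ x) (a ∷ x′) (b ∷ y) (b′ ∷ y′) Px Px′ Qy Qy′ ⟩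
    v + ⟪ x , y′ ⟫ + (u + ⟪ x′ , y ⟫)     ≈⟨ interchange v _ u _ ⟩
    v + u + (⟪ x , y′ ⟫ + ⟪ x′ , y ⟫)     ≈⟨ +-congʳ (+-comm v u) ⟩
    u + v + (⟪ x , y′ ⟫ + ⟪ x′ , y ⟫)     ∎)
    where
    ⟪_,_⟫ = pairing (p ∘ suc)
    u = signed a (signed b (p zero))
    v = signed a (signed b′ (p zero))

  -- The difference of the two vectors of P has head 2 and that of the two vectors of Q is 2 at the
  -- head and 0 elsewhere. Their inner product is 4 times the head weight.
  crossed-heads : ∀ {N} {p : Fin (suc N) → Carrier} {P Q} → Crossed p P Q →
    ∀ x x′ y → P (false ∷ x) ≡ true → P (true ∷ x′) ≡ true →
    Q (false ∷ y) ≡ true → Q (true ∷ y) ≡ true → p zero ≃ 0#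
  crossed-heads {p = p} crossed x x′ y Px Px′ Qy Qy′ = halve q (halve (q + q) (begin
    q + q + (q + q)         ≈⟨ +-congʳ 2q≃-2q ⟩
    - (q + q) + (q + q)     ≈⟨ -‿inverseˡ (q + q) ⟩
    0#                      ∎))
    where
    ⟪_,_⟫ = pairing (p ∘ suc)
    q = p zero
    t = ⟪ x , y ⟫
    t′ = ⟪ x′ , y ⟫
    2q≃-2q : q + q ≃ - (q + q)
    2q≃-2q = ≃-trans (+-cancelˡ (t + t′) _ _ (begin
      t + t′ + (q + q)         ≈⟨ +-comm _ _ ⟩
      q + q + (t + t′)         ≈⟨ interchange q q t t′ ⟩
      q + t + (q + t′)         ≈⟨ +-congˡ (+-congʳ (≃-sym (-‿involutive q))) ⟩
      q + t + (- - q + t′)     ≈⟨ crossed (false ∷ x) (true ∷ x′) (false ∷ y) (true ∷ y) Px Px′ Qy Qy′ ⟩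
      - q + t + (- q + t′)     ≈⟨ interchange (- q) t (- q) t′ ⟩
      - q + - q + (t + t′)     ≈⟨ +-comm _ _ ⟩
      t + t′ + (- q + - q)     ∎)) (-‿+-comm q q)

  ∨-lift : ∀ {N} (Q : Vec Bool (suc N) → Bool) y → Q (false ∷ y) ∨ Q (true ∷ y) ≡ true →
    ∃ λ b → Q (b ∷ y) ≡ true
  ∨-lift Q y Q∨ with Q (false ∷ y) in eq
  ... | true  = false , eq
  ... | false = true , Q∨

  -- The product of the sizes splits into four products of halves, so a coordinate in Z costs a
  -- factor 4. At a nonzero weight `crossed-heads` forbids that P meets both halves while Q contains
  -- two vectors differing only there. In each remaining case two smaller products suffice, and the
  -- cost is a factor 2.
  crossed⇒product-bound : ∀ {N} (p : Fin N → Carrier) (Z : Subset N) →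
    (∀ i → lookup Z i ≡ false → ¬ p i ≃ 0#) →
    (P Q : Vec Bool N → Bool) → Crossed p P Q →
    count P ℕ.* count Q ℕ.≤ 2 ℕ.^ (N ℕ.+ ∣ Z ∣)
  crossed⇒product-bound p [] nonzero P Q crossed = unit (P []) (Q [])
    where
    unit : ∀ a b → (if a then 1 else 0) ℕ.* (if b then 1 else 0) ℕ.≤ 1
    unit false b     = ℕ.z≤n
    unit true  false = ℕ.z≤n
    unit true  true  = ℕ.≤-refl
  crossed⇒product-bound {suc N} p (z ∷ Z) nonzero P Q crossed = cases z (nonzero zero)
    where
    K a₀ a₁ b₀ b₁ : ℕ
    K = 2 ℕ.^ (N ℕ.+ ∣ Z ∣)
    a₀ = count (P ∘ (false ∷_))
    a₁ = count (P ∘ (true ∷_))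
    b₀ = count (Q ∘ (false ∷_))
    b₁ = count (Q ∘ (true ∷_))

    slice : ∀ a (Q′ : Vec Bool N → Bool) →
      (∀ y → Q′ y ≡ true → ∃ λ b → Q (b ∷ y) ≡ true) →
      count (P ∘ (a ∷_)) ℕ.* count Q′ ℕ.≤ K
    slice a Q′ lift = crossed⇒product-bound (p ∘ suc) Z (nonzero ∘ suc) (P ∘ (a ∷_)) Q′
      (crossed-tail {p = p} {P} {Q} a Q′ lift crossed)

    ≤K : ∀ a b → count (P ∘ (a ∷_)) ℕ.* count (Q ∘ (b ∷_)) ℕ.≤ K
    ≤K a b = slice a (Q ∘ (b ∷_)) λ _ Qy → b , Qy

    2K : K ℕ.+ K ≡ 2 ℕ.^ (suc N ℕ.+ ∣ Z ∣)
    2K = cong (K ℕ.+_) (≡.sym (ℕ.+-identityʳ K))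

    expand : ∀ a b c d → (a ℕ.+ b) ℕ.* (c ℕ.+ d) ≡ (a ℕ.* c ℕ.+ a ℕ.* d) ℕ.+ (b ℕ.* c ℕ.+ b ℕ.* d)
    expand = ℕ-ring

    only : ∀ a → count (P ∘ (not a ∷_)) ≡ 0 →
      (a₀ ℕ.+ a₁) ℕ.* (b₀ ℕ.+ b₁) ℕ.≤ K ℕ.+ K
    only false a₁≡0 rewrite a₁≡0 | ℕ.+-identityʳ a₀ | ℕ.*-distribˡ-+ a₀ b₀ b₁ =
      ℕ.+-mono-≤ (≤K false false) (≤K false true)
    only true  a₀≡0 rewrite a₀≡0 | ℕ.*-distribˡ-+ a₁ b₀ b₁ =
      ℕ.+-mono-≤ (≤K true false) (≤K true true)

    cases : ∀ z → (z ≡ false → ¬ p zero ≃ 0#) →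
      (a₀ ℕ.+ a₁) ℕ.* (b₀ ℕ.+ b₁) ℕ.≤ 2 ℕ.^ (suc N ℕ.+ ∣ z ∷ Z ∣)
    cases true _ rewrite ℕ.+-suc N ∣ Z ∣ | expand a₀ a₁ b₀ b₁
      | ℕ.+-identityʳ K | ℕ.+-identityʳ (K ℕ.+ K) =
      ℕ.+-mono-≤ (ℕ.+-mono-≤ (≤K false false) (≤K false true))
                 (ℕ.+-mono-≤ (≤K true false) (≤K true true))
    cases false p₀≄0 = subst ((a₀ ℕ.+ a₁) ℕ.* (b₀ ℕ.+ b₁) ℕ.≤_) 2K
      (split (search λ y → Q (false ∷ y) ∧ Q (true ∷ y)))
      where
      Q′ : Vec Bool N → Bool
      Q′ y = Q (false ∷ y) ∨ Q (true ∷ y)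

      split : _ ⊎ _ → (a₀ ℕ.+ a₁) ℕ.* (b₀ ℕ.+ b₁) ℕ.≤ K ℕ.+ K
      -- No tail occurs in Q with both heads, so forgetting the head preserves the size of Q and
      -- only the two halves of P are summed.
      split (inj₂ disjoint) = subst (λ b → (a₀ ℕ.+ a₁) ℕ.* b ℕ.≤ K ℕ.+ K)
        (count-∨ (Q ∘ (false ∷_)) (Q ∘ (true ∷_)) disjoint)
        (subst (ℕ._≤ K ℕ.+ K) (≡.sym (ℕ.*-distribʳ-+ (count Q′) a₀ a₁))
          (ℕ.+-mono-≤ (slice false Q′ (∨-lift Q)) (slice true Q′ (∨-lift Q))))
      split (inj₁ (y , Qy∧)) with search (P ∘ (false ∷_)) | search (P ∘ (true ∷_))
      -- Some tail occurs in Q with both heads, so one half of P must be empty.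
      ... | _ | inj₂ none = only false (count≡0 _ none)
      ... | inj₂ none | _ = only true (count≡0 _ none)
      ... | inj₁ (x , Px) | inj₁ (x′ , Px′) = contradiction
        (crossed-heads {p = p} {P} {Q} crossed x x′ y Px Px′
          (Bool.∧-conicalˡ _ _ Qy∧) (Bool.∧-conicalʳ _ _ Qy∧))
        (p₀≄0 refl)

does⇒ : ∀ {A : Set} (a? : Dec A) → does a? ≡ true → A
does⇒ (yes a) _ = a

-- Sizes of mutually orthogonal sets of sign vectors

module RationalAlgebra (R : CommutativeRing 0ℓ 0ℓ) (ι : ℚ → CommutativeRing.Carrier R)
  (ι-homomorphism : IsRingHomomorphism ℚ.+-*-rawRing (CommutativeRing.rawRing R) ι)
  where

  open CommutativeRing R hiding (zero)
    renaming (_≈_ to _≃_; refl to ≃-refl; sym to ≃-sym; trans to ≃-trans)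
  open IsRingHomomorphism ι-homomorphism using (+-homo; *-homo; -‿homo; 0#-homo; 1#-homo)
  open RingProperties ring using (-‿+-comm; -0#≈0#; -1*x≈-x)
  open SemiringSum semiring
    using (sum; sum-cong-≋; ∑-distrib-+; *-distribˡ-sum; sum-replicate-zero)

  private
    ι-cancel : ∀ v {r} → ¬ v ≡ 0ℚ → ι v * r ≃ 0# → r ≃ 0#
    ι-cancel v {r} v≢0 vr≃0 = begin
      r                           ≈⟨ *-identityˡ r ⟨
      1# * r                      ≈⟨ *-congʳ 1#-homo ⟨
      ι 1ℚ * r                    ≡⟨ cong (λ t → ι t * r) (ℚ.*-inverseˡ v) ⟨
      ι (ℚ.1/ v ℚ.* v) * r        ≈⟨ *-congʳ (*-homo (ℚ.1/ v) v) ⟩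
      ι (ℚ.1/ v) * ι v * r        ≈⟨ *-assoc _ _ _ ⟩
      ι (ℚ.1/ v) * (ι v * r)      ≈⟨ *-congˡ vr≃0 ⟩
      ι (ℚ.1/ v) * 0#             ≈⟨ zeroʳ _ ⟩
      0#                          ∎
      where
      open SetoidReasoning setoid
      instance _ = ℚ.≢-nonZero v≢0

  halve : TwoTorsionFree R
  halve x x+x≃0 = ι-cancel (1ℚ ℚ.+ 1ℚ) (λ ()) (begin
    ι (1ℚ ℚ.+ 1ℚ) * x       ≈⟨ *-congʳ (+-homo 1ℚ 1ℚ) ⟩
    (ι 1ℚ + ι 1ℚ) * x       ≈⟨ *-congʳ (+-cong 1#-homo 1#-homo) ⟩
    (1# + 1#) * x           ≈⟨ distribʳ x 1# 1# ⟩
    1# * x + 1# * x         ≈⟨ +-cong (*-identityˡ x) (*-identityˡ x) ⟩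
    x + x                   ≈⟨ x+x≃0 ⟩
    0#                      ∎)
    where open SetoidReasoning setoid

  open SignedSums R halve public

  pairing-flip : ∀ {N} (p : Fin N → Carrier) i x y → p i ≃ 0# →
    pairing p (updateAt x i not) y ≃ pairing p x y
  pairing-flip p zero (b ∷ x) (c ∷ y) p₀≃0 = +-congʳ (≃-trans
    (signed-0 (not b) (signed-0 c p₀≃0)) (≃-sym (signed-0 b (signed-0 c p₀≃0))))
  pairing-flip p (suc i) (b ∷ x) (c ∷ y) pᵢ≃0 = +-congˡ (pairing-flip (p ∘ suc) i x y pᵢ≃0)

  pairing-map-not : ∀ {N} (p : Fin N → Carrier) x y →
    pairing p (map not x) y ≃ - pairing p x y
  pairing-map-not p [] [] = ≃-sym -0#≈0#
  pairing-map-not p (b ∷ x) (c ∷ y) = ≃-trans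
    (+-cong (signed-not b (signed c (p zero))) (pairing-map-not (p ∘ suc) x y)) (-‿+-comm _ _)

  Perp : ∀ {N} → (Fin N → Carrier) → (Vec Bool N → Set) → Vec Bool N → Set
  Perp p B x = ∀ y → B y → pairing p x y ≃ 0#

  perp-flip : ∀ {N} (p : Fin N → Carrier) {B i} x → p i ≃ 0# →
    Perp p B x → Perp p B (updateAt x i not)
  perp-flip p {i = i} x pᵢ≃0 x⊥B y By = ≃-trans (pairing-flip p i x y pᵢ≃0) (x⊥B y By)

  perp-map-not : ∀ {N} (p : Fin N → Carrier) {B} x → Perp p B x → Perp p B (map not x)
  perp-map-not p x x⊥B y By =
    ≃-trans (pairing-map-not p x y) (≃-trans (-‿cong (x⊥B y By)) -0#≈0#)

  -- The dimension is n + 1 with n = m + 1. Hence the product bound factors as 2^(z+1) times 2^(m+1)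
  -- for z = `∣ Z ∣`, and the first factor is the common lower bound that `product⇒sum` requires.
  perp-sizes : ∀ {m} (p : Fin (suc (suc m)) → Carrier) (Z : Subset (suc (suc m))) →
    (∀ i → lookup Z i ≡ true → p i ≃ 0#) → (∀ i → lookup Z i ≡ false → ¬ p i ≃ 0#) →
    (∃ λ i → lookup Z i ≡ false) →
    {B : Vec Bool (suc (suc m)) → Set} →
    (A? : ∀ x → Dec (Perp p B x)) (B? : ∀ y → Dec (Perp p (Perp p B) y)) →
    ∃ (Perp p B) → ∃ B →
    count (λ x → does (A? (false ∷ x))) ℕ.+ count (λ y → does (B? (false ∷ y)))
      ℕ.≤ 2 ℕ.^ m ℕ.+ 2 ℕ.^ ∣ Z ∣
  perp-sizes {m} p Z zeros nonzeros (i , Zi≡f) {B} A? B? (x , x⊥B) (y , By) =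
    ℕ.*-cancelˡ-≤ 2 (begin
      2 ℕ.* (a ℕ.+ b)                           ≡⟨ double a b ⟩
      (a ℕ.+ a) ℕ.+ (b ℕ.+ b)                   ≡⟨ cong₂ ℕ._+_ (twice A?) (twice B?) ⟨
      count (does ∘ A?) ℕ.+ count (does ∘ B?)   ≤⟨ product⇒sum (ℕ.m^n>0 2 (suc ∣ Z ∣))
                                                     (large A? x x⊥B) (large B? y y⊥⊥) product ⟩
      2 ℕ.^ suc m ℕ.+ 2 ℕ.^ suc ∣ Z ∣           ≡⟨ ℕ.*-distribˡ-+ 2 (2 ℕ.^ m) (2 ℕ.^ ∣ Z ∣) ⟨
      2 ℕ.* (2 ℕ.^ m ℕ.+ 2 ℕ.^ ∣ Z ∣)           ∎)
    where
    open ℕ.≤-Reasoning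
    a = count (λ x → does (A? (false ∷ x)))
    b = count (λ y → does (B? (false ∷ y)))

    double : ∀ c d → 2 ℕ.* (c ℕ.+ d) ≡ (c ℕ.+ c) ℕ.+ (d ℕ.+ d)
    double = ℕ-ring

    y⊥⊥ : Perp p (Perp p B) y
    y⊥⊥ x x⊥B = ≃-trans (pairing-comm p y x) (x⊥B y By)

    -- Negation exchanges the two heads, so both halves of an orthogonal set are equally large.
    twice : ∀ {B : Vec Bool (suc (suc m)) → Set} (A? : ∀ x → Dec (Perp p B x)) →
      count (does ∘ A?)
        ≡ count (λ x → does (A? (false ∷ x))) ℕ.+ count (λ x → does (A? (false ∷ x)))
    twice {B} A? = cong (count (λ x → does (A? (false ∷ x))) ℕ.+_)
      (≡.trans (≡.sym (count-∘-map-not (λ x → does (A? (true ∷ x)))))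
        (count-cong λ x → agree x (A? (true ∷ map not x)) (A? (false ∷ x))))
      where
      agree : ∀ x (d : Dec (Perp p B (true ∷ map not x))) (e : Dec (Perp p B (false ∷ x))) →
        does d ≡ does e
      agree x (yes _) (yes _) = refl
      agree x (no ¬d) (yes e) = contradiction (perp-map-not p (false ∷ x) e) ¬d
      agree x (no _)  (no _)  = refl
      agree x (yes d) (no ¬e) = contradiction
        (subst (λ t → Perp p B (false ∷ t)) (not-not x) (perp-map-not p (true ∷ map not x) d)) ¬e
        where
        not-not : ∀ {n} (x : Vec Bool n) → map not (map not x) ≡ x
        not-not []      = refl
        not-not (b ∷ x) = cong₂ _∷_ (Bool.not-involutive b) (not-not x)

    large : ∀ {B : Vec Bool (suc (suc m)) → Set} (A? : ∀ x → Dec (Perp p B x)) x → Perp p B x →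
      2 ℕ.^ suc ∣ Z ∣ ℕ.≤ count (does ∘ A?)
    large A? x x⊥B = antipodal⇒2^≤ Z (does ∘ A?)
      (λ i x Zi A?x → dec-true (A? (updateAt x i not)) (perp-flip p x (zeros i Zi) (does⇒ (A? x) A?x)))
      i Zi≡f x (dec-true (A? x) x⊥B) (dec-true (A? (map not x)) (perp-map-not p x x⊥B))

    product : count (does ∘ A?) ℕ.* count (does ∘ B?) ℕ.≤ 2 ℕ.^ suc ∣ Z ∣ ℕ.* 2 ℕ.^ suc m
    product = subst (count (does ∘ A?) ℕ.* count (does ∘ B?) ℕ.≤_)
      (≡.trans (cong (2 ℕ.^_) (exponents m ∣ Z ∣)) (ℕ.^-distribˡ-+-* 2 (suc ∣ Z ∣) (suc m)))
      (crossed⇒product-bound p Z nonzeros (does ∘ A?) (does ∘ B?)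
        λ x x′ y y′ Ax Ax′ By By′ → ≃-trans
          (+-cong (orthogonal x y Ax By) (orthogonal x′ y′ Ax′ By′))
          (≃-sym (+-cong (orthogonal x y′ Ax By′) (orthogonal x′ y Ax′ By))))
      where
      exponents : ∀ m z → suc (suc m) ℕ.+ z ≡ suc z ℕ.+ suc m
      exponents = ℕ-ring
      orthogonal : ∀ x y → does (A? x) ≡ true → does (B? y) ≡ true → pairing p x y ≃ 0#
      orthogonal x y Ax By =
        ≃-trans (pairing-comm p x y) (does⇒ (B? y) By x (does⇒ (A? x) Ax))

  -- Spanning subfamilies of rational vectors

  open SetoidReasoning setoid

  infix 8 _∙_
  _∙_ : ∀ {N} → (Fin N → ℚ) → (Fin N → Carrier) → Carrier
  u ∙ q = sum λ i → ι (u i) * q i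

  ∙-0 : ∀ {N} (u : Fin N → ℚ) {q} → (∀ i → q i ≃ 0#) → u ∙ q ≃ 0#
  ∙-0 {N} u q≃0 = ≃-trans
    (sum-cong-≋ λ i → ≃-trans (*-congˡ (q≃0 i)) (zeroʳ _)) (sum-replicate-zero N)

  -- One step of Gaussian elimination with pivot row v: the head of u is cleared and dropped.
  eliminate : ∀ {N} (u v : Fin (suc N) → ℚ) → ¬ v zero ≡ 0ℚ → Fin N → ℚ
  eliminate u v v₀≢0 i = u (suc i) ℚ.+ ℚ.- (u zero ℚ.* ℚ.1/ v zero) ℚ.* v (suc i)
    where instance _ = ℚ.≢-nonZero v₀≢0

  -- A multiple of v contributes nothing against a q that v annihilates, and the cleared head no
  -- longer sees `q zero`.
  eliminate-∙ : ∀ {N} (u v : Fin (suc N) → ℚ) (v₀≢0 : ¬ v zero ≡ 0ℚ) q →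
    v ∙ q ≃ 0# → eliminate u v v₀≢0 ∙ tail q ≃ u ∙ q
  eliminate-∙ {N} u v v₀≢0 q v∙q≃0 = begin
    w ∙ tail q                                        ≈⟨ +-identityˡ _ ⟨
    0# + w ∙ tail q                                   ≈⟨ +-congʳ (≃-sym head≃0) ⟩
    ι (u zero ℚ.+ d ℚ.* v zero) * q zero + w ∙ tail q   ≡⟨⟩
    sum (λ i → ι (u i ℚ.+ d ℚ.* v i) * q i)           ≈⟨ sum-cong-≋ (λ i → expand (u i) (v i) (q i)) ⟩
    sum (λ i → ι (u i) * q i + ι d * (ι (v i) * q i)) ≈⟨ ∑-distrib-+ (λ i → ι (u i) * q i)
                                                           (λ i → ι d * (ι (v i) * q i)) ⟩
    u ∙ q + sum (λ i → ι d * (ι (v i) * q i))         ≈⟨ +-congˡ (*-distribˡ-sum (ι d)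
                                                           (λ i → ι (v i) * q i)) ⟨
    u ∙ q + ι d * v ∙ q                               ≈⟨ +-congˡ (≃-trans (*-congˡ v∙q≃0) (zeroʳ _)) ⟩
    u ∙ q + 0#                                        ≈⟨ +-identityʳ _ ⟩
    u ∙ q                                             ∎
    where
    instance _ = ℚ.≢-nonZero v₀≢0
    d = ℚ.- (u zero ℚ.* ℚ.1/ v zero)
    w = eliminate u v v₀≢0
    expand : ∀ a b r → ι (a ℚ.+ d ℚ.* b) * r ≃ ι a * r + ι d * (ι b * r)
    expand a b r = ≃-trans
      (*-congʳ (≃-trans (+-homo a (d ℚ.* b)) (+-congˡ (*-homo d b))))
      (≃-trans (distribʳ r (ι a) (ι d * ι b)) (+-congˡ (*-assoc _ _ _)))
    u₀+dv₀≡0 : u zero ℚ.+ d ℚ.* v zero ≡ 0ℚ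
    u₀+dv₀≡0 = ≡.trans (cong (u zero ℚ.+_)
      (≡.trans (≡.sym (ℚ.neg-distribˡ-* (u zero ℚ.* ℚ.1/ v zero) (v zero)))
        (cong ℚ.-_ (≡.trans (ℚ.*-assoc (u zero) (ℚ.1/ v zero) (v zero))
          (≡.trans (cong (u zero ℚ.*_) (ℚ.*-inverseˡ (v zero))) (ℚ.*-identityʳ (u zero)))))))
      (ℚ.+-inverseʳ (u zero))
    head≃0 : ι (u zero ℚ.+ d ℚ.* v zero) * q zero ≃ 0#
    head≃0 = ≃-trans (*-congʳ (≃-trans (reflexive (cong ι u₀+dv₀≡0)) 0#-homo)) (zeroˡ _)

  -- Linear span by duality: no coefficients are exhibited. The vectors are rational, but the test
  -- vectors q range over the whole ring, so real weights can be used for q.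
  Spans : ∀ {N k} {I : Set} → (I → Fin N → ℚ) → (Fin k → I) → Set
  Spans u g = ∀ q → (∀ j → u (g j) ∙ q ≃ 0#) → ∀ i → u i ∙ q ≃ 0#

  private
    Pivot : ∀ {N} {I : Set} → (I → Fin (suc N) → ℚ) → Set
    Pivot u = ∃ λ i → ¬ u i zero ≡ 0ℚ

    spans-tail : ∀ {N k} {I : Set} (u : I → Fin (suc N) → ℚ) → ¬ Pivot u →
      (g : Fin k → I) → Spans (tail ∘ u) g → Spans u g
    spans-tail u ¬pivot g spans q vanish i =
      ≃-trans (drop i) (spans (tail q) (λ j → ≃-trans (≃-sym (drop (g j))) (vanish j)) i)
      where
      drop : ∀ i → u i ∙ q ≃ tail (u i) ∙ tail q
      drop i = ≃-trans (+-congʳ (≃-trans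
        (*-congʳ (≃-trans (reflexive (cong ι u₀≡0)) 0#-homo)) (zeroˡ _))) (+-identityˡ _)
        where
        u₀≡0 : u i zero ≡ 0ℚ
        u₀≡0 = decidable-stable (u i zero ℚ.≟ 0ℚ) λ u₀≢0 → ¬pivot (i , u₀≢0)

    spans-pivot : ∀ {N k} {I : Set} (u : I → Fin (suc N) → ℚ) ((v , v₀≢0) : Pivot u) →
      (g : Fin k → I) → Spans (λ i → eliminate (u i) (u v) v₀≢0) g → Spans u (v ◂ g)
    spans-pivot u (v , v₀≢0) g spans q vanish i =
      ≃-trans (≃-sym (eliminate-∙ (u i) (u v) v₀≢0 q (vanish zero)))
        (spans (tail q) (λ j → ≃-trans (eliminate-∙ (u (g j)) (u v) v₀≢0 q (vanish zero))
          (vanish (suc j))) i)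

  -- Each coordinate yields at most one pivot row. The index type is arbitrary, so whether a pivot
  -- exists is decided by excluded middle; this is the source of the double negation.
  spanning : ∀ {N} {I : Set} (u : I → Fin N → ℚ) → I →
    ¬ ¬ (Σ (Fin N → I) λ g → Spans u g)
  spanning {zero}  u i₀ none = none ((λ ()) , λ q _ i → ≃-refl)
  spanning {suc N} u i₀ none = ¬¬-excluded-middle {A = Pivot u} λ
    { (yes (v , v₀≢0)) → spanning (λ i → eliminate (u i) (u v) v₀≢0) i₀ λ (g , spans) →
        none (v ◂ g , spans-pivot u (v , v₀≢0) g spans)
    ; (no ¬pivot) → spanning (tail ∘ u) i₀ λ (g , spans) →
        -- A coordinate without pivot costs no generator; `i₀` fills the vacant slot.
        none (i₀ ◂ g , spans-tail u ¬pivot (i₀ ◂ g) λ q vanish → spans q (vanish ∘ suc))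
    }

  -- A nonzero annihilator p forces elimination to meet a coordinate without pivot, where one
  -- generator is saved. As long as pivots are found, `tail p` annihilates the reduced family and
  -- stays nonzero: otherwise the pivot row would make `p zero` vanish as well. This cannot last
  -- down to dimension zero.
  spanning-hyperplane : ∀ {N} {I : Set} (u : I → Fin (suc N) → ℚ) → I →
    ∀ p → ¬ (∀ j → p j ≃ 0#) → (∀ i → u i ∙ p ≃ 0#) →
    ¬ ¬ (Σ (Fin N → I) λ g → Spans u g)
  spanning-hyperplane {N} u i₀ p p≄0 u∙p≃0 none = ¬¬-excluded-middle {A = Pivot u} λ
    { (no ¬pivot) → spanning (tail ∘ u) i₀ λ (g , spans) → none (g , spans-tail u ¬pivot g spans)
    ; (yes (v , v₀≢0)) → descend N u p (tail≄0 v v₀≢0) u∙p≃0 none v v₀≢0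
    }
    where
    tail≄0 : ∀ v → ¬ u v zero ≡ 0ℚ → ¬ (∀ j → tail p j ≃ 0#)
    tail≄0 v v₀≢0 tail≃0 = p≄0 λ
      { zero → ι-cancel (u v zero) v₀≢0 (≃-trans (≃-sym (≃-trans
          (+-congˡ (∙-0 (tail (u v)) tail≃0)) (+-identityʳ _))) (u∙p≃0 v))
      ; (suc j) → tail≃0 j
      }
    descend : ∀ N (u : _ → Fin (suc N) → ℚ) p → ¬ (∀ j → tail p j ≃ 0#) → (∀ i → u i ∙ p ≃ 0#) →
      ¬ (Σ (Fin N → _) λ g → Spans u g) → ∀ v → ¬ ¬ u v zero ≡ 0ℚ
    descend zero    u p tail≄0 u∙p≃0 none v v₀≢0 = tail≄0 λ ()
    descend (suc N) u p tail≄0 u∙p≃0 none v v₀≢0 =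
      spanning-hyperplane (λ i → eliminate (u i) (u v) v₀≢0) i₀ (tail p) tail≄0
        (λ i → ≃-trans (eliminate-∙ (u i) (u v) v₀≢0 p (u∙p≃0 v)) (u∙p≃0 i))
        λ (g , spans) → none (v ◂ g , spans-pivot u (v , v₀≢0) g spans)

  signedSum : ∀ {N} → Vec Bool N → (Fin N → Carrier) → Carrier
  signedSum x q = sum λ i → signed (lookup x i) (q i)

  signs : ∀ {N} → Vec Bool N → Fin N → ℚ
  signs x i = if lookup x i then ℚ.- 1ℚ else 1ℚ

  signs-∙ : ∀ {N} (x : Vec Bool N) q → signs x ∙ q ≃ signedSum x q
  signs-∙ x q = sum-cong-≋ λ i → act (lookup x i) (q i)
    where
    act : ∀ b r → ι (if b then ℚ.- 1ℚ else 1ℚ) * r ≃ signed b r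
    act false r = ≃-trans (*-congʳ 1#-homo) (*-identityˡ r)
    act true  r = ≃-trans (*-congʳ (≃-trans (-‿homo 1ℚ) (-‿cong 1#-homo))) (-1*x≈-x r)

  -- The sign vectors in the linear span of α, by the same duality as in `Spans`.
  Closure : ∀ {k N} → (Fin k → Vec Bool N) → Vec Bool N → Set
  Closure α x = ∀ q → (∀ j → signedSum (α j) q ≃ 0#) → signedSum x q ≃ 0#

  closure-generators : ∀ {N} {A : Vec Bool (suc N) → Set} → ∃ A →
    ∀ q → ¬ (∀ j → q j ≃ 0#) → (∀ x → A x → signedSum x q ≃ 0#) →
    ¬ ¬ (Σ (Fin N → ∃ A) λ α → ∀ x → A x → Closure (proj₁ ∘ α) x)
  closure-generators {N} {A} a₀ q q≄0 A⊥q = ¬¬-map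
    (λ (g , spans) → g , λ x Ax r vanish → ≃-trans (≃-sym (signs-∙ x r))
      (spans r (λ j → ≃-trans (signs-∙ (proj₁ (g j)) r) (vanish j)) (x , Ax)))
    -- Indexing the family by `∃ A` makes the generators members of A.
    (spanning-hyperplane {I = ∃ A} (signs ∘ proj₁) a₀ q q≄0
      λ (x , Ax) → ≃-trans (signs-∙ x q) (A⊥q x Ax))

-- Complex numbers

infix 4 _≃ℂ_ _&_
record _≃ℂ_ (z w : ℂ) : Set where
  constructor _&_
  field
    re≃ : re z ≃ℝ re w
    im≃ : im z ≃ℝ im w
open _≃ℂ_ public

infixl 6 _+ᶜ_
infixl 7 _*ᶜ_
infix  8 -ᶜ_

opaque
  _+ᶜ_ _*ᶜ_ : ℂ → ℂ → ℂ
  z +ᶜ w = (re z +ᴿ re w) +i (im z +ᴿ im w)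
  z *ᶜ w = (re z *ᴿ re w +ᴿ -ᴿ (im z *ᴿ im w)) +i (re z *ᴿ im w +ᴿ im z *ᴿ re w)

  -ᶜ_ : ℂ → ℂ
  -ᶜ z = (-ᴿ re z) +i (-ᴿ im z)

  0ᶜ 1ᶜ : ℂ
  0ᶜ = 0ᴿ +i 0ᴿ
  1ᶜ = 1ᴿ +i 0ᴿ

opaque
  unfolding _+ᴿ_ _+ᶜ_

  ℂ-*-cong : ∀ {x y u v} → x ≃ℂ y → u ≃ℂ v → (x *ᶜ u) ≃ℂ (y *ᶜ v)
  ℂ-*-cong {x} {y} {u} {v} (r & i) (s & j) =
    ℝ-+-cong {re x *ᴿ re u} {re y *ᴿ re v}
      { -ᴿ (im x *ᴿ im u)} { -ᴿ (im y *ᴿ im v)}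
      (ℝ-*-cong {re x} {re y} {re u} {re v} r s)
      (ℝ-neg-cong {im x *ᴿ im u} {im y *ᴿ im v} (ℝ-*-cong {im x} {im y} {im u} {im v} i j))
    & ℝ-+-cong {re x *ᴿ im u} {re y *ᴿ im v} {im x *ᴿ re u} {im y *ᴿ re v}
      (ℝ-*-cong {re x} {re y} {im u} {im v} r j) (ℝ-*-cong {im x} {im y} {re u} {re v} i s)

  ℂ-*-assoc : ∀ x y z → ((x *ᶜ y) *ᶜ z) ≃ℂ (x *ᶜ (y *ᶜ z))
  ℂ-*-assoc x y z =
    (≗⇒≃ λ n → QS.solve 6 (λ a b c d e f →
      (a :* c :+ :- (b :* d)) :* e :+ :- ((a :* d :+ b :* c) :* f)
      := a :* (c :* e :+ :- (d :* f)) :+ :- (b :* (c :* f :+ d :* e))) refl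
      (seq (re x) n) (seq (im x) n) (seq (re y) n) (seq (im y) n) (seq (re z) n) (seq (im z) n))
    & (≗⇒≃ λ n → QS.solve 6 (λ a b c d e f →
      (a :* c :+ :- (b :* d)) :* f :+ (a :* d :+ b :* c) :* e
      := a :* (c :* f :+ d :* e) :+ b :* (c :* e :+ :- (d :* f))) refl
      (seq (re x) n) (seq (im x) n) (seq (re y) n) (seq (im y) n) (seq (re z) n) (seq (im z) n))

  ℂ-*-identityˡ : ∀ x → (1ᶜ *ᶜ x) ≃ℂ x
  ℂ-*-identityˡ x =
    (≗⇒≃ λ n → QS.solve 2 (λ a b →
      QS.con 1ℚ :* a :+ :- (QS.con 0ℚ :* b) := a) refl (seq (re x) n) (seq (im x) n))
    & (≗⇒≃ λ n → QS.solve 2 (λ a b →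
      QS.con 1ℚ :* b :+ QS.con 0ℚ :* a := b) refl (seq (re x) n) (seq (im x) n))

  ℂ-*-identityʳ : ∀ x → (x *ᶜ 1ᶜ) ≃ℂ x
  ℂ-*-identityʳ x =
    (≗⇒≃ λ n → QS.solve 2 (λ a b →
      a :* QS.con 1ℚ :+ :- (b :* QS.con 0ℚ) := a) refl (seq (re x) n) (seq (im x) n))
    & (≗⇒≃ λ n → QS.solve 2 (λ a b →
      a :* QS.con 0ℚ :+ b :* QS.con 1ℚ := b) refl (seq (re x) n) (seq (im x) n))

  ℂ-distribˡ : ∀ x y z → (x *ᶜ (y +ᶜ z)) ≃ℂ (x *ᶜ y +ᶜ x *ᶜ z)
  ℂ-distribˡ x y z =
    (≗⇒≃ λ n → QS.solve 6 (λ a b c d e f →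
      a :* (c :+ e) :+ :- (b :* (d :+ f))
      := (a :* c :+ :- (b :* d)) :+ (a :* e :+ :- (b :* f))) refl
      (seq (re x) n) (seq (im x) n) (seq (re y) n) (seq (im y) n) (seq (re z) n) (seq (im z) n))
    & (≗⇒≃ λ n → QS.solve 6 (λ a b c d e f →
      a :* (d :+ f) :+ b :* (c :+ e) := (a :* d :+ b :* c) :+ (a :* f :+ b :* e)) refl
      (seq (re x) n) (seq (im x) n) (seq (re y) n) (seq (im y) n) (seq (re z) n) (seq (im z) n))

  ℂ-distribʳ : ∀ x y z → ((y +ᶜ z) *ᶜ x) ≃ℂ (y *ᶜ x +ᶜ z *ᶜ x)
  ℂ-distribʳ x y z =
    (≗⇒≃ λ n → QS.solve 6 (λ a b c d e f →
      (c :+ e) :* a :+ :- ((d :+ f) :* b)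
      := (c :* a :+ :- (d :* b)) :+ (e :* a :+ :- (f :* b))) refl
      (seq (re x) n) (seq (im x) n) (seq (re y) n) (seq (im y) n) (seq (re z) n) (seq (im z) n))
    & (≗⇒≃ λ n → QS.solve 6 (λ a b c d e f →
      (c :+ e) :* b :+ (d :+ f) :* a := (c :* b :+ d :* a) :+ (e :* b :+ f :* a)) refl
      (seq (re x) n) (seq (im x) n) (seq (re y) n) (seq (im y) n) (seq (re z) n) (seq (im z) n))

  ℂ-*-comm : ∀ x y → (x *ᶜ y) ≃ℂ (y *ᶜ x)
  ℂ-*-comm x y =
    (≗⇒≃ λ n → QS.solve 4 (λ a b c d →
      a :* c :+ :- (b :* d) := c :* a :+ :- (d :* b)) refl
      (seq (re x) n) (seq (im x) n) (seq (re y) n) (seq (im y) n))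
    & (≗⇒≃ λ n → QS.solve 4 (λ a b c d →
      a :* d :+ b :* c := c :* b :+ d :* a) refl
      (seq (re x) n) (seq (im x) n) (seq (re y) n) (seq (im y) n))

  ℂ-isMagma : IsMagma _≃ℂ_ _+ᶜ_
  ℂ-isMagma = record
    { isEquivalence = record
      { refl  = λ {x} → (≗⇒≃ λ _ → refl) & (≗⇒≃ λ _ → refl)
      ; sym   = λ {x} {y} (r & i) → ℝ-sym {re x} {re y} r & ℝ-sym {im x} {im y} i
      ; trans = λ {x} {y} {z} (r & i) (s & j) →
          ℝ-trans {re x} {re y} {re z} r s & ℝ-trans {im x} {im y} {im z} i j
      }
    ; ∙-cong = λ {x} {y} {u} {v} (r & i) (s & j) →
        ℝ-+-cong {re x} {re y} {re u} {re v} r s & ℝ-+-cong {im x} {im y} {im u} {im v} i j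
    }

  ℂ-isSemigroup : IsSemigroup _≃ℂ_ _+ᶜ_
  ℂ-isSemigroup = record
    { isMagma = ℂ-isMagma
    ; assoc = λ x y z →
        (≗⇒≃ λ n → ℚ.+-assoc (seq (re x) n) (seq (re y) n) (seq (re z) n))
        & (≗⇒≃ λ n → ℚ.+-assoc (seq (im x) n) (seq (im y) n) (seq (im z) n))
    }

  ℂ-isMonoid : IsMonoid _≃ℂ_ _+ᶜ_ 0ᶜ
  ℂ-isMonoid = record
    { isSemigroup = ℂ-isSemigroup
    ; identity =
        (λ x → (≗⇒≃ λ n → ℚ.+-identityˡ (seq (re x) n)) & (≗⇒≃ λ n → ℚ.+-identityˡ (seq (im x) n)))
      , (λ x → (≗⇒≃ λ n → ℚ.+-identityʳ (seq (re x) n)) & (≗⇒≃ λ n → ℚ.+-identityʳ (seq (im x) n)))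
    }

  ℂ-isGroup : IsGroup _≃ℂ_ _+ᶜ_ 0ᶜ -ᶜ_
  ℂ-isGroup = record
    { isMonoid = ℂ-isMonoid
    ; inverse =
        (λ x → (≗⇒≃ λ n → ℚ.+-inverseˡ (seq (re x) n)) & (≗⇒≃ λ n → ℚ.+-inverseˡ (seq (im x) n)))
      , (λ x → (≗⇒≃ λ n → ℚ.+-inverseʳ (seq (re x) n)) & (≗⇒≃ λ n → ℚ.+-inverseʳ (seq (im x) n)))
    ; ⁻¹-cong = λ {x} {y} (r & i) → ℝ-neg-cong {re x} {re y} r & ℝ-neg-cong {im x} {im y} i
    }

  ℂ-isAbelianGroup : IsAbelianGroup _≃ℂ_ _+ᶜ_ 0ᶜ -ᶜ_
  ℂ-isAbelianGroup = record
    { isGroup = ℂ-isGroup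
    ; comm = λ x y →
        (≗⇒≃ λ n → ℚ.+-comm (seq (re x) n) (seq (re y) n))
        & (≗⇒≃ λ n → ℚ.+-comm (seq (im x) n) (seq (im y) n))
    }

  ℂ-isRing : IsRing _≃ℂ_ _+ᶜ_ _*ᶜ_ -ᶜ_ 0ᶜ 1ᶜ
  ℂ-isRing = record
    { +-isAbelianGroup = ℂ-isAbelianGroup
    ; *-cong = ℂ-*-cong
    ; *-assoc = ℂ-*-assoc
    ; *-identity = ℂ-*-identityˡ , ℂ-*-identityʳ
    ; distrib = ℂ-distribˡ , ℂ-distribʳ
    }

  ℂ-isCommutativeRing : IsCommutativeRing _≃ℂ_ _+ᶜ_ _*ᶜ_ -ᶜ_ 0ᶜ 1ᶜ
  ℂ-isCommutativeRing = record { isRing = ℂ-isRing ; *-comm = ℂ-*-comm }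

ℂ-commutativeRing : CommutativeRing 0ℓ 0ℓ
ℂ-commutativeRing = record { isCommutativeRing = ℂ-isCommutativeRing }

opaque
  unfolding _+ᴿ_ _+ᶜ_

  ℂ-*-≃ : ∀ z w → z ℂ-Ring.* w ≃ℂ z *ᶜ w
  ℂ-*-≃ z w = (≗⇒≃ λ _ → refl) & (≗⇒≃ λ _ → refl)

  ℂ-+-≃ : ∀ z w → z ℂ-Ring.+ w ≃ℂ z +ᶜ w
  ℂ-+-≃ z w = (≗⇒≃ λ _ → refl) & (≗⇒≃ λ _ → refl)

  ℂ-0-≃ : ℂ-Ring.0# ≃ℂ 0ᶜ
  ℂ-0-≃ = (≗⇒≃ λ _ → refl) & (≗⇒≃ λ _ → refl)

  ℂ-1-≃ : ℂ-Ring.1# ≃ℂ 1ᶜ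
  ℂ-1-≃ = (≗⇒≃ λ _ → refl) & (≗⇒≃ λ _ → refl)

  ℝ-1-≃ : ℝ-Ring.1# ≃ℝ 1ᴿ
  ℝ-1-≃ = ≗⇒≃ λ _ → refl

  ℝ-0-≃ : ℝ-Ring.0# ≃ℝ 0ᴿ
  ℝ-0-≃ = ≗⇒≃ λ _ → refl

  re-+ : ∀ z w → re (z +ᶜ w) ≡ re z +ᴿ re w
  re-+ z w = refl

  im-+ : ∀ z w → im (z +ᶜ w) ≡ im z +ᴿ im w
  im-+ z w = refl

  re-0 : re 0ᶜ ≡ 0ᴿ
  re-0 = refl

  im-0 : im 0ᶜ ≡ 0ᴿ
  im-0 = refl

record IsConjugation (C : CommutativeRing 0ℓ 0ℓ)
  (conj : CommutativeRing.Carrier C → CommutativeRing.Carrier C) : Set where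
  open CommutativeRing C renaming (_≈_ to _≃_)
  field
    conj-cong       : ∀ z w → z ≃ w → conj z ≃ conj w
    conj-0          : conj 0# ≃ 0#
    conj-+          : ∀ z w → conj (z + w) ≃ conj z + conj w
    conj-*          : ∀ z w → conj (z * w) ≃ conj z * conj w
    conj-involutive : ∀ z → conj (conj z) ≃ z

opaque
  unfolding _+ᴿ_ _+ᶜ_

  conj-isConjugation : IsConjugation ℂ-commutativeRing conj
  conj-isConjugation = record
    { conj-cong = λ z w (r & i) → r & ℝ-neg-cong {im z} {im w} i
    ; conj-0 = (≗⇒≃ λ _ → refl) & (≗⇒≃ λ _ → refl)
    ; conj-+ = λ z w → (≗⇒≃ λ _ → refl) & (≗⇒≃ λ n → ℚ.neg-distrib-+ (seq (im z) n) (seq (im w) n))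
    ; conj-* = λ z w →
        (≗⇒≃ λ n → QS.solve 4 (λ a b c d →
          a :* c :+ :- (b :* d) := a :* c :+ :- ((:- b) :* (:- d))) refl
          (seq (re z) n) (seq (im z) n) (seq (re w) n) (seq (im w) n))
        & (≗⇒≃ λ n → QS.solve 4 (λ a b c d →
          :- (a :* d :+ b :* c) := a :* (:- d) :+ (:- b) :* c) refl
          (seq (re z) n) (seq (im z) n) (seq (re w) n) (seq (im w) n))
    ; conj-involutive = λ z → (≗⇒≃ λ _ → refl)
        & (≗⇒≃ λ n → QS.solve 1 (λ p → :- (:- p) := p) refl (seq (im z) n))
    }

-- Inner products

module InnerProduct (C : CommutativeRing 0ℓ 0ℓ)
  (conj : CommutativeRing.Carrier C → CommutativeRing.Carrier C)
  (isConjugation : IsConjugation C conj)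
  (m w : ℕ)
  where

  open CommutativeRing C hiding (zero)
    renaming (_≈_ to _≃_; refl to ≃-refl; sym to ≃-sym; trans to ≃-trans)
  open SemiringSum semiring using
    (sum; sum-cong-≋; ∑-distrib-+; *-distribˡ-sum; *-distribʳ-sum; sum-replicate-zero; ∑-comm)
  open SetoidReasoning setoid

  open IsConjugation isConjugation

  Basis : Set
  Basis = Fin m × Fin w

  State Operator : Set
  State    = Basis → Carrier
  Operator = Basis → Basis → Carrier

  ∑ : (Basis → Carrier) → Carrier
  ∑ g = sum λ i → sum λ j → g (i , j)

  identity : Operator
  identity a b = if does (≡-dec Fin._≟_ Fin._≟_ a b) then 1# else 0#

  infixr 7 _·_ _⊚_
  infixl 6 _⊞_
  infix  4 _≋_ _≐_
  infix  8 ⟪_,_⟫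

  _·_ : Operator → State → State
  (A · ψ) a = ∑ λ b → A a b * ψ b

  _⊚_ _⊞_ : Operator → Operator → Operator
  (A ⊚ B) a c = ∑ λ b → A a b * B b c
  (A ⊞ B) a b = A a b + B a b

  _† : Operator → Operator
  (A †) a b = conj (A b a)

  _≋_ : Operator → Operator → Set
  A ≋ B = ∀ a b → A a b ≃ B a b

  _≐_ : State → State → Set
  φ ≐ ψ = ∀ a → φ a ≃ ψ a

  ⟪_,_⟫ : State → State → Carrier
  ⟪ φ , ψ ⟫ = ∑ λ a → conj (φ a) * ψ a

  ∑-cong : ∀ {g h : State} → g ≐ h → ∑ g ≃ ∑ h
  ∑-cong g≐h = sum-cong-≋ λ i → sum-cong-≋ λ j → g≐h (i , j)

  ∑-+ : ∀ (g h : State) → ∑ (λ a → g a + h a) ≃ ∑ g + ∑ h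
  ∑-+ g h = ≃-trans
    (sum-cong-≋ λ i → ∑-distrib-+ (λ j → g (i , j)) (λ j → h (i , j)))
    (∑-distrib-+ (λ i → sum λ j → g (i , j)) (λ i → sum λ j → h (i , j)))

  ∑-*ˡ : ∀ c (g : State) → c * ∑ g ≃ ∑ (λ a → c * g a)
  ∑-*ˡ c g = ≃-trans (*-distribˡ-sum c (λ i → sum λ j → g (i , j)))
    (sum-cong-≋ λ i → *-distribˡ-sum c (λ j → g (i , j)))

  ∑-*ʳ : ∀ c (g : State) → ∑ g * c ≃ ∑ (λ a → g a * c)
  ∑-*ʳ c g = ≃-trans (*-distribʳ-sum c (λ i → sum λ j → g (i , j)))
    (sum-cong-≋ λ i → *-distribʳ-sum c (λ j → g (i , j)))

  ∑-0 : ∀ {g : State} → (∀ a → g a ≃ 0#) → ∑ g ≃ 0#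
  ∑-0 g≐0 = ≃-trans
    (sum-cong-≋ λ i → ≃-trans (sum-cong-≋ λ j → g≐0 (i , j)) (sum-replicate-zero w))
    (sum-replicate-zero m)

  ∑-swap : ∀ (g : Operator) → ∑ (λ a → ∑ λ b → g a b) ≃ ∑ (λ b → ∑ λ a → g a b)
  ∑-swap g = begin
    (sum λ i → sum λ j → sum λ k → sum λ l → g (i , j) (k , l))
      ≈⟨ sum-cong-≋ (λ i → ∑-comm λ j k → sum λ l → g (i , j) (k , l)) ⟩
    (sum λ i → sum λ k → sum λ j → sum λ l → g (i , j) (k , l))
      ≈⟨ ∑-comm (λ i k → sum λ j → sum λ l → g (i , j) (k , l)) ⟩
    (sum λ k → sum λ i → sum λ j → sum λ l → g (i , j) (k , l))
      ≈⟨ sum-cong-≋ (λ k → sum-cong-≋ λ i → ∑-comm λ j l → g (i , j) (k , l)) ⟩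
    (sum λ k → sum λ i → sum λ l → sum λ j → g (i , j) (k , l))
      ≈⟨ sum-cong-≋ (λ k → ∑-comm λ i l → sum λ j → g (i , j) (k , l)) ⟩
    (sum λ k → sum λ l → sum λ i → sum λ j → g (i , j) (k , l)) ∎

  sum-conj : ∀ {n} (t : Fin n → Carrier) → conj (sum t) ≃ sum (conj ∘ t)
  sum-conj {zero}  t = conj-0
  sum-conj {suc n} t =
    ≃-trans (conj-+ (t zero) (sum (t ∘ suc))) (+-congˡ (sum-conj (t ∘ suc)))

  ∑-conj : ∀ g → conj (∑ g) ≃ ∑ (conj ∘ g)
  ∑-conj g = ≃-trans (sum-conj λ i → sum λ j → g (i , j))
    (sum-cong-≋ λ i → sum-conj λ j → g (i , j))

  sum-single : ∀ {n} i (t : Fin n → Carrier) → (∀ j → ¬ i ≡ j → t j ≃ 0#) → sum t ≃ t i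
  sum-single {suc n} zero t off = ≃-trans
    (+-congˡ (≃-trans (sum-cong-≋ λ j → off (suc j) λ ()) (sum-replicate-zero n))) (+-identityʳ _)
  sum-single {suc n} (suc i) t off = ≃-trans
    (+-cong (off zero λ ())
      (sum-single i (t ∘ suc) λ j i≢j → off (suc j) (i≢j ∘ Fin.suc-injective)))
    (+-identityˡ _)

  identity-· : ∀ ψ → identity · ψ ≐ ψ
  identity-· ψ (i , j) = begin
    (sum λ k → sum λ l → identity (i , j) (k , l) * ψ (k , l))
      ≈⟨ sum-single i _ (λ k i≢k → ≃-trans
           (sum-cong-≋ λ l → off (k , l) (i≢k ∘ cong proj₁)) (sum-replicate-zero w)) ⟩
    (sum λ l → identity (i , j) (i , l) * ψ (i , l))
      ≈⟨ sum-single j _ (λ l j≢l → off (i , l) (j≢l ∘ cong proj₂)) ⟩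
    identity (i , j) (i , j) * ψ (i , j)
      ≡⟨ cong (λ b → (if b then 1# else 0#) * ψ (i , j))
           (dec-true (≡-dec Fin._≟_ Fin._≟_ (i , j) (i , j)) refl) ⟩
    1# * ψ (i , j)
      ≈⟨ *-identityˡ _ ⟩
    ψ (i , j) ∎
    where
    off : ∀ b → ¬ (i , j) ≡ b → identity (i , j) b * ψ b ≃ 0#
    off b ≢b = ≃-trans (reflexive (cong (λ c → (if c then 1# else 0#) * ψ b)
      (dec-false (≡-dec Fin._≟_ Fin._≟_ (i , j) b) ≢b))) (zeroˡ _)

  ·-congˡ : ∀ {A B} ψ → A ≋ B → A · ψ ≐ B · ψ
  ·-congˡ ψ A≋B a = ∑-cong λ b → *-congʳ (A≋B a b)

  ⊚-· : ∀ A B ψ → (A ⊚ B) · ψ ≐ A · (B · ψ)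
  ⊚-· A B ψ a = begin
    ∑ (λ c → (∑ λ b → A a b * B b c) * ψ c)
      ≈⟨ ∑-cong (λ c → ≃-trans (∑-*ʳ (ψ c) (λ b → A a b * B b c))
           (∑-cong λ b → *-assoc (A a b) (B b c) (ψ c))) ⟩
    ∑ (λ c → ∑ λ b → A a b * (B b c * ψ c))
      ≈⟨ ∑-swap (λ c b → A a b * (B b c * ψ c)) ⟩
    ∑ (λ b → ∑ λ c → A a b * (B b c * ψ c))
      ≈⟨ ∑-cong (λ b → ≃-sym (∑-*ˡ (A a b) (λ c → B b c * ψ c))) ⟩
    ∑ (λ b → A a b * ∑ λ c → B b c * ψ c) ∎

  ⟪⟫-cong : ∀ {φ φ′ ψ ψ′} → φ ≐ φ′ → ψ ≐ ψ′ → ⟪ φ , ψ ⟫ ≃ ⟪ φ′ , ψ′ ⟫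
  ⟪⟫-cong φ≐ ψ≐ = ∑-cong λ a → *-cong (conj-cong _ _ (φ≐ a)) (ψ≐ a)

  adjoint : ∀ A φ ψ → ⟪ φ , A · ψ ⟫ ≃ ⟪ A † · φ , ψ ⟫
  adjoint A φ ψ = begin
    ∑ (λ a → conj (φ a) * ∑ λ b → A a b * ψ b)
      ≈⟨ ∑-cong (λ a → ∑-*ˡ (conj (φ a)) (λ b → A a b * ψ b)) ⟩
    ∑ (λ a → ∑ λ b → conj (φ a) * (A a b * ψ b))
      ≈⟨ ∑-swap (λ a b → conj (φ a) * (A a b * ψ b)) ⟩
    ∑ (λ b → ∑ λ a → conj (φ a) * (A a b * ψ b))
      ≈⟨ ∑-cong (λ b → ∑-cong λ a → move a b) ⟩
    ∑ (λ b → ∑ λ a → conj (conj (A a b) * φ a) * ψ b)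
      ≈⟨ ∑-cong (λ b → ≃-sym (∑-*ʳ (ψ b) (λ a → conj (conj (A a b) * φ a)))) ⟩
    ∑ (λ b → (∑ λ a → conj (conj (A a b) * φ a)) * ψ b)
      ≈⟨ ∑-cong (λ b → *-congʳ (≃-sym (∑-conj λ a → conj (A a b) * φ a))) ⟩
    ∑ (λ b → conj (∑ λ a → conj (A a b) * φ a) * ψ b) ∎
    where
    move : ∀ a b → conj (φ a) * (A a b * ψ b) ≃ conj (conj (A a b) * φ a) * ψ b
    move a b = begin
      conj (φ a) * (A a b * ψ b)               ≈⟨ *-assoc _ _ _ ⟨
      conj (φ a) * A a b * ψ b                 ≈⟨ *-congʳ (*-comm _ _) ⟩
      A a b * conj (φ a) * ψ b                 ≈⟨ *-congʳ (*-congʳ (conj-involutive (A a b))) ⟨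
      conj (conj (A a b)) * conj (φ a) * ψ b   ≈⟨ *-congʳ (conj-* (conj (A a b)) (φ a)) ⟨
      conj (conj (A a b) * φ a) * ψ b          ∎

  isometry : ∀ U → U † ⊚ U ≋ identity → ∀ φ ψ → ⟪ U · φ , U · ψ ⟫ ≃ ⟪ φ , ψ ⟫
  isometry U U†U φ ψ = ≃-trans (adjoint U (U · φ) ψ) (⟪⟫-cong
    (λ a → ≃-trans (≃-sym (⊚-· (U †) U φ a)) (≃-trans (·-congˡ φ U†U a) (identity-· φ a)))
    (λ _ → ≃-refl))

  projection : ∀ P → P † ≋ P → P ⊚ P ≋ P → ∀ φ ψ → ⟪ φ , P · ψ ⟫ ≃ ⟪ P · φ , P · ψ ⟫
  projection P P†≋P PP≋P φ ψ = begin
    ⟪ φ , P · ψ ⟫         ≈⟨ ⟪⟫-cong (λ _ → ≃-refl)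
                               (λ a → ≃-trans (≃-sym (·-congˡ ψ PP≋P a)) (⊚-· P P ψ a)) ⟩
    ⟪ φ , P · (P · ψ) ⟫   ≈⟨ adjoint P φ (P · ψ) ⟩
    ⟪ P † · φ , P · ψ ⟫   ≈⟨ ⟪⟫-cong (·-congˡ φ P†≋P) (λ _ → ≃-refl) ⟩
    ⟪ P · φ , P · ψ ⟫     ∎

  -- The polarised form serves twice: for equal states it gives total probability, and for the final
  -- states of a 0-input and a 1-input it gives orthogonality.
  pythagoras : ∀ P Q → P † ≋ P → P ⊚ P ≋ P → Q † ≋ Q → Q ⊚ Q ≋ Q → P ⊞ Q ≋ identity →
    ∀ φ ψ → ⟪ φ , ψ ⟫ ≃ ⟪ P · φ , P · ψ ⟫ + ⟪ Q · φ , Q · ψ ⟫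
  pythagoras P Q P† PP Q† QQ P+Q φ ψ = begin
    ⟪ φ , ψ ⟫
      ≈⟨ ⟪⟫-cong (λ _ → ≃-refl) (λ a → ≃-trans (≃-sym (identity-· ψ a)) (≃-trans
           (≃-sym (·-congˡ ψ P+Q a)) (⊞-· a))) ⟩
    ∑ (λ a → conj (φ a) * ((P · ψ) a + (Q · ψ) a))
      ≈⟨ ∑-cong (λ a → distribˡ (conj (φ a)) ((P · ψ) a) ((Q · ψ) a)) ⟩
    ∑ (λ a → conj (φ a) * (P · ψ) a + conj (φ a) * (Q · ψ) a)
      ≈⟨ ∑-+ (λ a → conj (φ a) * (P · ψ) a) (λ a → conj (φ a) * (Q · ψ) a) ⟩
    ⟪ φ , P · ψ ⟫ + ⟪ φ , Q · ψ ⟫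
      ≈⟨ +-cong (projection P P† PP φ ψ) (projection Q Q† QQ φ ψ) ⟩
    ⟪ P · φ , P · ψ ⟫ + ⟪ Q · φ , Q · ψ ⟫ ∎
    where
    ⊞-· : ∀ a → ((P ⊞ Q) · ψ) a ≃ (P · ψ) a + (Q · ψ) a
    ⊞-· a = ≃-trans (∑-cong λ b → distribʳ (ψ b) (P a b) (Q a b))
      (∑-+ (λ b → P a b * ψ b) (λ b → Q a b * ψ b))

  ⟪⟫-0ˡ : ∀ φ ψ → (∀ a → φ a ≃ 0#) → ⟪ φ , ψ ⟫ ≃ 0#
  ⟪⟫-0ˡ φ ψ φ≐0 = ∑-0 λ a →
    ≃-trans (*-congʳ (≃-trans (conj-cong _ _ (φ≐0 a)) conj-0)) (zeroˡ _)

  ⟪⟫-0ʳ : ∀ φ ψ → (∀ a → ψ a ≃ 0#) → ⟪ φ , ψ ⟫ ≃ 0#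
  ⟪⟫-0ʳ φ ψ ψ≐0 = ∑-0 λ a → ≃-trans (*-congˡ (ψ≐0 a)) (zeroʳ _)

module ℝ-CR = CommutativeRing ℝ-commutativeRing
module ℝ-Algebra = RationalAlgebra ℝ-commutativeRing constℝ constℝ-homomorphism
open ℝ-Algebra using (signed; pairing; Perp; Closure; signedSum)
module ℝ-Sum = SemiringSum (CommutativeRing.semiring ℝ-commutativeRing)
module ℂ-CR = CommutativeRing ℂ-commutativeRing
module ℂ-Sum = SemiringSum (CommutativeRing.semiring ℂ-commutativeRing)

-- One-query algorithms

seq-sumℝ : ∀ {m} (t : Fin m → ℝ) n → seq (sumℝ t) n ≡ seq (ℝ-Sum.sum t) n
seq-sumℝ {zero}  t n = ≡.sym (seq-0 n)
seq-sumℝ {suc m} t n = ≡.trans (cong (seq (t zero) n ℚ.+_) (seq-sumℝ (t ∘ suc) n))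
  (≡.sym (seq-+ (t zero) (ℝ-Sum.sum (t ∘ suc)) n))

seq-re-+ : ∀ z w n → seq (re (z +ᶜ w)) n ≡ seq (re z) n ℚ.+ seq (re w) n
seq-re-+ z w n = ≡.trans (cong (λ x → seq x n) (re-+ z w)) (seq-+ (re z) (re w) n)

seq-im-+ : ∀ z w n → seq (im (z +ᶜ w)) n ≡ seq (im z) n ℚ.+ seq (im w) n
seq-im-+ z w n = ≡.trans (cong (λ x → seq x n) (im-+ z w)) (seq-+ (im z) (im w) n)

seq-re-sumℂ : ∀ {m} (t : Fin m → ℂ) n → seq (re (sumℂ t)) n ≡ seq (re (ℂ-Sum.sum t)) n
seq-re-sumℂ {zero}  t n = ≡.sym (≡.trans (cong (λ x → seq x n) re-0) (seq-0 n))
seq-re-sumℂ {suc m} t n = ≡.trans (cong (seq (re (t zero)) n ℚ.+_) (seq-re-sumℂ (t ∘ suc) n))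
  (≡.sym (seq-re-+ (t zero) (ℂ-Sum.sum (t ∘ suc)) n))

seq-im-sumℂ : ∀ {m} (t : Fin m → ℂ) n → seq (im (sumℂ t)) n ≡ seq (im (ℂ-Sum.sum t)) n
seq-im-sumℂ {zero}  t n = ≡.sym (≡.trans (cong (λ x → seq x n) im-0) (seq-0 n))
seq-im-sumℂ {suc m} t n = ≡.trans (cong (seq (im (t zero)) n ℚ.+_) (seq-im-sumℂ (t ∘ suc) n))
  (≡.sym (seq-im-+ (t zero) (ℂ-Sum.sum (t ∘ suc)) n))

module _ {w : ℕ} where

  seq-sumℝ² : ∀ {m} (t : Fin m → Fin w → ℝ) n →
    seq (sumℝ λ i → sumℝ (t i)) n ≡ seq (ℝ-Sum.sum λ i → ℝ-Sum.sum (t i)) n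
  seq-sumℝ² {zero}  t n = ≡.sym (seq-0 n)
  seq-sumℝ² {suc m} t n = ≡.trans (cong₂ ℚ._+_ (seq-sumℝ (t zero) n) (seq-sumℝ² (t ∘ suc) n))
    (≡.sym (seq-+ (ℝ-Sum.sum (t zero)) (ℝ-Sum.sum λ i → ℝ-Sum.sum (t (suc i))) n))

  seq-re-sumℂ² : ∀ {m} (t : Fin m → Fin w → ℂ) n →
    seq (re (sumℂ λ i → sumℂ (t i))) n ≡ seq (re (ℂ-Sum.sum λ i → ℂ-Sum.sum (t i))) n
  seq-re-sumℂ² {zero}  t n = ≡.sym (≡.trans (cong (λ x → seq x n) re-0) (seq-0 n))
  seq-re-sumℂ² {suc m} t n = ≡.trans (cong₂ ℚ._+_ (seq-re-sumℂ (t zero) n) (seq-re-sumℂ² (t ∘ suc) n))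
    (≡.sym (seq-re-+ (ℂ-Sum.sum (t zero)) (ℂ-Sum.sum λ i → ℂ-Sum.sum (t (suc i))) n))

  seq-im-sumℂ² : ∀ {m} (t : Fin m → Fin w → ℂ) n →
    seq (im (sumℂ λ i → sumℂ (t i))) n ≡ seq (im (ℂ-Sum.sum λ i → ℂ-Sum.sum (t i))) n
  seq-im-sumℂ² {zero}  t n = ≡.sym (≡.trans (cong (λ x → seq x n) im-0) (seq-0 n))
  seq-im-sumℂ² {suc m} t n = ≡.trans (cong₂ ℚ._+_ (seq-im-sumℂ (t zero) n) (seq-im-sumℂ² (t ∘ suc) n))
    (≡.sym (seq-im-+ (ℂ-Sum.sum (t zero)) (ℂ-Sum.sum λ i → ℂ-Sum.sum (t (suc i))) n))

re-sum : ∀ {m} (t : Fin m → ℂ) → re (ℂ-Sum.sum t) ≃ℝ ℝ-Sum.sum (re ∘ t)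
re-sum {zero}  t = ℝ-CR.reflexive re-0
re-sum {suc m} t = ℝ-CR.trans (ℝ-CR.reflexive (re-+ (t zero) (ℂ-Sum.sum (t ∘ suc))))
  (ℝ-CR.+-congˡ (re-sum (t ∘ suc)))

toℂ≃ : ∀ {z w} → z ℂ-Ring.≈ w → z ≃ℂ w
toℂ≃ (r , i) = mk≃ r & mk≃ i

flipSign : Bool → ℂ → ℂ
flipSign b z = if b then ℂ-Ring.- z else z

opaque
  unfolding _+ᴿ_ _+ᶜ_

  -- Both factors are z up to sign and conjugation, so the product is real and its real part loses
  -- nothing.
  re-signed : ∀ b c z → re (conj (flipSign b z) *ᶜ flipSign c z) ≃ℝ signed b (signed c ∣ z ∣²)
  re-signed false false z = ≗⇒≃ λ n → QS.solve 2 (λ a b →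
    a :* a :+ :- ((:- b) :* b) := a :* a :+ b :* b) refl (seq (re z) n) (seq (im z) n)
  re-signed false true z = ≗⇒≃ λ n → QS.solve 2 (λ a b →
    a :* (:- a) :+ :- ((:- b) :* (:- b)) := :- (a :* a :+ b :* b)) refl (seq (re z) n) (seq (im z) n)
  re-signed true false z = ≗⇒≃ λ n → QS.solve 2 (λ a b →
    (:- a) :* a :+ :- ((:- (:- b)) :* b) := :- (a :* a :+ b :* b)) refl (seq (re z) n) (seq (im z) n)
  re-signed true true z = ≗⇒≃ λ n → QS.solve 2 (λ a b →
    (:- a) :* (:- a) :+ :- ((:- (:- b)) :* (:- b)) := :- (:- (a :* a :+ b :* b))) refl
    (seq (re z) n) (seq (im z) n)

module ComplexStates (m w : ℕ) where

  module IP = InnerProduct ℂ-commutativeRing conj conj-isConjugation m w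
  open IP using (State; ⟪_,_⟫)

  weights : State → Fin m → ℝ
  weights ψ i = ℝ-Sum.sum λ j → ∣ ψ (i , j) ∣²

  re-⟪⟫ : ∀ φ ψ → re ⟪ φ , ψ ⟫ ≃ℝ
    ℝ-Sum.sum (λ i → ℝ-Sum.sum λ j → re (conj (φ (i , j)) *ᶜ ψ (i , j)))
  re-⟪⟫ φ ψ = ℝ-CR.trans (re-sum λ i → ℂ-Sum.sum (t i)) (ℝ-Sum.sum-cong-≋ λ i → re-sum (t i))
    where
    t : Fin m → Fin w → ℂ
    t i j = conj (φ (i , j)) *ᶜ ψ (i , j)

  flipped : (Fin m → Bool) → State → State
  flipped b ψ (i , j) = flipSign (b i) (ψ (i , j))

  ⟪flipped⟫ : ∀ b c ψ → re ⟪ flipped b ψ , flipped c ψ ⟫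
    ≃ℝ ℝ-Sum.sum λ i → signed (b i) (signed (c i) (weights ψ i))
  ⟪flipped⟫ b c ψ = ℝ-CR.trans (re-⟪⟫ (flipped b ψ) (flipped c ψ))
    (ℝ-CR.trans (ℝ-Sum.sum-cong-≋ λ i → ℝ-Sum.sum-cong-≋ λ j → re-signed (b i) (c i) (ψ (i , j)))
      (ℝ-Algebra.sum-signed² b c λ i j → ∣ ψ (i , j) ∣²))

-- All that the count keeps of an algorithm. The heads `false` are the sign s₀ = 1. Total weight 1
-- makes p nonzero and keeps every sign vector from being orthogonal to itself.
Separating : ∀ {n} → PartialFunction n → (Fin (suc n) → ℝ) → Set
Separating f p = ℝ-Sum.sum p ≃ℝ 1ᴿ ×
  (∀ x y → f x ≡ just false → f y ≡ just true → pairing p (false ∷ x) (false ∷ y) ≃ℝ 0ᴿ)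

module OneQuery (n w : ℕ) where

  open Hilbert n w
  open ComplexStates (suc n) w public

  ∑-≃ : ∀ g → ∑ g ≃ℂ IP.∑ g
  ∑-≃ g = ≗⇒≃ (seq-re-sumℂ² λ i j → g (i , j)) & ≗⇒≃ (seq-im-sumℂ² λ i j → g (i , j))

  ·-≃ : ∀ A ψ a → (A · ψ) a ≃ℂ (A IP.· ψ) a
  ·-≃ A ψ a = ℂ-CR.trans (∑-≃ λ b → A a b ℂ-Ring.* ψ b) (IP.∑-cong λ b → ℂ-*-≃ (A a b) (ψ b))

  ⊚-≃ : ∀ A B a c → (A ⊚ B) a c ≃ℂ (A IP.⊚ B) a c
  ⊚-≃ A B a c = ℂ-CR.trans (∑-≃ λ b → A a b ℂ-Ring.* B b c) (IP.∑-cong λ b → ℂ-*-≃ (A a b) (B b c))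

  identity-≃ : ∀ a b → identity a b ≃ℂ IP.identity a b
  identity-≃ a b with does (≡-dec Fin._≟_ Fin._≟_ a b)
  ... | true  = ℂ-1-≃
  ... | false = ℂ-0-≃

  norm-≃ : ∀ φ → ‖ φ ‖² ≃ℝ ℝ-Sum.sum (weights φ)
  norm-≃ φ = ≗⇒≃ (seq-sumℝ² λ i j → ∣ φ (i , j) ∣²)

  norm-⟪⟫ : ∀ φ → ‖ φ ‖² ≃ℝ re (IP.⟪_,_⟫ φ φ)
  norm-⟪⟫ φ = ℝ-CR.trans (norm-≃ φ) (ℝ-CR.sym (⟪flipped⟫ (λ _ → false) (λ _ → false) φ))

  norm≃0⇒ : ∀ φ → ‖ φ ‖² ≃ℝ 0ᴿ → ∀ a → φ a ≃ℂ 0ᶜ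
  norm≃0⇒ φ φ≃0 (i , j) = ℂ-CR.trans (toℂ≃
    ( square≈0⇒ (re z) (+≈0⇒ˡ {re z ℝ-Ring.* re z} {im z ℝ-Ring.* im z}
        (square-nonNeg (re z)) (square-nonNeg (im z)) z≈0)
    , square≈0⇒ (im z) (+≈0⇒ʳ {re z ℝ-Ring.* re z} {im z ℝ-Ring.* im z}
        (square-nonNeg (re z)) (square-nonNeg (im z)) z≈0)))
    ℂ-0-≃
    where
    z = φ (i , j)
    abs-nonNeg : ∀ a → TermwiseNonNeg ∣ φ a ∣²
    abs-nonNeg a = +-nonNeg {re (φ a) ℝ-Ring.* re (φ a)} {im (φ a) ℝ-Ring.* im (φ a)}
      (square-nonNeg (re (φ a))) (square-nonNeg (im (φ a)))
    φ≈0 : ‖ φ ‖² ≈ ℝ-Ring.0#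
    φ≈0 = ≃⇒≈ (ℝ-CR.trans φ≃0 (ℝ-CR.sym ℝ-0-≃))
    z≈0 : ∣ z ∣² ≈ ℝ-Ring.0#
    z≈0 = sum≈0⇒ (λ j → ∣ φ (i , j) ∣²) (λ j → abs-nonNeg (i , j))
      (sum≈0⇒ (λ i → sumℝ λ j → ∣ φ (i , j) ∣²)
        (λ i → sum-nonNeg (λ j → ∣ φ (i , j) ∣²) λ j → abs-nonNeg (i , j)) φ≈0 i) j

  oracle-pairing : ∀ x y ψ → re (IP.⟪_,_⟫ (oracle x ψ) (oracle y ψ))
    ≃ℝ pairing (weights ψ) (false ∷ x) (false ∷ y)
  oracle-pairing x y ψ = ℝ-CR.trans
    (re≃ (IP.⟪⟫-cong (oracle-flipped x) (oracle-flipped y)))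
    (⟪flipped⟫ (lookup (false ∷ x)) (lookup (false ∷ y)) ψ)
    where
    oracle-flipped : ∀ x a → oracle x ψ a ≃ℂ flipped (lookup (false ∷ x)) ψ a
    oracle-flipped x (zero  , j) = ℂ-CR.refl
    oracle-flipped x (suc i , j) = ℂ-CR.refl

  -- ψ, o, φ and ρ stand for the states before the query, after the query, at the
  -- end and after the measurement; as variables they are not unfolded.
  module _ {f : PartialFunction n}
    (initial ψ : State) (U₀ U₁ : Operator) (P : Bool → Operator) (o φ : Vec Bool n → State)
    (ρ : Vec Bool n → Bool → State)
    (ψ≡ : ψ ≡ U₀ · initial) (o≡ : ∀ x a → o x a ≡ oracle x ψ a) (φ≡ : ∀ x → φ x ≡ U₁ · o x)
    (ρ≡ : ∀ x b a → ρ x b a ≡ (P b · φ x) a)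
    (normalised : ‖ initial ‖² ≈ ℝ-Ring.1#) (U₀-unitary : IsUnitary U₀) (U₁-unitary : IsUnitary U₁)
    (projections : ∀ b → IsOrthogonalProjection (P b)) (complete : P false ⊞ P true ≋ identity)
    (exact : ∀ x b → f x ≡ just b → ‖ ρ x b ‖² ≈ ℝ-Ring.1#)
    where

    open RingProperties (CommutativeRing.ring ℝ-commutativeRing) using (+-cancelˡ)

    private
      isometry : ∀ U → IsUnitary U → ∀ χ ω → IP.⟪_,_⟫ (U · χ) (U · ω) ≃ℂ IP.⟪_,_⟫ χ ω
      isometry U (U†U , _) χ ω = ℂ-CR.trans (IP.⟪⟫-cong (·-≃ U χ) (·-≃ U ω))
        (IP.isometry U (λ a b → ℂ-CR.trans (ℂ-CR.sym (⊚-≃ (U †) U a b))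
          (ℂ-CR.trans (toℂ≃ (U†U a b)) (identity-≃ a b))) χ ω)

      sum-weights : ℝ-Sum.sum (weights ψ) ≃ℝ 1ᴿ
      sum-weights = ℝ-CR.trans (ℝ-CR.sym (norm-≃ ψ)) (ℝ-CR.trans (norm-⟪⟫ ψ)
        (ℝ-CR.trans (ℝ-CR.reflexive (cong (λ χ → re (IP.⟪_,_⟫ χ χ)) ψ≡))
        (ℝ-CR.trans (re≃ (isometry U₀ U₀-unitary initial initial))
        (ℝ-CR.trans (ℝ-CR.sym (norm-⟪⟫ initial)) (ℝ-CR.trans (mk≃ normalised) ℝ-1-≃)))))

      final-pairing : ∀ x y → re (IP.⟪_,_⟫ (φ x) (φ y))
        ≃ℝ pairing (weights ψ) (false ∷ x) (false ∷ y)
      final-pairing x y = ℝ-CR.trans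
        (ℝ-CR.reflexive (cong₂ (λ χ ω → re (IP.⟪_,_⟫ χ ω)) (φ≡ x) (φ≡ y)))
        (ℝ-CR.trans (re≃ (isometry U₁ U₁-unitary (o x) (o y))) (ℝ-CR.trans
          (re≃ (IP.⟪⟫-cong (λ a → ℂ-CR.reflexive (o≡ x a)) (λ a → ℂ-CR.reflexive (o≡ y a))))
          (oracle-pairing x y ψ)))

      pythagoras : ∀ x y → IP.⟪_,_⟫ (φ x) (φ y) ≃ℂ
        IP.⟪_,_⟫ (ρ x false) (ρ y false) +ᶜ IP.⟪_,_⟫ (ρ x true) (ρ y true)
      pythagoras x y = ℂ-CR.trans
        (IP.pythagoras (P false) (P true) (self-adjoint false) (idempotent false)
          (self-adjoint true) (idempotent true) sum-identity (φ x) (φ y))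
        (ℂ-CR.sym (ℂ-CR.+-cong (IP.⟪⟫-cong (ρ≃ x false) (ρ≃ y false))
          (IP.⟪⟫-cong (ρ≃ x true) (ρ≃ y true))))
        where
        ρ≃ : ∀ x b a → ρ x b a ≃ℂ (P b IP.· φ x) a
        ρ≃ x b a = ℂ-CR.trans (ℂ-CR.reflexive (ρ≡ x b a)) (·-≃ (P b) (φ x) a)
        self-adjoint : ∀ b a c → (P b IP.†) a c ≃ℂ P b a c
        self-adjoint b a c = toℂ≃ (proj₁ (projections b) a c)
        idempotent : ∀ b a c → (P b IP.⊚ P b) a c ≃ℂ P b a c
        idempotent b a c =
          ℂ-CR.trans (ℂ-CR.sym (⊚-≃ (P b) (P b) a c)) (toℂ≃ (proj₂ (projections b) a c))
        sum-identity : ∀ a c → (P false IP.⊞ P true) a c ≃ℂ IP.identity a c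
        sum-identity a c = ℂ-CR.trans (ℂ-CR.sym (ℂ-+-≃ (P false a c) (P true a c)))
          (ℂ-CR.trans (toℂ≃ (complete a c)) (identity-≃ a c))

      total-probability : ∀ x → ‖ ρ x false ‖² +ᴿ ‖ ρ x true ‖² ≃ℝ 1ᴿ
      total-probability x = ℝ-CR.trans
        (ℝ-CR.+-cong (norm-⟪⟫ (ρ x false)) (norm-⟪⟫ (ρ x true)))
        (ℝ-CR.trans (ℝ-CR.sym (ℝ-CR.trans (re≃ (pythagoras x x))
          (ℝ-CR.reflexive
            (re-+ (IP.⟪_,_⟫ (ρ x false) (ρ x false)) (IP.⟪_,_⟫ (ρ x true) (ρ x true))))))
        (ℝ-CR.trans (final-pairing x x) (ℝ-CR.trans
          (ℝ-Algebra.pairing-self (weights ψ) (false ∷ x)) sum-weights)))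

      certain : ∀ x b → f x ≡ just b → ‖ ρ x b ‖² ≃ℝ 1ᴿ
      certain x b fx = ℝ-CR.trans (mk≃ (exact x b fx)) ℝ-1-≃

      cancel : ∀ {p q} → p ≃ℝ 1ᴿ → p +ᴿ q ≃ℝ 1ᴿ → q ≃ℝ 0ᴿ
      cancel p≃1 p+q≃1 = +-cancelˡ 1ᴿ _ _ (ℝ-CR.trans (ℝ-CR.+-congʳ (ℝ-CR.sym p≃1))
        (ℝ-CR.trans p+q≃1 (ℝ-CR.sym (ℝ-CR.+-identityʳ 1ᴿ))))

      -- The outcome `false` already takes the whole probability, so the other component has norm 0.
      never-true : ∀ x → f x ≡ just false → ∀ a → ρ x true a ≃ℂ 0ᶜ
      never-true x fx = norm≃0⇒ (ρ x true) (cancel (certain x false fx) (total-probability x))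

      never-false : ∀ x → f x ≡ just true → ∀ a → ρ x false a ≃ℂ 0ᶜ
      never-false x fx = norm≃0⇒ (ρ x false) (cancel (certain x true fx)
        (ℝ-CR.trans (ℝ-CR.+-comm _ _) (total-probability x)))

    exact⇒separating : Separating f (weights ψ)
    exact⇒separating = sum-weights , λ x y fx fy → ℝ-CR.trans (ℝ-CR.sym (final-pairing x y))
      (ℝ-CR.trans (re≃ (ℂ-CR.trans (pythagoras x y) (ℂ-CR.trans
        -- Each summand has a vanishing factor: y never yields `false` and x never yields `true`.
        (ℂ-CR.+-cong (IP.⟪⟫-0ʳ (ρ x false) (ρ y false) (never-false y fy))
          (IP.⟪⟫-0ˡ (ρ x true) (ρ y true) (never-true x fx)))
        (ℂ-CR.+-identityʳ 0ᶜ)))) (ℝ-CR.reflexive re-0))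

separatingWeights : ∀ {n} {f : PartialFunction n} → ExactQuantumQueryComplexityOne f →
  ∃ (Separating f)
separatingWeights (_ , A , (normalised , U₀-unitary , U₁-unitary , projections , complete) , exact) =
  OneQuery.weights _ w (U₀ · initial) ,
  OneQuery.exact⇒separating _ w initial (U₀ · initial) U₀ U₁ P (λ x → oracle x (U₀ · initial)) final
    (λ x b → P b · final x) refl (λ _ _ → refl) (λ _ → refl) (λ _ _ _ → refl)
    normalised U₀-unitary U₁-unitary projections complete exact
  where open AlgorithmData A

-- Double-negation shift over finite types

Shift : Set → Set₁
Shift A = ∀ {P : A → Set} → (∀ a → ¬ ¬ P a) → ¬ ¬ (∀ a → P a)

shift-Bool : Shift Bool
shift-Bool ¬¬P none = ¬¬P false λ Pf → ¬¬P true λ Pt → none λ { false → Pf ; true → Pt }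

shift-Fin : ∀ {n} → Shift (Fin n)
shift-Fin {zero}  ¬¬P none = none λ ()
shift-Fin {suc n} ¬¬P none = ¬¬P zero λ P₀ → shift-Fin (¬¬P ∘ suc) λ Pₛ →
  none λ { zero → P₀ ; (suc i) → Pₛ i }

shift-Vec : ∀ {A n} → Shift A → Shift (Vec A n)
shift-Vec {n = zero}  shift ¬¬P none = ¬¬P [] λ P[] → none λ { [] → P[] }
shift-Vec {n = suc n} shift ¬¬P none =
  shift (λ a → shift-Vec shift (λ x → ¬¬P (a ∷ x))) λ P → none λ { (a ∷ x) → P a x }

-- Multilinear interpolation

evalBits : ∀ {n} → Multilinear n → Vec Bool n → ℝ
evalBits p x = eval p (bit ∘ lookup x)

open CommutativeRing ℝ-commutativeRing
  using (+-congˡ; +-cong; *-congʳ; +-identityʳ; *-identityˡ; zeroˡ; distribˡ; distribʳ;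
    +-assoc; +-comm; -‿cong; -‿inverseʳ; setoid; +-commutativeSemigroup; *-commutativeSemigroup)
open RingProperties (CommutativeRing.ring ℝ-commutativeRing) using (-0#≈0#; -‿distribˡ-*; -‿+-comm)
open CommutativeSemigroupProperties +-commutativeSemigroup using (interchange)
open CommutativeSemigroupProperties *-commutativeSemigroup using (x∙yz≈y∙xz)

private
  sumᴿ : ∀ {n} → (Subset n → ℝ) → ℝ
  sumᴿ {zero}  g = g []
  sumᴿ {suc n} g = sumᴿ (g ∘ (outside ∷_)) +ᴿ sumᴿ (g ∘ (inside ∷_))

  monomialᴿ : ∀ {n} → Subset n → Vec Bool n → ℝ
  monomialᴿ []            []      = 1ᴿ
  monomialᴿ (outside ∷ S) (b ∷ x) = monomialᴿ S x
  monomialᴿ (inside ∷ S)  (b ∷ x) = bit b *ᴿ monomialᴿ S x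

  evalᴿ : ∀ {n} → Multilinear n → Vec Bool n → ℝ
  evalᴿ p x = sumᴿ λ S → p S *ᴿ monomialᴿ S x

  seq-monomial : ∀ {n} (S : Subset n) x (v : Fin n → ℝ) →
    (∀ j i → seq (v j) i ≡ seq (bit (lookup x j)) i) →
    ∀ i → seq (monomial S v) i ≡ seq (monomialᴿ S x) i
  seq-monomial []            []      v v≗ i = ≡.sym (seq-1 i)
  seq-monomial (outside ∷ S) (b ∷ x) v v≗ i = ≡.trans
    (ℚ.*-identityˡ (seq (monomial S (v ∘ suc)) i)) (seq-monomial S x (v ∘ suc) (v≗ ∘ suc) i)
  seq-monomial (inside ∷ S)  (b ∷ x) v v≗ i = ≡.trans
    (cong₂ ℚ._*_ (v≗ zero i) (seq-monomial S x (v ∘ suc) (v≗ ∘ suc) i))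
    (≡.sym (seq-* (bit b) (monomialᴿ S x) i))

  seq-sumSubsets : ∀ {n} {g h : Subset n → ℝ} → (∀ S i → seq (g S) i ≡ seq (h S) i) →
    ∀ i → seq (sumSubsets g) i ≡ seq (sumᴿ h) i
  seq-sumSubsets {zero}  g≗h i = g≗h [] i
  seq-sumSubsets {suc n} {g} {h} g≗h i = ≡.trans
    (cong₂ ℚ._+_ (seq-sumSubsets {h = h ∘ (outside ∷_)} (g≗h ∘ (outside ∷_)) i)
                 (seq-sumSubsets {h = h ∘ (inside ∷_)} (g≗h ∘ (inside ∷_)) i))
    (≡.sym (seq-+ (sumᴿ (h ∘ (outside ∷_))) (sumᴿ (h ∘ (inside ∷_))) i))

  eval-≃ : ∀ {n} (p : Multilinear n) x → evalBits p x ≃ℝ evalᴿ p x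
  eval-≃ p x = ≗⇒≃ (seq-sumSubsets {h = λ S → p S *ᴿ monomialᴿ S x} λ S i → ≡.trans
    (cong (seq (p S) i ℚ.*_) (seq-monomial S x (bit ∘ lookup x) (λ _ _ → refl) i))
    (≡.sym (seq-* (p S) (monomialᴿ S x) i)))

  sumᴿ-cong : ∀ {n} {g h : Subset n → ℝ} → (∀ S → g S ≃ℝ h S) → sumᴿ g ≃ℝ sumᴿ h
  sumᴿ-cong {zero}  g≃h = g≃h []
  sumᴿ-cong {suc n} g≃h = +-cong (sumᴿ-cong (g≃h ∘ (outside ∷_))) (sumᴿ-cong (g≃h ∘ (inside ∷_)))

  sumᴿ-* : ∀ {n} c (g : Subset n → ℝ) → sumᴿ (λ S → c *ᴿ g S) ≃ℝ c *ᴿ sumᴿ g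
  sumᴿ-* {zero}  c g = ℝ-CR.refl
  sumᴿ-* {suc n} c g = ℝ-CR.trans (+-cong (sumᴿ-* c (g ∘ (outside ∷_))) (sumᴿ-* c (g ∘ (inside ∷_))))
    (ℝ-CR.sym (distribˡ c _ _))

  sumᴿ-minus : ∀ {n} (g h : Subset n → ℝ) → sumᴿ (λ S → g S +ᴿ -ᴿ h S) ≃ℝ sumᴿ g +ᴿ -ᴿ sumᴿ h
  sumᴿ-minus {zero}  g h = ℝ-CR.refl
  sumᴿ-minus {suc n} g h = ℝ-CR.trans
    (+-cong (sumᴿ-minus (g ∘ (outside ∷_)) (h ∘ (outside ∷_)))
            (sumᴿ-minus (g ∘ (inside ∷_)) (h ∘ (inside ∷_))))
    (ℝ-CR.trans (interchange _ _ _ _) (+-congˡ (-‿+-comm _ _)))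

  evalᴿ-minus : ∀ {n} (p q : Multilinear n) x →
    evalᴿ (λ S → p S +ᴿ -ᴿ q S) x ≃ℝ evalᴿ p x +ᴿ -ᴿ evalᴿ q x
  evalᴿ-minus p q x = ℝ-CR.trans
    (sumᴿ-cong λ S → ℝ-CR.trans (distribʳ (monomialᴿ S x) (p S) (-ᴿ q S))
      (+-congˡ (ℝ-CR.sym (-‿distribˡ-* (q S) (monomialᴿ S x)))))
    (sumᴿ-minus (λ S → p S *ᴿ monomialᴿ S x) (λ S → q S *ᴿ monomialᴿ S x))

  evalᴿ-∷ : ∀ {n} (p : Multilinear (suc n)) b x → evalᴿ p (b ∷ x)
    ≃ℝ evalᴿ (p ∘ (outside ∷_)) x +ᴿ bit b *ᴿ evalᴿ (p ∘ (inside ∷_)) x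
  evalᴿ-∷ p b x = +-congˡ (ℝ-CR.trans
    (sumᴿ-cong λ S → x∙yz≈y∙xz (p (inside ∷ S)) (bit b) (monomialᴿ S x))
    (sumᴿ-* (bit b) λ S → p (inside ∷ S) *ᴿ monomialᴿ S x))

-- Newton's formula in the head variable, F(b, x) = F(0, x) + b (F(1, x) - F(0, x)), applied
-- recursively.
interpolant : ∀ {n} → (Vec Bool n → ℝ) → Multilinear n
interpolant {zero}  F []            = F []
interpolant {suc n} F (outside ∷ S) = interpolant (F ∘ (false ∷_)) S
interpolant {suc n} F (inside ∷ S)  =
  interpolant (F ∘ (true ∷_)) S +ᴿ -ᴿ interpolant (F ∘ (false ∷_)) S

eval-interpolant : ∀ {n} (F : Vec Bool n → ℝ) x → evalBits (interpolant F) x ≃ℝ F x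
eval-interpolant F x = ℝ-CR.trans (eval-≃ (interpolant F) x) (go F x)
  where
  go : ∀ {n} (F : Vec Bool n → ℝ) x → evalᴿ (interpolant F) x ≃ℝ F x
  go F [] = ℝ-CR.*-identityʳ (F [])
  go F (false ∷ x) = ℝ-CR.trans (evalᴿ-∷ (interpolant F) false x)
    (ℝ-CR.trans (+-cong (go (F ∘ (false ∷_)) x) (ℝ-CR.trans (*-congʳ ℝ-0-≃) (zeroˡ _))) (+-identityʳ _))
  go F (true ∷ x) = begin
    evalᴿ (interpolant F) (true ∷ x)                          ≈⟨ evalᴿ-∷ (interpolant F) true x ⟩
    a₀ +ᴿ bit true *ᴿ evalᴿ (interpolant F ∘ (inside ∷_)) x   ≈⟨ +-congˡ (ℝ-CR.trans (*-congʳ ℝ-1-≃) (*-identityˡ _)) ⟩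
    a₀ +ᴿ evalᴿ (interpolant F ∘ (inside ∷_)) x               ≈⟨ +-congˡ (evalᴿ-minus (interpolant (F ∘ (true ∷_)))
                                                                   (interpolant (F ∘ (false ∷_))) x) ⟩
    a₀ +ᴿ (a₁ +ᴿ -ᴿ a₀)                                       ≈⟨ ℝ-CR.trans (+-comm _ _) (+-assoc _ _ _) ⟩
    a₁ +ᴿ (-ᴿ a₀ +ᴿ a₀)                                       ≈⟨ +-congˡ (ℝ-CR.-‿inverseˡ a₀) ⟩
    a₁ +ᴿ 0ᴿ                                                  ≈⟨ +-identityʳ a₁ ⟩
    a₁                                                        ≈⟨ go (F ∘ (true ∷_)) x ⟩
    F (true ∷ x)                                              ∎
    where
    open SetoidReasoning setoid
    a₀ = evalᴿ (interpolant (F ∘ (false ∷_))) x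
    a₁ = evalᴿ (interpolant (F ∘ (true ∷_))) x

interpolant-cong : ∀ {n} {F G : Vec Bool n → ℝ} → (∀ x → F x ≡ G x) →
  ∀ S → interpolant F S ≡ interpolant G S
interpolant-cong F≗G []            = F≗G []
interpolant-cong F≗G (outside ∷ S) = interpolant-cong (F≗G ∘ (false ∷_)) S
interpolant-cong F≗G (inside ∷ S)  = cong₂ (λ a b → a +ᴿ -ᴿ b)
  (interpolant-cong (F≗G ∘ (true ∷_)) S) (interpolant-cong (F≗G ∘ (false ∷_)) S)

-- A coefficient at a set containing i is built from differences of F along i, which invariance
-- makes zero.
interpolant-support : ∀ {n} (F : Vec Bool n → ℝ) i → (∀ x → F (updateAt x i not) ≡ F x) →
  ∀ S → i ∈ S → interpolant F S ≃ℝ 0ᴿ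
interpolant-support F zero invariant (inside ∷ S) here = ℝ-CR.trans
  (+-congˡ (-‿cong (ℝ-CR.reflexive (interpolant-cong (λ x → invariant (true ∷ x)) S))))
  (-‿inverseʳ (interpolant (F ∘ (true ∷_)) S))
interpolant-support F (suc i) invariant (outside ∷ S) (there i∈S) =
  interpolant-support (F ∘ (false ∷_)) i (invariant ∘ (false ∷_)) S i∈S
interpolant-support F (suc i) invariant (inside ∷ S) (there i∈S) = ℝ-CR.trans
  (+-cong (interpolant-support (F ∘ (true ∷_)) i (invariant ∘ (true ∷_)) S i∈S)
    (ℝ-CR.trans (-‿cong (interpolant-support (F ∘ (false ∷_)) i (invariant ∘ (false ∷_)) S i∈S)) -0#≈0#))
  (+-identityʳ 0ᴿ)

Represents≃ : ∀ {n} → Multilinear n → PartialFunction n → Set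
Represents≃ p f = ∀ x b → f x ≡ just b → evalBits p x ≃ℝ bit b

≃⇒represents : ∀ {n} {f : PartialFunction n} (p : Multilinear n) → Represents≃ p f → Represents p f
≃⇒represents p represents x b fx = ≃⇒≈ (represents x b fx)

-- The interpolant of F represents f and its variables avoid Z. Minimality of k wants the exact set
-- of occurring variables, and whether a real coefficient is nonzero is decided only classically;
-- hence the double negation.
invariantExtension⇒k≤ : ∀ {n k} {f : PartialFunction n} → DependsOnBits f k →
  (F : Vec Bool n → ℝ) → (∀ x b → f x ≡ just b → F x ≡ bit b) →
  (Z : Subset n) → (∀ i → lookup Z i ≡ true → ∀ x → F (updateAt x i not) ≡ F x) →
  ¬ ¬ (k ℕ.≤ ∣ ∁ Z ∣)
invariantExtension⇒k≤ {n} {k} {f} (_ , minimal) F extends Z invariant =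
  ¬¬-map bound (shift-Fin {P = λ i → Dec (Occurs i (interpolant F))} λ i → ¬¬-excluded-middle)
  where
  represents : Represents (interpolant F) f
  represents = ≃⇒represents (interpolant F) λ x b fx →
    ℝ-CR.trans (eval-interpolant F x) (ℝ-CR.reflexive (extends x b fx))

  unused : ∀ i → lookup Z i ≡ true → ¬ Occurs i (interpolant F)
  unused i Zi (S , i∈S , qS≉0) = qS≉0 (≃⇒≈ {interpolant F S} {ℝ-Ring.0#}
    (ℝ-CR.trans (interpolant-support F i (invariant i Zi) S i∈S) (ℝ-CR.sym ℝ-0-≃)))

  bound : (∀ i → Dec (Occurs i (interpolant F))) → k ℕ.≤ ∣ ∁ Z ∣
  bound occurs? = ℕ.≤-trans
    (minimal ∣ V ∣ (interpolant F , represents , V , (λ i → mk⇔ (∈V⇒ i) (⇒∈V i)) , refl))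
    (p⊆q⇒∣p∣≤∣q∣ {p = V} {q = ∁ Z} λ {i} i∈V → x∉p⇒x∈∁p {p = Z} λ i∈Z →
      unused i ([]=⇒lookup i∈Z) (∈V⇒ i i∈V))
    where
    V : Subset n
    V = tabulate (does ∘ occurs?)
    ∈V⇒ : ∀ i → i ∈ V → Occurs i (interpolant F)
    ∈V⇒ i i∈V = does⇒ (occurs? i)
      (≡.trans (≡.sym (lookup∘tabulate (does ∘ occurs?) i)) ([]=⇒lookup i∈V))
    ⇒∈V : ∀ i → Occurs i (interpolant F) → i ∈ V
    ⇒∈V i occ = lookup⇒[]= i V
      (≡.trans (lookup∘tabulate (does ∘ occurs?) i) (dec-true (occurs? i) occ))

-- A partial function separated by p extends to a total function of the
-- coordinates with nonzero weight.
module _ {n} {f : PartialFunction n} {p} (separating : Separating f p)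
  z (Z : Subset n) (zeros : ∀ i → lookup (z ∷ Z) i ≡ true → p i ≃ℝ 0ᴿ) where

  private
    sum≃1 = proj₁ separating
    orthogonal = proj₂ separating

  Agree : Vec Bool n → Vec Bool n → Set
  Agree x y = ∀ i → lookup Z i ≡ false → lookup x i ≡ lookup y i

  -- The support of the total extension: the 1-inputs, saturated under changes inside Z.
  Extends : Vec Bool n → Set
  Extends x = ∃ λ y → f y ≡ just true × Agree x y

  -- Outside Z the two signs agree and cancel; inside Z the weight is zero.
  agree⇒pairing : ∀ x y → Agree x y → pairing p (false ∷ x) (false ∷ y) ≃ℝ ℝ-Sum.sum p
  agree⇒pairing x y agree = +-congˡ (ℝ-Sum.sum-cong-≋ λ i → term i (lookup Z i) refl)
    where
    term : ∀ i b → lookup Z i ≡ b → signed (lookup x i) (signed (lookup y i) (p (suc i))) ≃ℝ p (suc i)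
    term i false Zi = subst (λ b → signed (lookup x i) (signed b (p (suc i))) ≃ℝ p (suc i))
      (agree i Zi) (ℝ-Algebra.signed-self (lookup x i) (p (suc i)))
    term i true Zi = ℝ-CR.trans
      (ℝ-Algebra.signed-0 (lookup x i) (ℝ-Algebra.signed-0 (lookup y i) (zeros (suc i) Zi)))
      (ℝ-CR.sym (zeros (suc i) Zi))

  -- The pairing of x with such a y would be 1 by agreement and 0 by separation.
  false⇒¬extends : ∀ x → f x ≡ just false → ¬ Extends x
  false⇒¬extends x fx (y , fy , agree) = 1≄0 (ℝ-CR.trans (ℝ-CR.sym sum≃1)
    (ℝ-CR.trans (ℝ-CR.sym (agree⇒pairing x y agree)) (orthogonal x y fx fy)))

  flip-extends : ∀ i → lookup Z i ≡ true → ∀ x → Extends x → Extends (updateAt x i not)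
  flip-extends i Zi x (y , fy , agree) = y , fy , λ j Zj → ≡.trans
    (lookup∘updateAt′ j i (λ { refl → contradiction (≡.trans (≡.sym Zi) Zj) λ () }) x) (agree j Zj)

  unflip-extends : ∀ i → lookup Z i ≡ true → ∀ x → Extends (updateAt x i not) → Extends x
  unflip-extends i Zi x (y , fy , agree) = y , fy , λ j Zj → ≡.trans
    (≡.sym (lookup∘updateAt′ j i (λ { refl → contradiction (≡.trans (≡.sym Zi) Zj) λ () }) x)) (agree j Zj)

  module _ (E? : ∀ x → Dec (Extends x)) where

    F : Vec Bool n → ℝ
    F x = bit (does (E? x))

    F-represents : ∀ x b → f x ≡ just b → F x ≡ bit b
    F-represents x true  fx = cong bit (dec-true (E? x) (x , fx , λ _ _ → refl))
    F-represents x false fx = cong bit (dec-false (E? x) (false⇒¬extends x fx))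

    F-invariant : ∀ i → lookup Z i ≡ true → ∀ x → F (updateAt x i not) ≡ F x
    F-invariant i Zi x with E? x | E? (updateAt x i not)
    ... | yes e | yes _ = refl
    ... | no _  | no _  = refl
    ... | yes e | no ¬e = contradiction (flip-extends i Zi x e) ¬e
    ... | no ¬e | yes e = contradiction (unflip-extends i Zi x e) ¬e

  dependsOnBits≤ : ∀ {k} → DependsOnBits f k → k ℕ.≤ ∣ ∁ Z ∣
  dependsOnBits≤ {k} depends = decidable-stable (k ℕ.≤? ∣ ∁ Z ∣) λ k≰ →
    shift-Vec shift-Bool {P = λ x → Dec (Extends x)} (λ x → ¬¬-excluded-middle) λ E? →
    invariantExtension⇒k≤ depends (F E?) (F-represents E?) Z (F-invariant E?) k≰

-- Codes of partial functions

-- Repetitions and extra points are allowed, so a cover can be padded to a size M common to all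
-- functions.
FinCover : ∀ {n} → ℕ → (Vec Bool n → Set) → Set
FinCover {n} M P = Σ (Fin M → Vec Bool n) λ e → ∀ x → P x → ∃ λ j → e j ≡ x

cover-widen : ∀ {n M M′} {P : Vec Bool n → Set} → Vec Bool n → M ℕ.≤ M′ →
  FinCover M P → FinCover M′ P
cover-widen {n} {M} {M′} x₀ M≤M′ (e , onto) = e′ , λ x Px → let (j , ej≡x) = onto x Px in
  inject≤ j M≤M′ , ≡.trans (e′-inject j) ej≡x
  where
  e′ : Fin M′ → Vec Bool n
  e′ j with toℕ j ℕ.<? M
  ... | yes j<M = e (fromℕ< j<M)
  ... | no _    = x₀
  e′-inject : ∀ j → e′ (inject≤ j M≤M′) ≡ e j
  e′-inject j with toℕ (inject≤ j M≤M′) ℕ.<? M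
  ... | yes j<M = cong e (Fin.toℕ-injective (≡.trans (Fin.toℕ-fromℕ< j<M) (Fin.toℕ-inject≤ j M≤M′)))
  ... | no j≮M  = contradiction (subst (ℕ._< M) (≡.sym (Fin.toℕ-inject≤ j M≤M′)) (Fin.toℕ<n j)) j≮M

cover-⊎ : ∀ {n M₁ M₂} {P Q : Vec Bool n → Set} → FinCover M₁ P → FinCover M₂ Q →
  FinCover (M₁ ℕ.+ M₂) (λ x → P x ⊎ Q x)
cover-⊎ {M₁ = M₁} {M₂} {P} {Q} (e₁ , onto₁) (e₂ , onto₂) = [ e₁ , e₂ ] ∘ splitAt M₁ , onto
  where
  onto : ∀ x → P x ⊎ Q x → ∃ λ j → [ e₁ , e₂ ] (splitAt M₁ j) ≡ x
  onto x (inj₁ Px) with onto₁ x Px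
  ... | j , eq = j ↑ˡ M₂ , ≡.trans (cong [ e₁ , e₂ ] (Fin.splitAt-↑ˡ M₁ j M₂)) eq
  onto x (inj₂ Qx) with onto₂ x Qx
  ... | j , eq = M₁ ↑ʳ j , ≡.trans (cong [ e₁ , e₂ ] (Fin.splitAt-↑ʳ M₁ M₂ j)) eq

cover-dec : ∀ {n} {P : Vec Bool n → Set} (P? : ∀ x → Dec (P x)) → FinCover (count (does ∘ P?)) P
cover-dec P? with enumerate (does ∘ P?)
... | e , onto = e , λ x Px → onto x (dec-true (P? x) Px)

cover-⊆ : ∀ {n M} {P Q : Vec Bool n → Set} → (∀ x → P x → Q x) → FinCover M Q → FinCover M P
cover-⊆ P⊆Q (e , onto) = e , λ x Px → onto x (P⊆Q x Px)

-- The 0-th coordinate, with constant value false, is the one the oracle leaves alone.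
Generated : ∀ {n} → (Fin n → Vec Bool n) → Vec Bool n → Set
Generated α x = Closure (λ j → false ∷ α j) (false ∷ x)

-- The last two fields do not mention f. They concern the spans of α and β only, so functions with
-- the same generators can be compared through them.
record Code {n} (f : PartialFunction n) (M : ℕ) (α β : Fin n → Vec Bool n) : Set where
  field
    false-generated : ∀ x → f x ≡ just false → Generated α x
    true-generated  : ∀ x → f x ≡ just true → Generated β x
    disjoint        : ∀ x → Generated α x → ¬ Generated β x
    covered         : FinCover M (λ x → Generated α x ⊎ Generated β x)

Generated-cong : ∀ {n} {α α′ : Fin n → Vec Bool n} → (∀ j → α j ≡ α′ j) →
  ∀ x → Generated α x → Generated α′ x
Generated-cong α≗α′ x gen q vanish = gen q λ j →
  subst (λ v → signedSum (false ∷ v) q ≃ℝ 0ᴿ) (≡.sym (α≗α′ j)) (vanish j)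

Code-cong : ∀ {n M} {f : PartialFunction n} {α α′ β β′} →
  (∀ j → α j ≡ α′ j) → (∀ j → β j ≡ β′ j) →
  Code f M α β → Code f M α′ β′
Code-cong α≗ β≗ code = record
  { false-generated = λ x fx → Generated-cong α≗ x (false-generated x fx)
  ; true-generated  = λ x fx → Generated-cong β≗ x (true-generated x fx)
  ; disjoint = λ x a b →
      disjoint x (Generated-cong (≡.sym ∘ α≗) x a) (Generated-cong (≡.sym ∘ β≗) x b)
  ; covered = cover-⊆ (λ x → [ inj₁ ∘ Generated-cong (≡.sym ∘ α≗) x
                             , inj₂ ∘ Generated-cong (≡.sym ∘ β≗) x ]) covered
  }
  where open Code code

-- Existence of codes

nonconstant : ∀ {n} {f : PartialFunction n} → ¬ Constant f → ∀ b → ¬ ¬ (∃ λ x → f x ≡ just b)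
-- If the value b were missed, f would be constantly `not b` on its domain.
nonconstant ¬constant b none = ¬constant (not b , λ x c fx →
  Bool.¬-not λ c≡b → none (x , ≡.trans fx (cong just c≡b)))

Side : ∀ {n} → PartialFunction n → Bool → Vec Bool (suc n) → Set
Side f b v = ∃ λ x → v ≡ false ∷ x × f x ≡ just b

-- With n = m + 1, the second exponent bounds the number of zero weights: at most n - k among the n
-- bits, and one more for the index 0 that the oracle leaves alone.
sizeBound : ℕ → ℕ → ℕ
sizeBound m k = 2 ℕ.^ m ℕ.+ 2 ℕ.^ suc (suc m ℕ.∸ k)

module _ {m} {f : PartialFunction (suc m)} {p} (separating : Separating f p) where

  private
    n = suc m
    A B : Vec Bool (suc n) → Set
    A = Side f false
    B = Side f true

    orthogonal : ∀ x y → A x → B y → pairing p x y ≃ℝ 0ᴿ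
    orthogonal _ _ (x , refl , fx) (y , refl , fy) = proj₂ separating x y fx fy

    p≄0 : ¬ (∀ i → p i ≃ℝ 0ᴿ)
    p≄0 p≃0 = 1≄0 (ℝ-CR.trans (ℝ-CR.sym (proj₁ separating))
      (ℝ-CR.trans (ℝ-Sum.sum-cong-≋ p≃0) (ℝ-Sum.sum-replicate-zero (suc n))))

    -- Absorbing the signs of y into the weights turns the pairing with y into a plain `signedSum`,
    -- that is, into a linear condition with coefficient vector `twist y`.
    twist : Vec Bool (suc n) → Fin (suc n) → ℝ
    twist y i = signed (lookup y i) (p i)

    twist≄0 : ∀ y → ¬ (∀ i → twist y i ≃ℝ 0ᴿ)
    twist≄0 y twist≃0 = p≄0 λ i → ℝ-CR.trans
      (ℝ-CR.sym (ℝ-Algebra.signed-self (lookup y i) (p i)))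
      (ℝ-Algebra.signed-0 (lookup y i) (twist≃0 i))

    -- For a y orthogonal to the whole side, `twist y` is a nonzero normal of it. This lowers the
    -- number of generators from n + 1 to n.
    generators : ∀ b → ∃ (Side f b) → ∀ y → (∀ x → Side f b x → pairing p x y ≃ℝ 0ᴿ) →
      ¬ ¬ (Σ (Fin n → Vec Bool n) λ α → (∀ j → f (α j) ≡ just b) ×
        (∀ x → f x ≡ just b → Generated α x))
    generators b x₀ y ⊥y = ¬¬-map
      (λ (g , spans) → (λ j → proj₁ (proj₂ (g j))) , (λ j → proj₂ (proj₂ (proj₂ (g j))))
        , λ x fx q vanish → spans (false ∷ x) (x , refl , fx) q λ j →
            subst (λ v → signedSum v q ≃ℝ 0ᴿ) (≡.sym (proj₁ (proj₂ (proj₂ (g j))))) (vanish j))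
      (ℝ-Algebra.closure-generators x₀ (twist y) (twist≄0 y) ⊥y)

  code-exists : ∀ {k} → DependsOnBits f k → ¬ Constant f →
    ¬ ¬ (k ℕ.≤ n × ∃ λ α → ∃ λ β → Code f (sizeBound m k) α β)
  code-exists {k} depends ¬constant none =
    nonconstant ¬constant false λ (x₀ , fx₀) →
    nonconstant ¬constant true λ (y₀ , fy₀) →
    shift-Fin {P = λ i → Dec (p i ≃ℝ 0ᴿ)} (λ i → ¬¬-excluded-middle) λ zero? →
    shift-Vec shift-Bool {P = λ x → Dec (Perp p B x)} (λ x → ¬¬-excluded-middle) λ A? →
    shift-Vec shift-Bool {P = λ y → Dec (Perp p (Perp p B) y)} (λ y → ¬¬-excluded-middle) λ B? →
    generators false (false ∷ x₀ , x₀ , refl , fx₀) (false ∷ y₀)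
      (λ x Ax → orthogonal x (false ∷ y₀) Ax (y₀ , refl , fy₀)) λ (α , fα , α-generates) →
    generators true (false ∷ y₀ , y₀ , refl , fy₀) (false ∷ x₀)
      (λ y By → ℝ-CR.trans (ℝ-Algebra.pairing-comm p y (false ∷ x₀))
        (orthogonal (false ∷ x₀) y (x₀ , refl , fx₀) By)) λ (β , fβ , β-generates) →
    none (build x₀ fx₀ y₀ fy₀ zero? A? B? α fα α-generates β fβ β-generates)
    where
    build : ∀ x₀ → f x₀ ≡ just false → ∀ y₀ → f y₀ ≡ just true →
      (∀ i → Dec (p i ≃ℝ 0ᴿ)) → (∀ x → Dec (Perp p B x)) → (∀ y → Dec (Perp p (Perp p B) y)) →
      ∀ α → (∀ j → f (α j) ≡ just false) → (∀ x → f x ≡ just false → Generated α x) →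
      ∀ β → (∀ j → f (β j) ≡ just true) → (∀ x → f x ≡ just true → Generated β x) →
      k ℕ.≤ n × ∃ λ α → ∃ λ β → Code f (sizeBound m k) α β
    build x₀ fx₀ y₀ fy₀ zero? A? B? α fα α-generates β fβ β-generates =
      k≤n , α , β , record
        { false-generated = α-generates
        ; true-generated = β-generates
        -- A point of both spans would be orthogonal to itself, but its pairing with itself is the
        -- total weight 1.
        ; disjoint = λ x a b → 1≄0 (ℝ-CR.trans
            (ℝ-CR.sym (ℝ-CR.trans (ℝ-Algebra.pairing-self p (false ∷ x)) (proj₁ separating)))
            (β⊆ x b (false ∷ x) (α⊆ x a)))
        -- The two orthogonal sets contain the spans, and the bound on their sizes is known.
        ; covered = cover-widen x₀ size≤ (cover-⊆ (λ x → [ inj₁ ∘ α⊆ x , inj₂ ∘ β⊆ x ])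
            (cover-⊎ (cover-dec (λ x → A? (false ∷ x))) (cover-dec (λ y → B? (false ∷ y)))))
        }
      where
      α⊆ : ∀ x → Generated α x → Perp p B (false ∷ x)
      -- Orthogonality to y is linear, so it passes from the generators to their span.
      α⊆ x gen y By = gen (twist y) λ j → orthogonal (false ∷ α j) y (α j , refl , fα j) By

      β⊆ : ∀ y → Generated β y → Perp p (Perp p B) (false ∷ y)
      β⊆ y gen x x⊥B = gen (twist x) λ j →
        ℝ-CR.trans (ℝ-Algebra.pairing-comm p (false ∷ β j) x) (x⊥B (false ∷ β j) (β j , refl , fβ j))

      z = does (zero? zero)
      Z = tabulate (λ i → does (zero? (suc i)))

      lookup-Z : ∀ i → lookup (z ∷ Z) i ≡ does (zero? i)
      lookup-Z zero    = refl
      lookup-Z (suc i) = lookup∘tabulate (λ i → does (zero? (suc i))) i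

      zeros : ∀ i → lookup (z ∷ Z) i ≡ true → p i ≃ℝ 0ᴿ
      zeros i Zi = does⇒ (zero? i) (≡.trans (≡.sym (lookup-Z i)) Zi)

      nonzeros : ∀ i → lookup (z ∷ Z) i ≡ false → ¬ p i ≃ℝ 0ᴿ
      nonzeros i Zi pᵢ≃0 = contradiction
        (≡.trans (≡.sym Zi) (≡.trans (lookup-Z i) (dec-true (zero? i) pᵢ≃0))) λ ()

      some-nonzero : ∃ λ i → lookup (z ∷ Z) i ≡ false
      some-nonzero = let (i , pᵢ≄0) = Fin.¬∀⟶∃¬ (suc n) (λ i → p i ≃ℝ 0ᴿ) zero? p≄0 in
        i , ≡.trans (lookup-Z i) (dec-false (zero? i) pᵢ≄0)

      k≤∣∁Z∣ : k ℕ.≤ n ℕ.∸ ∣ Z ∣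
      k≤∣∁Z∣ = subst (k ℕ.≤_) (∣∁p∣≡n∸∣p∣ Z) (dependsOnBits≤ separating z Z zeros depends)

      k≤n : k ℕ.≤ n
      k≤n = ℕ.≤-trans k≤∣∁Z∣ (ℕ.m∸n≤m n ∣ Z ∣)

      ∣Z∣≤n∸k : ∣ Z ∣ ℕ.≤ n ℕ.∸ k
      ∣Z∣≤n∸k = subst (ℕ._≤ n ℕ.∸ k) (ℕ.m∸[m∸n]≡n (∣p∣≤n Z)) (ℕ.∸-monoʳ-≤ n k≤∣∁Z∣)

      ∣zZ∣≤ : ∀ z → ∣ z ∷ Z ∣ ℕ.≤ suc (n ℕ.∸ k)
      ∣zZ∣≤ true  = ℕ.s≤s ∣Z∣≤n∸k
      ∣zZ∣≤ false = ℕ.m≤n⇒m≤1+n ∣Z∣≤n∸k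

      size≤ : count (λ x → does (A? (false ∷ x))) ℕ.+ count (λ y → does (B? (false ∷ y)))
        ℕ.≤ sizeBound m k
      size≤ = ℕ.≤-trans
        (ℝ-Algebra.perp-sizes p (z ∷ Z) zeros nonzeros some-nonzero A? B?
          (false ∷ x₀ , λ y By → orthogonal (false ∷ x₀) y (x₀ , refl , fx₀) By)
          (false ∷ y₀ , y₀ , refl , fy₀))
        (ℕ.+-monoʳ-≤ (2 ℕ.^ m) (ℕ.^-monoʳ-≤ 2 (∣zZ∣≤ z)))

-- Counting codes

bitToFin : Bool → Fin 2
bitToFin b = if b then suc zero else zero

finToBit : Fin 2 → Bool
finToBit zero    = false
finToBit (suc _) = true

finToBit-bitToFin : ∀ b → finToBit (bitToFin b) ≡ b
finToBit-bitToFin false = refl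
finToBit-bitToFin true  = refl

encode : ∀ {n} → Vec Bool n → Fin (2 ℕ.^ n)
encode x = funToFin (bitToFin ∘ lookup x)

decode : ∀ {n} → Fin (2 ℕ.^ n) → Vec Bool n
decode c = tabulate (finToBit ∘ finToFun c)

decode-encode : ∀ {n} (x : Vec Bool n) → decode (encode x) ≡ x
decode-encode x = ≡.trans
  (tabulate-cong λ i → ≡.trans (cong finToBit (Fin.finToFun-funToFin (bitToFin ∘ lookup x) i))
    (finToBit-bitToFin (lookup x i)))
  (tabulate∘lookup x)

PointsCode : ℕ → Set
PointsCode n = Fin ((2 ℕ.^ n) ℕ.^ n)

points : ∀ {n} → PointsCode n → Fin n → Vec Bool n
points c j = decode (finToFun c j)

pointsCode : ∀ {n} → (Fin n → Vec Bool n) → PointsCode n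
pointsCode α = funToFin (encode ∘ α)

points-pointsCode : ∀ {n} (α : Fin n → Vec Bool n) j → points {n} (pointsCode α) j ≡ α j
points-pointsCode α j =
  ≡.trans (cong decode (Fin.finToFun-funToFin (encode ∘ α) j)) (decode-encode (α j))

Covered : ∀ n → ℕ → PointsCode n → PointsCode n → Set
Covered n M c d = FinCover M (λ x → Generated (points {n} c) x ⊎ Generated (points {n} d) x)

Coded : ∀ {n} → ℕ → PartialFunction n → Set
Coded {n} M f = Σ (PointsCode n) λ c → Σ (PointsCode n) λ d → Code f M (points c) (points d)

-- The bits record only where a function is defined; which of the two disjoint spans contains the
-- point decides the value. Every domain point lies in a span and hence on the cover.
code-determines : ∀ {n M} {f g : PartialFunction n} {α β} → Code f M α β → Code g M α β →
  (cover : FinCover M (λ x → Generated α x ⊎ Generated β x)) →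
  (∀ j → is-just (f (proj₁ cover j)) ≡ is-just (g (proj₁ cover j))) → ∀ x → f x ≡ g x
code-determines {f = f} {g} {α} {β} F G (e , onto) same x = go (f x) (g x) refl refl
  where
  module F = Code F
  module G = Code G
  domain : Generated α x ⊎ Generated β x → is-just (f x) ≡ is-just (g x)
  domain gen with onto x gen
  ... | j , refl = same j
  defined≢undefined : ∀ {a c : Maybe Bool} {b} → a ≡ just b → c ≡ nothing → ¬ is-just a ≡ is-just c
  defined≢undefined refl refl ()
  go : ∀ a b → f x ≡ a → g x ≡ b → f x ≡ g x
  go nothing nothing fx gx = ≡.trans fx (≡.sym gx)
  go (just false) (just false) fx gx = ≡.trans fx (≡.sym gx)
  go (just true) (just true) fx gx = ≡.trans fx (≡.sym gx)
  go (just false) (just true) fx gx =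
    contradiction (G.true-generated x gx) (F.disjoint x (F.false-generated x fx))
  go (just true) (just false) fx gx =
    contradiction (F.true-generated x fx) (F.disjoint x (G.false-generated x gx))
  go (just false) nothing fx gx =
    contradiction (domain (inj₁ (F.false-generated x fx))) (defined≢undefined fx gx)
  go (just true) nothing fx gx =
    contradiction (domain (inj₂ (F.true-generated x fx))) (defined≢undefined fx gx)
  go nothing (just false) fx gx =
    contradiction (≡.sym (domain (inj₁ (G.false-generated x gx)))) (defined≢undefined gx fx)
  go nothing (just true) fx gx =
    contradiction (≡.sym (domain (inj₂ (G.true-generated x gx)))) (defined≢undefined gx fx)

unique⇒lookup-injective : ∀ {n} {fs : List (PartialFunction n)} → Unique (PartialFunction-setoid n) fs →
  ∀ i j → (∀ x → List.lookup fs i x ≡ List.lookup fs j x) → i ≡ j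
unique⇒lookup-injective (_ ∷ _) zero zero _ = refl
unique⇒lookup-injective (f≢ ∷ _) zero (suc j) f≗g = contradiction f≗g (All.lookup f≢ (∈-lookup j))
unique⇒lookup-injective (f≢ ∷ _) (suc i) zero f≗g =
  contradiction (≡.sym ∘ f≗g) (All.lookup f≢ (∈-lookup i))
unique⇒lookup-injective (_ ∷ fs!) (suc i) (suc j) f≗g = cong suc (unique⇒lookup-injective fs! i j f≗g)

codeCount : ℕ → ℕ → ℕ
codeCount n M = ((2 ℕ.^ n) ℕ.^ n ℕ.* (2 ℕ.^ n) ℕ.^ n) ℕ.* 2 ℕ.^ M

-- Every coded function brings its own cover, but bits of two functions are comparable only along
-- the same one. Therefore `cover?` fixes a single cover for each pair of point codes.
length≤codeCount : ∀ {n M} {fs : List (PartialFunction n)} → Unique (PartialFunction-setoid n) fs →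
  All (Coded M) fs → (∀ c d → Dec (Covered n M c d)) → length fs ℕ.≤ codeCount n M
length≤codeCount {n} {M} {fs} fs! coded cover? = Fin.injective⇒≤ {f = code} code-injective
  where
  f : Fin (length fs) → PartialFunction n
  f = List.lookup fs

  codedAt : ∀ i → Coded M (f i)
  codedAt i = All.lookup coded (∈-lookup i)

  position : PointsCode n → PointsCode n → Fin M → Vec Bool n
  position c d with cover? c d
  ... | yes (e , _) = e
  -- An arbitrary value: a pair that belongs to a coded function always has a cover.
  ... | no _        = λ _ → tabulate λ _ → false

  bits : ∀ i → Fin M → Fin 2
  bits i = let (c , d , _) = codedAt i in bitToFin ∘ is-just ∘ f i ∘ position c d

  code : Fin (length fs) → Fin (codeCount n M)
  code i = let (c , d , _) = codedAt i in combine (combine c d) (funToFin (bits i))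

  code-injective : ∀ {i j} → code i ≡ code j → i ≡ j
  code-injective {i} {j} eq = unique⇒lookup-injective fs! i j
    (same (codedAt i) (codedAt j) cd≡ λ l → ≡.trans (≡.sym (finToBit-bitToFin _))
      (≡.trans (cong finToBit (bits≡ l)) (finToBit-bitToFin _)))
    where
    both≡ = Fin.combine-injective _ (funToFin (bits i)) _ (funToFin (bits j)) eq
    cd≡ : (proj₁ (codedAt i) ≡ proj₁ (codedAt j))
      × (proj₁ (proj₂ (codedAt i)) ≡ proj₁ (proj₂ (codedAt j)))
    cd≡ = Fin.combine-injective _ _ _ _ (proj₁ both≡)
    bits≡ : ∀ l → bits i l ≡ bits j l
    bits≡ l = ≡.trans (≡.sym (Fin.finToFun-funToFin (bits i) l))
      (≡.trans (cong (λ c → finToFun c l) (proj₂ both≡)) (Fin.finToFun-funToFin (bits j) l))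

    same : ∀ {f g} (F : Coded M f) (G : Coded M g) →
      (proj₁ F ≡ proj₁ G) × (proj₁ (proj₂ F) ≡ proj₁ (proj₂ G)) →
      (∀ l → is-just (f (position (proj₁ F) (proj₁ (proj₂ F)) l))
           ≡ is-just (g (position (proj₁ G) (proj₁ (proj₂ G)) l))) →
      ∀ x → f x ≡ g x
    same (c , d , F) (_ , _ , G) (refl , refl) agree with cover? c d
    ... | yes cover = code-determines F G cover agree
    ... | no ¬cover = contradiction (Code.covered F) ¬cover

¬¬-All : ∀ {A : Set} {P : A → Set} {xs : List A} → All (λ x → ¬ ¬ P x) xs → ¬ ¬ All P xs
¬¬-All []           none = none []
¬¬-All (¬¬p ∷ ¬¬ps) none = ¬¬p λ p → ¬¬-All ¬¬ps λ ps → none (p ∷ ps)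

-- Exponents

codeCount≡ : ∀ n M → codeCount n M ≡ 2 ℕ.^ (M ℕ.+ 2 ℕ.* n ℕ.^ 2)
codeCount≡ n M = begin
  ((2 ℕ.^ n) ℕ.^ n ℕ.* (2 ℕ.^ n) ℕ.^ n) ℕ.* 2 ℕ.^ M ≡⟨ cong (λ t → t ℕ.* t ℕ.* 2 ℕ.^ M) (ℕ.^-*-assoc 2 n n) ⟩
  (2 ℕ.^ (n ℕ.* n) ℕ.* 2 ℕ.^ (n ℕ.* n)) ℕ.* 2 ℕ.^ M ≡⟨ cong (ℕ._* 2 ℕ.^ M) (ℕ.^-distribˡ-+-* 2 (n ℕ.* n) (n ℕ.* n)) ⟨
  2 ℕ.^ (n ℕ.* n ℕ.+ n ℕ.* n) ℕ.* 2 ℕ.^ M           ≡⟨ ℕ.^-distribˡ-+-* 2 (n ℕ.* n ℕ.+ n ℕ.* n) M ⟨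
  2 ℕ.^ (n ℕ.* n ℕ.+ n ℕ.* n ℕ.+ M)                 ≡⟨ cong (2 ℕ.^_) (exponents n M) ⟩
  2 ℕ.^ (M ℕ.+ 2 ℕ.* n ℕ.^ 2)                       ∎
  where
  open ≡.≡-Reasoning
  exponents : ∀ n M → n ℕ.* n ℕ.+ n ℕ.* n ℕ.+ M ≡ M ℕ.+ 2 ℕ.* (n ℕ.* (n ℕ.* 1))
  exponents = ℕ-ring

zero≲ : ∀ c e → 0 ≲ c ·2^ e
zero≲ c (mkℚᵘ (+ p) d)      = ℕ.z≤n
zero≲ c (mkℚᵘ (-[1+ p ]) d) = ℕ.z≤n

^-distribʳ-* : ∀ q a b → (a ℕ.* b) ℕ.^ q ≡ a ℕ.^ q ℕ.* b ℕ.^ q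
^-distribʳ-* zero    a b = refl
^-distribʳ-* (suc q) a b = ≡.trans (cong (a ℕ.* b ℕ.*_) (^-distribʳ-* q a b))
  (ℕ.[m*n]*[o*p]≡[m*o]*[n*p] a b (a ℕ.^ q) (b ℕ.^ q))

-- For e = p / (d + 1) the relation compares (d + 1)-th powers, and E ≤ e means E (d + 1) ≤ p. A
-- negative e cannot lie above the natural number E.
≲-intro : ∀ {m c E} e → m ℕ.≤ c ℕ.* 2 ℕ.^ E → (+ E) ℚᵘ./ 1 ℚᵘ.≤ e → m ≲ c ·2^ e
≲-intro {m} {c} {E} (mkℚᵘ (+ p) d) m≤ (ℚᵘ.*≤* E≤) = begin
  m ℕ.^ suc d                           ≤⟨ ℕ.^-monoˡ-≤ (suc d) m≤ ⟩
  (c ℕ.* 2 ℕ.^ E) ℕ.^ suc d             ≡⟨ ^-distribʳ-* (suc d) c (2 ℕ.^ E) ⟩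
  c ℕ.^ suc d ℕ.* (2 ℕ.^ E) ℕ.^ suc d   ≡⟨ cong (c ℕ.^ suc d ℕ.*_) (ℕ.^-*-assoc 2 E (suc d)) ⟩
  c ℕ.^ suc d ℕ.* 2 ℕ.^ (E ℕ.* suc d)   ≤⟨ ℕ.*-monoʳ-≤ (c ℕ.^ suc d) (ℕ.^-monoʳ-≤ 2 Ed≤p) ⟩
  c ℕ.^ suc d ℕ.* 2 ℕ.^ p               ∎
  where
  open ℕ.≤-Reasoning
  Ed≤p : E ℕ.* suc d ℕ.≤ p
  Ed≤p = ℤ.drop‿+≤+ (≡.subst₂ ℤ._≤_ (≡.sym (ℤ.pos-* E (suc d))) (ℤ.*-identityʳ (+ p)) E≤)
≲-intro {E = E} (mkℚᵘ (-[1+ p ]) d) m≤ (ℚᵘ.*≤* E≤) =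
  contradiction (≡.subst₂ ℤ._≤_ (≡.sym (ℤ.pos-* E (suc d))) (ℤ.*-identityʳ -[1+ p ]) E≤) λ ()

a*b/b≃a : ∀ a b .{{_ : ℕ.NonZero b}} →
  ((+ (a ℕ.* b)) ℚᵘ./ 1) ℚᵘ.* ((+ 1) ℚᵘ./ b) ℚᵘ.≃ (+ a) ℚᵘ./ 1
a*b/b≃a a (suc b) = ℚᵘ.*≡* (≡.trans (ℤ.*-identityʳ _) (≡.trans (ℤ.*-identityʳ _)
  (≡.trans (ℤ.pos-* a (suc b)) (cong (λ t → (+ a) ℤ.* (+ suc t)) (≡.sym (ℕ.+-identityʳ b))))))

-- With n = m + 1 and k = j + 2 both sides are 2^(n+1-k), where k ≤ n keeps the truncated
-- subtraction exact. The cases j = 0 and j > 0 correspond to the two branches of `2^ℤ_`.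
2^≃ : ∀ m j → suc (suc j) ℕ.≤ suc m →
  ((+ (2 ℕ.^ m)) ℚᵘ./ 1) ℚᵘ.* 2^ℤ (+ 2 ℤ.- + suc (suc j))
    ℚᵘ.≃ (+ (2 ℕ.^ suc (suc m ℕ.∸ suc (suc j)))) ℚᵘ./ 1
2^≃ m zero (ℕ.s≤s 1≤m) = ℚᵘ.≃-trans
  (ℚᵘ.*-identityʳ ((+ (2 ℕ.^ m)) ℚᵘ./ 1))
  (ℚᵘ.≃-reflexive (cong (λ t → (+ (2 ℕ.^ t)) ℚᵘ./ 1) (≡.sym (ℕ.m+[n∸m]≡n 1≤m))))
2^≃ m (suc j) (ℕ.s≤s j+2≤m) = ℚᵘ.≃-trans
  (ℚᵘ.*-congʳ {2^ℤ (-[1+ j ])} (ℚᵘ.≃-reflexive (cong (λ t → (+ t) ℚᵘ./ 1) split)))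
  (a*b/b≃a (2 ℕ.^ suc (m ℕ.∸ suc (suc j))) (2 ℕ.^ suc j) {{ℕ.m^n≢0 2 (suc j)}})
  where
  split : 2 ℕ.^ m ≡ 2 ℕ.^ suc (m ℕ.∸ suc (suc j)) ℕ.* 2 ℕ.^ suc j
  split = ≡.trans
    (cong (2 ℕ.^_) (≡.trans (≡.sym (ℕ.m∸n+n≡m j+2≤m)) (ℕ.+-suc (m ℕ.∸ suc (suc j)) (suc j))))
    (ℕ.^-distribˡ-+-* 2 (suc (m ℕ.∸ suc (suc j))) (suc j))

+-/1 : ∀ a b → (+ (a ℕ.+ b)) ℚᵘ./ 1 ℚᵘ.≃ (+ a) ℚᵘ./ 1 ℚᵘ.+ (+ b) ℚᵘ./ 1
+-/1 a b = ℚᵘ.*≡* (cong (ℤ._* + 1) (≡.trans (ℤ.pos-+ a b)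
  (≡.sym (cong₂ ℤ._+_ (ℤ.*-identityʳ (+ a)) (ℤ.*-identityʳ (+ b))))))

exponent≃ : ∀ m j → suc (suc j) ℕ.≤ suc m → let n = suc m ; k = suc (suc j) in
  (+ (sizeBound m k ℕ.+ 2 ℕ.* n ℕ.^ 2)) ℚᵘ./ 1
    ℚᵘ.≃ ((2^ℤ (+ n ℤ.- + 1)) ℚᵘ.* (1ℚᵘ ℚᵘ.+ 2^ℤ (+ 2 ℤ.- + k))) ℚᵘ.+ (+ (2 ℕ.* n ℕ.^ 2)) ℚᵘ./ 1
exponent≃ m j k≤n = begin
  (+ (2 ℕ.^ m ℕ.+ B ℕ.+ C)) ℚᵘ./ 1
    ≈⟨ +-/1 (2 ℕ.^ m ℕ.+ B) C ⟩
  (+ (2 ℕ.^ m ℕ.+ B)) ℚᵘ./ 1 ℚᵘ.+ C/1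
    ≈⟨ ℚᵘ.+-congˡ C/1 (+-/1 (2 ℕ.^ m) B) ⟩
  (P ℚᵘ.+ (+ B) ℚᵘ./ 1) ℚᵘ.+ C/1
    ≈⟨ ℚᵘ.+-congˡ C/1 (ℚᵘ.+-cong (ℚᵘ.≃-sym (ℚᵘ.*-identityʳ P)) (ℚᵘ.≃-sym (2^≃ m j k≤n))) ⟩
  (P ℚᵘ.* 1ℚᵘ ℚᵘ.+ P ℚᵘ.* Q) ℚᵘ.+ C/1
    ≈⟨ ℚᵘ.+-congˡ C/1 (ℚᵘ.≃-sym (ℚᵘ.*-distribˡ-+ P 1ℚᵘ Q)) ⟩
  (P ℚᵘ.* (1ℚᵘ ℚᵘ.+ Q)) ℚᵘ.+ C/1 ∎
  where
  open SetoidReasoning ℚᵘ.≃-setoid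
  P = (+ (2 ℕ.^ m)) ℚᵘ./ 1
  B = 2 ℕ.^ suc (suc m ℕ.∸ suc (suc j))
  C = 2 ℕ.* suc m ℕ.^ 2
  Q = 2^ℤ (+ 2 ℤ.- + suc (suc j))
  C/1 = (+ C) ℚᵘ./ 1

-- The bound on the number of functions

module _ {m k : ℕ} where

  -- The inequality for k is carried along because it is what identifies the truncated exponent in
  -- `sizeBound` with the one in the theorem.
  codes : ∀ {f : PartialFunction (suc m)} → DependsOnBits f k × ExactQuantumQueryComplexityOne f →
    ¬ ¬ (k ℕ.≤ suc m × Coded (sizeBound m k) f)
  codes {f} (depends , exact) = go (separatingWeights exact)
    where
    go : ∃ (Separating f) → ¬ ¬ (k ℕ.≤ suc m × Coded (sizeBound m k) f)
    go (p , separating) = ¬¬-map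
      (λ (k≤n , α , β , code) → k≤n , pointsCode α , pointsCode β
        , Code-cong (≡.sym ∘ points-pointsCode α) (≡.sym ∘ points-pointsCode β) code)
      (code-exists {p = p} separating depends (proj₁ exact))

  length-bound : (fs : List (PartialFunction (suc m))) → Unique (PartialFunction-setoid (suc m)) fs →
    All (λ f → DependsOnBits f k × ExactQuantumQueryComplexityOne f) fs →
    length fs ℕ.≤ 2 ℕ.^ (sizeBound m k ℕ.+ 2 ℕ.* suc m ℕ.^ 2)
  length-bound fs fs! all = subst (length fs ℕ.≤_) (codeCount≡ (suc m) (sizeBound m k))
    (decidable-stable (length fs ℕ.≤? codeCount (suc m) (sizeBound m k)) λ length≰ →
      ¬¬-All (All.map (¬¬-map proj₂ ∘ codes) all) λ coded →
      -- There are finitely many pairs of point codes, so the existence of covers can be decided for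
      -- all of them under one double negation.
      shift-Fin {P = λ c → ∀ d → Dec (Covered (suc m) (sizeBound m k) c d)}
        (λ c → shift-Fin {P = λ d → Dec (Covered (suc m) (sizeBound m k) c d)}
          λ d → ¬¬-excluded-middle) λ cover? →
      length≰ (length≤codeCount fs! coded cover?))

open import Data.Nat.Base using (_≥_; _^_; _*_)

theorem5 : (n k : ℕ) → n ≥ 3 → k ≥ 2 →
    (fs : List (PartialFunction n)) → Unique (PartialFunction-setoid n) fs →
    All (λ f → DependsOnBits f k × ExactQuantumQueryComplexityOne f) fs →
    length fs ≲ n ^ 2 ·2^
    (((2^ℤ (+ n ℤ.- + 1)) ℚᵘ.* (1ℚᵘ ℚᵘ.+ 2^ℤ (+ 2 ℤ.- + k)))
    ℚᵘ.+ (+ (2 * n ^ 2)) ℚᵘ./ 1)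
-- The inequality k ≤ n comes from a function in the list, so the empty list is treated separately.
theorem5 n k _ _ [] _ _ = zero≲ (n ^ 2)
  (((2^ℤ (+ n ℤ.- + 1)) ℚᵘ.* (1ℚᵘ ℚᵘ.+ 2^ℤ (+ 2 ℤ.- + k))) ℚᵘ.+ (+ (2 * n ^ 2)) ℚᵘ./ 1)
theorem5 (suc m) (suc (suc j)) _ (ℕ.s≤s (ℕ.s≤s _)) fs@(_ ∷ _) fs! all@(f-counted ∷ _) = ≲-intro
  (((2^ℤ (+ suc m ℤ.- + 1)) ℚᵘ.* (1ℚᵘ ℚᵘ.+ 2^ℤ (+ 2 ℤ.- + suc (suc j))))
    ℚᵘ.+ (+ (2 * suc m ^ 2)) ℚᵘ./ 1)
  (ℕ.≤-trans (length-bound fs fs! all) (ℕ.m≤n*m _ (suc m ^ 2) {{ℕ.m^n≢0 (suc m) 2}}))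
  (ℚᵘ.≤-reflexive (exponent≃ m j
    (decidable-stable (suc (suc j) ℕ.≤? suc m) (¬¬-map proj₁ (codes f-counted)))))
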